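{- Let $T$ be a binary tree on $n\geq 12$ vertices. Let $l$ be the smallest positive odd integer such that $f_{T_{rg}^{l}}(r)>3\times 2^{\frac{n-l-1}{2}}-2$, where $r$ denotes the root of the rooted binary tree $T_{rg}^{l}$. Then $$d_T(C(T),S_c(T))\leq d_{T_{rg}^{n,l}}\big(C(T_{rg}^{n,l}),S_c(T_{rg}^{n,l})\big).$$
   Context: All graphs are finite, simple, connected and undirected. A pendant vertex is a vertex of degree $1$. A binary tree is a tree in which every non-pendant vertex has degree $3$ (so its number of vertices is even). Center and subtree core: the eccentricity of $v\in V(T)$ is $e(v)=\max_{u}d_T(u,v)$; the center $C(T)$ is the set of vertices of minimum eccentricity. A subtree of $T$ is a (nonempty) connected subgraph of $T$; $f_T(v)$ is the number of subtrees of $T$ containing $v$; the subtree core $S_c(T)$ is the set of vertices $v$ for which $f_T(v)$ is maximum. For $X,Y\subseteq V(T)$, $d_T(X,Y)=\min\{d_T(x,y):x\in X,y\in Y\}$. Rooted binary trees: a rooted binary tree is a rooted tree whose root has degree $2$ and in which every other vertex has degree $1$ or $3$; the single-vertex rooted tree is also allowed. The height (level) of a vertex is its distance to the root. A rooted binary tree is ordered if the vertices of each level $l\ge 1$ are linearly ordered so that two vertices at level $l+1$ with different parents are ordered as their parents are at level $l$. A rooted binary tree is rgood if (i) the heights of any two of its pendant vertices differ by at most $1$, and (ii) it can be ordered so that the parents of the pendant vertices at the highest level form a final segment in the ordering of the vertices at the next-to-highest level. For each odd $l$ there is, up to isomorphism, exactly one rgood binary tree on $l$ vertices, denoted $T_{rg}^l$.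 Crg trees: a binary caterpillar is a binary tree having a path such that every vertex not on the path is adjacent to a vertex of the path. For even $n\ge 4$ and odd $l$ with $3\le l<n$, the crg tree $T_{rg}^{n,l}$ is the tree on $n$ vertices obtained by identifying the root of $T_{rg}^l$ with a vertex of maximum eccentricity of a binary caterpillar on $n-l+1$ vertices. -}

module Defs where

open import Data.Bool.Base using (Bool; true; false)
open import Data.Fin.Base as Fin using (Fin; zero; suc; toℕ; fromℕ; inject₁)
open import Data.Fin.Properties as Fin using (all?; any?; pigeonhole; toℕ≤pred[n])
open import Data.Fin.Subset using (Subset; Nonempty) renaming (_∈_ to _∈ˢ_)
open import Data.Fin.Subset.Properties using (nonempty?) renaming (_∈?_ to _∈ˢ?_)
open import Data.List.Base
  using (List; []; _∷_; [_]; length; filter; map; allFin; cartesianProduct; cartesianProductWith)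
open import Data.List.Extrema.Nat using (max; min)
open import Data.Nat.Base
open import Data.Nat.Divisibility using (_∣_)
open import Data.Nat.DivMod using (_/_)
open import Data.Nat.Induction using (Acc; acc; <-wellFounded)
open import Data.Nat.Properties
open import Data.Product.Base using (Σ; ∃; ∃₂; _×_; _,_; proj₁; proj₂; uncurry)
open import Data.Sum.Base using (_⊎_)
open import Data.Vec.Base as Vec using (Vec; []; _∷_)
open import Function.Base using (_∘_; _on_)
open import Function.Bundles using (_⇔_)
open import Function.Definitions using (Injective)
open import Level using (0ℓ)
open import Relation.Binary.Core using (Rel)
open import Relation.Binary.Definitions using (Symmetric; Irreflexive; Decidable)
open import Relation.Binary.PropositionalEquality
  using (_≡_; _≢_; refl; sym; subst)
open import Relation.Binary.Structures using (IsStrictTotalOrder)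
open import Relation.Nullary using (¬_; Dec; yes; no; contradiction)
open import Relation.Nullary.Decidable using (map′; _×-dec_; _→-dec_)
import Relation.Unary as U

private
  variable
    a b n : ℕ

data Walk {n} (R : Rel (Fin n) 0ℓ) : ℕ → Rel (Fin n) 0ℓ where
  []  : ∀ {u} → Walk R 0 u u
  _∷_ : ∀ {k u v w} → R u v → Walk R k v w → Walk R (suc k) u w

Joined : Rel (Fin n) 0ℓ → Rel (Fin n) 0ℓ
Joined R u v = ∃ λ k → Walk R k u v

module _ {R : Rel (Fin n) 0ℓ} where

  private
    at : ∀ {k u v} → Walk R k u v → Fin (suc k) → Fin n
    at {u = u} _       zero    = u
    at         (_ ∷ w) (suc i) = at w i

    takeW : ∀ {k u v} (w : Walk R k u v) i → Walk R (toℕ i) u (at w i)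
    takeW w       zero    = []
    takeW (e ∷ w) (suc i) = e ∷ takeW w i

    dropW : ∀ {k u v} (w : Walk R k u v) i → Walk R (k ∸ toℕ i) (at w i) v
    dropW w       zero    = w
    dropW (e ∷ w) (suc i) = dropW w i

    _++W_ : ∀ {j k u v w} → Walk R j u v → Walk R k v w → Walk R (j + k) u w
    []      ++W q = q
    (e ∷ p) ++W q = e ∷ (p ++W q)

    shorten : ∀ {k u v} → Acc _<_ k → Walk R k u v → ∃ λ (j : Fin n) → Walk R (toℕ j) u v
    shorten {k} {u} {v} (acc rec) w with k <? n
    ... | yes k<n = Fin.fromℕ< k<n , subst (λ m → Walk R m u v) (sym (Fin.toℕ-fromℕ< k<n)) w
    ... | no  k≮n with pigeonhole (s≤s (≮⇒≥ k≮n)) (at w)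
    ...   | i , j , i<j , eq = shorten (rec shorter)
              (subst (Walk R (toℕ i) u) eq (takeW w i) ++W dropW w j)
      where
      shorter : toℕ i + (k ∸ toℕ j) < k
      shorter = subst (toℕ i + (k ∸ toℕ j) <_) (m+[n∸m]≡n (toℕ≤pred[n] j))
                      (+-monoˡ-< (k ∸ toℕ j) i<j)

  walk? : Decidable R → ∀ k u v → Dec (Walk R k u v)
  walk? R? zero    u v = map′ (λ { refl → [] }) (λ { [] → refl }) (u Fin.≟ v)
  walk? R? (suc k) u v = map′ (λ { (_ , e , w) → e ∷ w }) (λ { (e ∷ w) → _ , e , w })
                              (any? λ x → R? u x ×-dec walk? R? k x v)

  joined? : Decidable R → Decidable (Joined R)
  joined? R? u v = map′ (λ { (j , w) → toℕ j , w }) (λ { (k , w) → shorten (<-wellFounded k) w })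
                        (any? λ j → walk? R? (toℕ j) u v)

-- All graphs are finite, simple, undirected and connected.
record Graph (n : ℕ) : Set₁ where
  infix 4 _~_ _~?_
  field
    _~_        : Rel (Fin n) 0ℓ
    _~?_       : Decidable _~_
    symmetric  : Symmetric _~_
    irrefl     : Irreflexive _≡_ _~_
    connected  : ∀ u v → Joined _~_ u v

  degree : Fin n → ℕ
  degree v = length (filter (v ~?_) (allFin n))

  Pendant : Fin n → Set
  Pendant v = degree v ≡ 1

  IsPath : ∀ {k} → (Fin (suc k) → Fin n) → Set
  IsPath p = Injective _≡_ _≡_ p × (∀ i → p (inject₁ i) ~ p (suc i))

  IsCycle : ∀ {k} → (Fin (3 + k) → Fin n) → Set
  IsCycle {k} c = IsPath c × c (fromℕ (2 + k)) ~ c zero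

  IsTree : Set
  IsTree = ∀ {k} (c : Fin (3 + k) → Fin n) → ¬ IsCycle c

private
  least : {P : U.Pred ℕ 0ℓ} → U.Decidable P → ∀ k → P k → ∃ λ m → P m × (∀ {j} → P j → m ≤ j)
  least P? zero    p = 0 , p , λ _ → z≤n
  least P? (suc k) p with P? 0
  ... | yes p₀ = 0 , p₀ , λ _ → z≤n
  ... | no ¬p₀ with m , pₘ , lb ← least (P? ∘ suc) k p =
    suc m , pₘ , λ { {zero} p₀ → contradiction p₀ ¬p₀ ; {suc j} pⱼ → s≤s (lb pⱼ) }

module _ (G : Graph n) where
  open Graph G

  shortest : ∀ u v → ∃ λ d → Walk _~_ d u v × (∀ {k} → Walk _~_ k u v → d ≤ k)
  shortest u v with k , w ← connected u v = least (λ j → walk? _~?_ j u v) k w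

  dist : Fin n → Fin n → ℕ
  dist u v = proj₁ (shortest u v)

  ecc : Fin n → ℕ
  ecc v = max 0 (map (dist v) (allFin n))

  Center : U.Pred (Fin n) 0ℓ
  Center v = ∀ u → ecc v ≤ ecc u

  center? : U.Decidable Center
  center? v = all? λ u → ecc v ≤? ecc u

  -- The default value n is never attained when both sets are nonempty,
  -- since distances in a connected graph on n vertices are less than n.
  setDist : {P Q : U.Pred (Fin n) 0ℓ} → U.Decidable P → U.Decidable Q → ℕ
  setDist P? Q? =
    min n (map (uncurry dist) (cartesianProduct (filter P? (allFin n)) (filter Q? (allFin n))))

-- A candidate subgraph: a vertex set together with the rows of an adjacency
-- matrix, so that an edge set is a symmetric matrix and is counted once.
record Sub (n : ℕ) : Set where
  constructor _,_
  field
    vertices : Subset n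
    rows     : Vec (Subset n) n

  Edge : Rel (Fin n) 0ℓ
  Edge u v = v ∈ˢ Vec.lookup rows u

  edge? : Decidable Edge
  edge? u v = v ∈ˢ? Vec.lookup rows u

allVecs : {A : Set} → List A → ∀ k → List (Vec A k)
allVecs xs zero    = [ [] ]
allVecs xs (suc k) = cartesianProductWith _∷_ xs (allVecs xs k)

allSubsets : ∀ n → List (Subset n)
allSubsets = allVecs (true ∷ false ∷ [])

allSubs : ∀ n → List (Sub n)
allSubs n = cartesianProductWith _,_ (allSubsets n) (allVecs (allSubsets n) n)

module _ (G : Graph n) where
  open Graph G

  IsSubgraph : Sub n → Set
  IsSubgraph S = (∀ u v → Edge u v → u ~ v × Edge v u × u ∈ˢ vertices)
    where open Sub S

  IsConnected : Sub n → Set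
  IsConnected S = ∀ u v → u ∈ˢ vertices → v ∈ˢ vertices → Joined Edge u v
    where open Sub S

  IsSubtree : Sub n → Set
  IsSubtree S = IsSubgraph S × Nonempty (Sub.vertices S) × IsConnected S

  isSubtree? : U.Decidable IsSubtree
  isSubtree? S =
          (all? λ u → all? λ v → edge? u v →-dec (u ~? v ×-dec edge? v u ×-dec u ∈ˢ? vertices))
    ×-dec nonempty? vertices
    ×-dec (all? λ u → all? λ v → u ∈ˢ? vertices →-dec (v ∈ˢ? vertices →-dec joined? edge? u v))
    where open Sub S

  subtreeCount : Fin n → ℕ
  subtreeCount v =
    length (filter (λ S → isSubtree? S ×-dec v ∈ˢ? Sub.vertices S) (allSubs n))

  SubtreeCore : U.Pred (Fin n) 0ℓ
  SubtreeCore v = ∀ u → subtreeCount u ≤ subtreeCount v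

  subtreeCore? : U.Decidable SubtreeCore
  subtreeCore? v = all? λ u → subtreeCount u ≤? subtreeCount v

  centerCoreDist : ℕ
  centerCoreDist = setDist G (center? G) subtreeCore?

  IsBinaryTree : Set
  IsBinaryTree = IsTree × (∀ v → ¬ Pendant v → degree v ≡ 3)

  IsBinaryCaterpillar : Set
  IsBinaryCaterpillar = IsBinaryTree ×
    ∃₂ λ k (p : Fin (suc k) → Fin n) →
      IsPath p × (∀ v → (∀ i → p i ≢ v) → ∃ λ i → v ~ p i)

  module _ (root : Fin n) where

    IsRootedBinaryTree : Set
    IsRootedBinaryTree = IsTree ×
      (n ≡ 1 ⊎ (degree root ≡ 2 × (∀ v → v ≢ root → degree v ≡ 1 ⊎ degree v ≡ 3)))

    height : Fin n → ℕ
    height = dist G root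

    _ParentOf_ : Rel (Fin n) 0ℓ
    p ParentOf v = p ~ v × height v ≡ suc (height p)

    -- Level 0 consists of the root alone, so ordering it as well and imposing
    -- the compatibility condition there adds nothing.
    record IsOrdering (_≺_ : Rel (Fin n) 0ℓ) : Set where
      field
        linear     : ∀ h → IsStrictTotalOrder {A = ∃ λ v → height v ≡ h}
                             (_≡_ on proj₁) (_≺_ on proj₁)
        compatible : ∀ {p q u v} → height u ≡ height v → p ParentOf u → q ParentOf v →
                     p ≢ q → p ≺ q → u ≺ v

    HighestPendantParent : U.Pred (Fin n) 0ℓ
    HighestPendantParent p =
      ∃ λ v → Pendant v × (∀ w → height w ≤ height v) × p ParentOf v

    record IsRGood : Set₁ where
      field
        balanced     : ∀ {u v} → Pendant u → Pendant v → height u ≤ suc (height v)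
        _≺_          : Rel (Fin n) 0ℓ
        isOrdering   : IsOrdering _≺_
        finalSegment : ∀ {p q} → HighestPendantParent p → height q ≡ height p → p ≺ q →
                       HighestPendantParent q

    IsRGoodBinaryTree : Set₁
    IsRGoodBinaryTree = IsRootedBinaryTree × IsRGood

-- G is, up to isomorphism, obtained from the disjoint union of H and K by
-- identifying the vertex h of H with the vertex k of K.
record IsIdentification (G : Graph n) (H : Graph a) (h : Fin a) (K : Graph b) (k : Fin b) : Set where
  private
    module G = Graph G
    module H = Graph H
    module K = Graph K
  field
    φ          : Fin a → Fin n
    ψ          : Fin b → Fin n
    φ-inj      : Injective _≡_ _≡_ φ
    ψ-inj      : Injective _≡_ _≡_ ψ
    identified : φ h ≡ ψ k
    disjoint   : ∀ {x y} → φ x ≡ ψ y → x ≡ h × y ≡ k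
    cover      : ∀ v → (∃ λ x → φ x ≡ v) ⊎ (∃ λ y → ψ y ≡ v)
    edges      : ∀ {u v} → u G.~ v ⇔
                 ((∃₂ λ x x′ → φ x ≡ u × φ x′ ≡ v × x H.~ x′) ⊎
                  (∃₂ λ y y′ → ψ y ≡ u × ψ y′ ≡ v × y K.~ y′))

-- G is a copy of the crg tree on n vertices with parameter l.
IsCrg : ∀ n l → Graph n → Set₁
IsCrg n l G =
  Σ (Graph l) λ R → Σ (Fin l) λ r → IsRGoodBinaryTree R r ×
  Σ (Graph (n ∸ l + 1)) λ H → Σ (Fin (n ∸ l + 1)) λ h →
    IsBinaryCaterpillar H × (∀ u → ecc H u ≤ ecc H h) ×
    IsIdentification G R r H h

-- The rgood binary tree on l vertices is unique up to isomorphism, so it is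
-- given here by any representative.  Truncated subtraction in the exponent
-- only matters for l ≥ n, and the bound is already met at l = n - 1.
RootCountExceeds : ℕ → ℕ → Set₁
RootCountExceeds n l =
  Σ (Graph l) λ R → Σ (Fin l) λ r → IsRGoodBinaryTree R r ×
    subtreeCount R r > 3 * 2 ^ ((n ∸ l ∸ 1) / 2) ∸ 2

Odd : ℕ → Set
Odd l = ¬ (2 ∣ l)

IsLeastOddExceeding : ℕ → ℕ → Set₁
IsLeastOddExceeding n l =
  Odd l × RootCountExceeds n l × (∀ m → Odd m → RootCountExceeds n m → l ≤ m)

-- Deleting an edge uv of a tree gives f(u) - f(v) = a - b, where a and b count the subtrees of
-- the two components that contain u, respectively v.  Let s and c be a nearest pair of a core
-- vertex and a center vertex of T, at distance d > 0, and let A and B be the components of the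
-- first edge of the path from s to c, with s in A.  Then a > b, and comparing eccentricities near
-- c gives 2d + height A <= 1 + i(B), where i counts inner vertices.  Complete (rgood) trees
-- maximise the number of root subtrees for given order, and b >= 3 * 2 ^ i(B) - 2, so that A has
-- at least l vertices; the rgood tree on l vertices is no higher than A.  Hence
-- 2d + height R <= 1 + i(H) in the crg tree, and there a midpoint argument on the spine shows that
-- every center vertex is at distance at least d from the head R, which contains the core.
--
-- Optimality of complete trees: writing x(i) for 1 + the number of root subtrees of the complete
-- tree with i inner vertices, x(j) x(k) has to be maximal, for fixed j + k, at the split of a
-- complete tree.  Expanding both factors by x(1 + a + b) = 1 + x(a) x(b), exchanges of
-- subtrees reduce to the case where one factor can be taken out, which leads to the same problem
-- for (u x(j) + v) (u x(k) + v); this weighted product is what the induction is about.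

module Submission where

open import Data.Bool.Base using (true; false)
open import Data.Empty using (⊥; ⊥-elim)
open import Data.Fin.Base as Fin using (Fin; zero; suc; toℕ; fromℕ; inject; inject₁)
import Data.Fin.Properties as Fin
open import Data.Fin.Subset using (Subset) renaming (_∈_ to _∈ˢ_)
open import Data.Fin.Subset.Properties using (⊆-antisym) renaming (_∈?_ to _∈ˢ?_)
open import Data.List.Base
  using (List; []; _∷_; _++_; map; length; allFin; upTo; filter; cartesianProduct; cartesianProductWith)
open import Data.List.Extrema.Nat
  using (max≤v⁺; xs≤max; v≤min⁺; min≤xs; argmax; argmax-all; f[xs]≤f[argmax]; f[argmin]≤f[xs])
open import Data.List.Membership.Propositional using (_∈_)
open import Data.List.Membership.Propositional.Properties
open import Data.List.Properties using (length-++; length-map; length-tabulate)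
open import Data.List.Relation.Unary.All as All using ([]; _∷_)
import Data.List.Relation.Unary.All.Properties as All
open import Data.List.Relation.Unary.AllPairs using ([]; _∷_)
open import Data.List.Relation.Unary.Any using (here; there)
open import Data.List.Relation.Unary.Unique.Propositional using (Unique)
import Data.List.Relation.Unary.Unique.Propositional.Properties as Unique
open import Data.Maybe.Base using (Maybe; just; nothing)
open import Data.Maybe.Properties using (just-injective)
open import Data.Maybe.Relation.Unary.Any using (just) renaming (Any to Anyᵐ)
open import Data.Nat.Base
open import Data.Nat.Divisibility using (_∣_; divides; ∣m+n∣m⇒∣n; ∣1⇒≡1)
open import Data.Nat.DivMod using (_/_; m*n/n≡m)
open import Data.Nat.Induction using (Acc; acc; <-wellFounded)
open import Data.Nat.Properties
open import Data.Nat.Tactic.RingSolver using (solve-∀)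
open import Data.Product.Base using (∃; ∃₂; _×_; _,_; proj₁; proj₂)
open import Data.Sum.Base using (_⊎_; inj₁; inj₂)
open import Data.Vec.Base using (Vec; []; _∷_; lookup; tabulate)
open import Data.Vec.Properties
  using (lookup⇒[]=; []=⇒lookup; tabulate∘lookup; lookup∘tabulate; tabulate-cong; ∷-injective)
open import Function.Base using (_∘_; id; case_of_)
open import Function.Bundles using (Equivalence)
open import Function.Definitions using (Injective)
open import Level using (0ℓ)
import Relation.Binary.Construct.Flip.EqAndOrd as Flip
import Relation.Binary.Construct.On as On
open import Relation.Binary.Core using (Rel)
open import Relation.Binary.Definitions using (tri<; tri≈; tri>)
open import Relation.Binary.PropositionalEquality
open import Relation.Binary.Structures using (IsStrictTotalOrder)
open import Relation.Nullary using (¬_; Dec; yes; no; does; contradiction)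
open import Relation.Nullary.Decidable using (_×-dec_; _⊎-dec_; map′; dec-true)
import Relation.Unary as U
open import Defs

-- The weighted product meets an obstacle: exchanging a subtree with a whole factor gains only while
-- `v * B < u + v` for the value `B` of its sibling. Factoring out `B` turns the weights into
-- `u * B` and `u + v`, and their condition at `B`, `(u + v) * B < u * B + (u + v)`, is the old one
-- again. So the induction carries a level `N`: both factors are capped at `fullSize (suc N)`, and
-- every subtree below their roots stays within `fullSize N`, where the condition is assumed.
-- Weights 1 and 0 satisfy it at every level.
--
-- The threshold `3 * 2 ^ i ∸ 2` is the number of root subtrees of a caterpillar with `i` inner
-- vertices hung up at its end, the least for that `i`. The same number therefore bounds `b` from
-- below in `T` and equals the count of the tail in the crg tree, so that one inequality on `l`
-- serves both trees.
--
-- Components are read off as a `Shape` through `Branch`, which makes orders, heights and counts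
-- recursive functions. Leastness of `l` can be applied only to an rgood tree that is at hand, hence
-- the explicit trees in breadth-first numbering.

private
  variable
    a b m n j k : ℕ

-- Complete binary trees

fullSize : ℕ → ℕ
fullSize zero    = 0
fullSize (suc h) = suc (fullSize h + fullSize h)

fullVal : ℕ → ℕ
fullVal zero    = 2
fullVal (suc h) = suc (fullVal h * fullVal h)

-- HeapVal h i x: a complete binary tree with i inner vertices, all of whose leaves
-- are at depth h or suc h, has x = 1 + (number of subtrees containing the root).
data HeapVal : ℕ → ℕ → ℕ → Set where
  leaf   : HeapVal 0 0 2
  cherry : HeapVal 0 1 5
  low    : ∀ {h i x} → HeapVal h i x → HeapVal (suc h) (suc (fullSize h + i)) (suc (fullVal h * x))
  high   : ∀ {h i x} → HeapVal h i x →
           HeapVal (suc h) (suc (fullSize (suc h) + i)) (suc (fullVal (suc h) * x))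

fullSize-< : ∀ h → fullSize h < fullSize (suc h)
fullSize-< h = s≤s (m≤m+n (fullSize h) (fullSize h))

fullSize-mono : ∀ {g h} → g ≤ h → fullSize g ≤ fullSize h
fullSize-mono z≤n       = z≤n
fullSize-mono (s≤s g≤h) = s≤s (+-mono-≤ (fullSize-mono g≤h) (fullSize-mono g≤h))

fullSize-cancel-< : ∀ g h → fullSize g < fullSize h → g < h
fullSize-cancel-< g h lt = ≰⇒> λ h≤g → <⇒≱ lt (fullSize-mono h≤g)

fullVal>0 : ∀ h → 0 < fullVal h
fullVal>0 zero    = s≤s z≤n
fullVal>0 (suc h) = s≤s z≤n

heapVal-≥ : ∀ {h i x} → HeapVal h i x → fullSize h ≤ i
heapVal-≥ leaf           = z≤n
heapVal-≥ cherry         = z≤n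
heapVal-≥ (low {h} t)    = s≤s (+-monoʳ-≤ (fullSize h) (heapVal-≥ t))
heapVal-≥ (high {h} t)   =
  s≤s (+-mono-≤ (<⇒≤ (fullSize-< h)) (heapVal-≥ t))

heapVal-≤ : ∀ {h i x} → HeapVal h i x → i ≤ fullSize (suc h)
heapVal-≤ leaf         = z≤n
heapVal-≤ cherry       = ≤-refl
heapVal-≤ (low {h} t)  = s≤s (+-mono-≤ (<⇒≤ (fullSize-< h)) (heapVal-≤ t))
heapVal-≤ (high {h} t) = s≤s (+-monoʳ-≤ (fullSize (suc h)) (heapVal-≤ t))

bottom : ∀ h → HeapVal h (fullSize h) (fullVal h)
bottom zero    = leaf
bottom (suc h) = low (bottom h)

top : ∀ h → HeapVal h (fullSize (suc h)) (fullVal (suc h))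
top zero    = cherry
top (suc h) = high (top h)

private
  -- The size ranges of `low` and `high` meet in one value only; there the two subtrees are perfect
  -- of heights `h` and `suc h`, merely swapped.
  high≤low : ∀ h {i j} → fullSize (suc h) + i ≤ fullSize h + j → fullSize h ≤ i → j ≤ fullSize (suc h) →
             i ≤ fullSize h × fullSize (suc h) ≤ j
  high≤low h {i} {j} le i≥ j≤ =
      +-cancelˡ-≤ (fullSize (suc h)) i (fullSize h)
        (≤-trans le (≤-trans (+-monoʳ-≤ (fullSize h) j≤) (≤-reflexive (+-comm (fullSize h) _))))
    , +-cancelˡ-≤ (fullSize h) (fullSize (suc h)) j
        (≤-trans (≤-reflexive (+-comm (fullSize h) (fullSize (suc h))))
              (≤-trans (+-monoʳ-≤ (fullSize (suc h)) i≥) le))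

heapVal-mono-≤ : ∀ {h i j x y} → HeapVal h i x → HeapVal h j y → i ≤ j → x ≤ y
heapVal-mono-≤ leaf leaf _        = ≤-refl
heapVal-mono-≤ leaf cherry _      = s≤s (s≤s z≤n)
heapVal-mono-≤ cherry cherry _    = ≤-refl
heapVal-mono-≤ (low {h} t) (low t′) (s≤s le) =
  s≤s (*-monoʳ-≤ (fullVal h) (heapVal-mono-≤ t t′ (+-cancelˡ-≤ (fullSize h) _ _ le)))
heapVal-mono-≤ (high {h} t) (high t′) (s≤s le) =
  s≤s (*-monoʳ-≤ (fullVal (suc h)) (heapVal-mono-≤ t t′ (+-cancelˡ-≤ (fullSize (suc h)) _ _ le)))
heapVal-mono-≤ (low {h} {_} {x} t) (high {_} {_} {y} t′) _ = s≤s (begin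
  fullVal h * x             ≤⟨ *-monoʳ-≤ (fullVal h) (heapVal-mono-≤ t (top h) (heapVal-≤ t)) ⟩
  fullVal h * fullVal (suc h) ≡⟨ *-comm (fullVal h) _ ⟩
  fullVal (suc h) * fullVal h ≤⟨ *-monoʳ-≤ (fullVal (suc h)) (heapVal-mono-≤ (bottom h) t′ (heapVal-≥ t′)) ⟩
  fullVal (suc h) * y       ∎)
  where open ≤-Reasoning
heapVal-mono-≤ (high {h} {_} {x} t) (low {_} {_} {y} t′) (s≤s le)
  with i≤ , j≥ ← high≤low h le (heapVal-≥ t) (heapVal-≤ t′) = s≤s (begin
  fullVal (suc h) * x         ≤⟨ *-monoʳ-≤ (fullVal (suc h)) (heapVal-mono-≤ t (bottom h) i≤) ⟩
  fullVal (suc h) * fullVal h ≡⟨ *-comm (fullVal (suc h)) _ ⟩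
  fullVal h * fullVal (suc h) ≤⟨ *-monoʳ-≤ (fullVal h) (heapVal-mono-≤ (top h) t′ j≥) ⟩
  fullVal h * y               ∎)
  where open ≤-Reasoning

heapVal-unique : ∀ {h i x y} → HeapVal h i x → HeapVal h i y → x ≡ y
heapVal-unique t t′ = ≤-antisym (heapVal-mono-≤ t t′ ≤-refl) (heapVal-mono-≤ t′ t ≤-refl)

heapVal-mono-< : ∀ {h i j x y} → HeapVal h i x → HeapVal h j y → i < j → x < y
heapVal-mono-< leaf cherry _        = s≤s (s≤s (s≤s z≤n))
heapVal-mono-< cherry cherry (s≤s ())
heapVal-mono-< (low {h} t) (low t′) (s≤s le) =
  s≤s (*-monoʳ-< (fullVal h) {{>-nonZero (fullVal>0 h)}} (heapVal-mono-< t t′ (+-cancelˡ-< (fullSize h) _ _ le)))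
heapVal-mono-< (high {h} t) (high t′) (s≤s le) =
  s≤s (*-monoʳ-< (fullVal (suc h)) (heapVal-mono-< t t′ (+-cancelˡ-< (fullSize (suc h)) _ _ le)))
heapVal-mono-< (low {h} {i} {x} t) (high {_} {j} {y} t′) (s≤s lt) with i <? fullSize (suc h)
... | yes i< = s≤s (begin-strict
  fullVal h * x               <⟨ *-monoʳ-< (fullVal h) {{>-nonZero (fullVal>0 h)}} (heapVal-mono-< t (top h) i<) ⟩
  fullVal h * fullVal (suc h) ≡⟨ *-comm (fullVal h) _ ⟩
  fullVal (suc h) * fullVal h ≤⟨ *-monoʳ-≤ (fullVal (suc h)) (heapVal-mono-≤ (bottom h) t′ (heapVal-≥ t′)) ⟩
  fullVal (suc h) * y         ∎)
  where open ≤-Reasoning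
... | no  i≮ = s≤s (begin-strict
  fullVal h * x               ≤⟨ *-monoʳ-≤ (fullVal h) (heapVal-mono-≤ t (top h) (heapVal-≤ t)) ⟩
  fullVal h * fullVal (suc h) ≡⟨ *-comm (fullVal h) _ ⟩
  fullVal (suc h) * fullVal h <⟨ *-monoʳ-< (fullVal (suc h)) (heapVal-mono-< (bottom h) t′ j>) ⟩
  fullVal (suc h) * y         ∎)
  where
  open ≤-Reasoning
  j> : fullSize h < j
  j> = +-cancelˡ-< (fullSize (suc h)) _ _ (≤-<-trans
    (≤-trans (≤-reflexive (+-comm _ (fullSize h))) (+-monoʳ-≤ (fullSize h) (≮⇒≥ i≮))) lt)
heapVal-mono-< (high {h} t) (low t′) (s≤s lt) = contradiction lt
  (≤⇒≯ (≤-trans (+-monoʳ-≤ (fullSize h) (heapVal-≤ t′))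
       (≤-trans (≤-reflexive (+-comm (fullSize h) _)) (+-monoʳ-≤ (fullSize (suc h)) (heapVal-≥ t)))))

heapVal : ∀ h {i} → fullSize h ≤ i → i ≤ fullSize (suc h) → ∃ (HeapVal h i)
heapVal zero {zero}        _ _ = 2 , leaf
heapVal zero {suc zero}    _ _ = 5 , cherry
heapVal zero {suc (suc i)} _ (s≤s ())
heapVal (suc h) {suc m} (s≤s ge) (s≤s le) with m ≤? fullSize h + fullSize (suc h)
... | yes m≤ with i , refl ← m≤n⇒∃[o]m+o≡n (≤-trans (m≤m+n (fullSize h) _) ge)
             with x , t ← heapVal h (+-cancelˡ-≤ (fullSize h) _ _ ge) (+-cancelˡ-≤ (fullSize h) _ _ m≤) = _ , low t
... | no  m≰ with i , refl ← m≤n⇒∃[o]m+o≡n (≤-trans (m≤n+m (fullSize (suc h)) (fullSize h)) (<⇒≤ (≰⇒> m≰)))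
             with x , t ← heapVal h (+-cancelˡ-≤ (fullSize (suc h)) _ _
                   (≤-trans (≤-reflexive (+-comm (fullSize (suc h)) _)) (<⇒≤ (≰⇒> m≰))))
                   (+-cancelˡ-≤ (fullSize (suc h)) _ _ le) = _ , high t

level : ∀ i → ∃ λ h → fullSize h ≤ i × i < fullSize (suc h)
level zero = 0 , z≤n , s≤s z≤n
level (suc i) with level i
... | h , ge , lt with suc i <? fullSize (suc h)
...   | yes lt′ = h , m≤n⇒m≤1+n ge , lt′
...   | no  ≮   = suc h , ≮⇒≥ ≮ , ≤-<-trans lt (fullSize-< (suc h))

level-unique : ∀ {g h i} → fullSize g ≤ i → i < fullSize (suc g) → fullSize h ≤ i → i < fullSize (suc h) → g ≡ h
level-unique {g} {h} ge lt ge′ lt′ = ≤-antisym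
  (≤-pred (fullSize-cancel-< g (suc h) (≤-<-trans ge lt′))) (≤-pred (fullSize-cancel-< h (suc g) (≤-<-trans ge′ lt)))

-- A perfect tree occurs at two levels, once with a full and once with an empty last level. The
-- strict bound makes `g` the second reading, and `h` may be either.
heapVal-unique′ : ∀ {g h i x y} → i < fullSize (suc g) → HeapVal g i x → HeapVal h i y → x ≡ y
heapVal-unique′ {g} {h} {i} lt t t′ with i <? fullSize (suc h)
... | yes lt′ with refl ← level-unique {g} {h} (heapVal-≥ t) lt (heapVal-≥ t′) lt′ = heapVal-unique t t′
... | no  ≮   with refl ← ≤-antisym (heapVal-≤ t′) (≮⇒≥ ≮)
              with refl ← level-unique {g} {suc h} (heapVal-≥ t) lt ≤-refl (fullSize-< (suc h)) =
  trans (heapVal-unique t (bottom (suc h))) (heapVal-unique (top h) t′)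

abstract
  -- The value of the complete tree with `i` inner vertices; that it is the maximum over all shapes
  -- is established only by `rootedSubtrees-≤`.
  maxVal : ℕ → ℕ
  maxVal i with h , ge , lt ← level i = proj₁ (heapVal h ge (<⇒≤ lt))

  maxVal≡ : ∀ {h i x} → HeapVal h i x → maxVal i ≡ x
  maxVal≡ {i = i} t with h , ge , lt ← level i = heapVal-unique′ lt (proj₂ (heapVal h ge (<⇒≤ lt))) t

maxVal-full : ∀ h → maxVal (fullSize h) ≡ fullVal h
maxVal-full h = maxVal≡ (bottom h)

maxVal-low : ∀ h {i} → fullSize h ≤ i → i ≤ fullSize (suc h) → maxVal (suc (fullSize h + i)) ≡ suc
      (maxVal (fullSize h) * maxVal i)
maxVal-low h ge le with x , t ← heapVal h ge le =
  trans (maxVal≡ (low t)) (cong suc (cong₂ _*_ (sym (maxVal-full h)) (sym (maxVal≡ t))))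

maxVal-high : ∀ h {i} → fullSize h ≤ i → i ≤ fullSize (suc h) →
         maxVal (suc (fullSize (suc h) + i)) ≡ suc (maxVal (fullSize (suc h)) * maxVal i)
maxVal-high h ge le with x , t ← heapVal h ge le =
  trans (maxVal≡ (high t)) (cong suc (cong₂ _*_ (sym (maxVal-full (suc h))) (sym (maxVal≡ t))))

maxVal-<-suc : ∀ i → maxVal i < maxVal (suc i)
maxVal-<-suc i with h , ge , lt ← level i
  with x , t ← heapVal h ge (<⇒≤ lt) | y , t′ ← heapVal h (m≤n⇒m≤1+n ge) lt =
  subst₂ _<_ (sym (maxVal≡ t)) (sym (maxVal≡ t′)) (heapVal-mono-< t t′ ≤-refl)

maxVal-mono-≤ : ∀ {i j} → i ≤ j → maxVal i ≤ maxVal j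
maxVal-mono-≤ i≤j = go (≤⇒≤′ i≤j)
  where
  go : ∀ {i j} → i ≤′ j → maxVal i ≤ maxVal j
  go ≤′-refl       = ≤-refl
  go (≤′-step i≤j) = ≤-trans (go i≤j) (<⇒≤ (maxVal-<-suc _))

maxVal-mono-< : ∀ {i j} → i < j → maxVal i < maxVal j
maxVal-mono-< i<j = <-≤-trans (maxVal-<-suc _) (maxVal-mono-≤ i<j)

maxVal>0 : ∀ i → 0 < maxVal i
maxVal>0 i = ≤-trans (subst (0 <_) (sym (maxVal≡ leaf)) (s≤s z≤n)) (maxVal-mono-≤ z≤n)

-- The sizes of the two subtrees below the root of a complete tree, the larger one first: the last
-- level fills from the larger side, so that one subtree is always perfect.
data Split : ℕ → ℕ → Set where
  low  : ∀ h {a} → fullSize h ≤ a → a ≤ fullSize (suc h) → Split a (fullSize h)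
  high : ∀ h {b} → fullSize h ≤ b → b ≤ fullSize (suc h) → Split (fullSize (suc h)) b

maxVal-split : ∀ {a b} → Split a b → maxVal (suc (a + b)) ≡ suc (maxVal a * maxVal b)
maxVal-split (low h {a} ge le) = begin
  maxVal (suc (a + fullSize h))        ≡⟨ cong (maxVal ∘ suc) (+-comm a _) ⟩
  maxVal (suc (fullSize h + a))        ≡⟨ maxVal-low h ge le ⟩
  suc (maxVal (fullSize h) * maxVal a)      ≡⟨ cong suc (*-comm (maxVal (fullSize h)) _) ⟩
  suc (maxVal a * maxVal (fullSize h))      ∎
  where open ≡-Reasoning
maxVal-split (high h ge le) = maxVal-high h ge le

split-≥ : ∀ {a b} → Split a b → b ≤ a
split-≥ (low h ge le)  = ge
split-≥ (high h ge le) = le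

split : ∀ m → ∃₂ λ a b → Split a b × a + b ≡ m
split m with level (suc m)
... | zero  , _ , s≤s ()
... | suc h , s≤s ge , s≤s lt with m ≤? fullSize h + fullSize (suc h)
...   | yes m≤ with a , refl ← m≤n⇒∃[o]m+o≡n (≤-trans (m≤m+n (fullSize h) _) ge) =
  a , fullSize h , low h (+-cancelˡ-≤ (fullSize h) _ _ ge) (+-cancelˡ-≤ (fullSize h) _ _ m≤) , +-comm a _
...   | no  m≰ with b , refl ← m≤n⇒∃[o]m+o≡n (≤-trans (m≤n+m (fullSize (suc h)) (fullSize h)) (<⇒≤ (≰⇒> m≰))) =
  fullSize (suc h) , b ,
  high h (+-cancelˡ-≤ (fullSize (suc h)) _ _ (≤-trans (≤-reflexive (+-comm (fullSize (suc h)) _)) (<⇒≤ (≰⇒> m≰))))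
         (+-cancelˡ-≤ (fullSize (suc h)) _ _ (<⇒≤ lt)) , refl

-- Two splits never trade size between their parts, since both follow the same order of filling;
-- hence a total determines its split.
split-mono : ∀ {a b a′ b′} → Split a b → Split a′ b′ → a < a′ → b ≤ b′
split-mono (low h ge _)  (low h′ _ le)  lt = fullSize-mono
      (≤-pred (fullSize-cancel-< h (suc h′) (≤-<-trans ge (<-≤-trans lt le))))
split-mono (low h ge _)  (high h′ ge′ _) lt = ≤-trans (fullSize-mono
      (≤-pred (fullSize-cancel-< h (suc h′) (≤-<-trans ge lt)))) ge′
split-mono (high h _ le) (low h′ _ le′) lt = ≤-trans le (fullSize-mono
      (≤-pred (fullSize-cancel-< (suc h) (suc h′) (<-≤-trans lt le′))))
split-mono (high h _ le) (high h′ ge _) lt = ≤-trans le (≤-trans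
      (fullSize-mono (≤-pred (fullSize-cancel-< (suc h) (suc h′) lt))) ge)

split-unique : ∀ {a b a′ b′} → Split a b → Split a′ b′ → a + b ≡ a′ + b′ → a ≡ a′ × b ≡ b′
split-unique {a} {b} {a′} {b′} s s′ eq with <-cmp a a′
... | tri< lt _ _   = contradiction eq (<⇒≢ (+-mono-<-≤ lt (split-mono s s′ lt)))
... | tri> _ _ gt   = contradiction (sym eq) (<⇒≢ (+-mono-<-≤ gt (split-mono s′ s gt)))
... | tri≈ _ refl _ = refl , +-cancelˡ-≡ a b b′ eq

split-parts-≤ : ∀ {a b} N → Split a b → suc (a + b) ≤ fullSize (suc N) → a ≤ fullSize N
split-parts-≤ N (high h ge le) (s≤s s) =
  fullSize-mono (≤-pred (fullSize-cancel-< (suc h) (suc N) (≤-<-trans (m≤m+n _ _) (s≤s s))))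
split-parts-≤ N (low h {a} ge le) (s≤s s) with h <? N
... | yes h<N = ≤-trans le (fullSize-mono h<N)
... | no  h≮N = +-cancelʳ-≤ (fullSize N) a (fullSize N)
  (≤-trans (+-monoʳ-≤ a (fullSize-mono (≮⇒≥ h≮N))) s)

-- The tree fills its first `H` levels, but its larger subtree has not filled the next one. So that
-- level has not reached the smaller subtree, which is perfect.
split-gap : ∀ {c d} H → Split c d → c < fullSize H → fullSize H ≤ suc (c + d) →
            ∃ λ h → H ≡ suc h × d ≡ fullSize h × fullSize h ≤ c
split-gap H (low h {c} ge le) c< H≤ with <-cmp (suc h) H
... | tri≈ _ refl _ = h , refl , refl , ge
... | tri< lt _ _   = contradiction (≤-trans (fullSize-mono lt) H≤)
  (<⇒≱ (s≤s (+-mono-≤-< le (fullSize-< h))))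
... | tri> _ _ gt   = contradiction (fullSize-cancel-< h H (≤-<-trans ge c<)) (≤⇒≯ (≤-pred gt))
split-gap H (high h {d} ge le) c< H≤ with <-cmp (suc (suc h)) H
... | tri> _ _ gt   = contradiction (fullSize-cancel-< (suc h) H c<) (≤⇒≯ (≤-pred gt))
... | tri< lt _ _   = contradiction (<-≤-trans (fullSize-< (suc (suc h))) (fullSize-mono lt))
  (≤⇒≯ (≤-trans H≤ (s≤s (+-monoʳ-≤ (fullSize (suc h)) le))))
... | tri≈ _ refl _ = suc h , refl ,
  ≤-antisym le (+-cancelˡ-≤ (fullSize (suc h)) _ _ (≤-pred H≤)) , ≤-refl

split-left-≥ : ∀ {a b h} → Split a b → fullSize h < b → fullSize (suc h) ≤ a
split-left-≥ {h = h} (low h′ ge le)  lt = ≤-trans (fullSize-mono (fullSize-cancel-< h h′ lt)) ge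
split-left-≥ {h = h} (high h′ ge le) lt = fullSize-mono (fullSize-cancel-< h (suc h′) (<-≤-trans lt le))

split-right-≥ : ∀ {a b h} → Split a b → fullSize h < a → fullSize h ≤ b
split-right-≥ {h = h} (low h′ ge le)  lt = fullSize-mono (≤-pred (fullSize-cancel-< h (suc h′) (<-≤-trans lt le)))
split-right-≥ {h = h} (high h′ ge le) lt = ≤-trans (fullSize-mono (≤-pred (fullSize-cancel-< h (suc h′) lt))) ge

-- Weighted products and exchanges of subtrees

prodVal : ℕ → ℕ → ℕ → ℕ → ℕ
prodVal u v x y = (u * x + v) * (u * y + v)

prodVal-comm : ∀ u v x y → prodVal u v x y ≡ prodVal u v y x
prodVal-comm u v x y = *-comm (u * x + v) _

prodVal-mono : ∀ u v {x x′ y y′} → x ≤ x′ → y ≤ y′ → prodVal u v x y ≤ prodVal u v x′ y′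
prodVal-mono u v x≤ y≤ = *-mono-≤ (+-monoˡ-≤ v (*-monoʳ-≤ u x≤)) (+-monoˡ-≤ v (*-monoʳ-≤ u y≤))

private
  <-by : ∀ {m n o} → n ≡ m + o → 0 < o → m < n
  <-by {m} refl o>0 = m<m+n m o>0

  pos-* : ∀ {m n} → 0 < m → 0 < n → 0 < m * n
  pos-* {suc m} {suc n} _ _ = s≤s z≤n

  <⇒∃+ : ∀ {m n} → m < n → ∃ λ o → 0 < o × m + o ≡ n
  <⇒∃+ {m} lt with o , refl ← m≤n⇒∃[o]m+o≡n lt = suc o , s≤s z≤n , +-suc m o

  abstract
    exchange₁-eq : ∀ u v B D x y →
      (u * (1 + (D + x) * (B + y)) + v) * (u * (1 + B * D) + v) ≡
      (u * (1 + (D + x) * B) + v) * (u * (1 + (B + y) * D) + v) + u * (u + v) * (x * y)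
    exchange₁-eq = solve-∀

    -- In the next two identities, y is the slack in the hypothesis v * B < u + v:
    -- e stands for u + v = v * B + y.
    exchange₂-eq : ∀ u v B K x y →
      (u * (K * B) + (v * B + y)) * (u * (K + x) + v) ≡
      (u * ((K + x) * B) + (v * B + y)) * (u * K + v) + u * x * y
    exchange₂-eq = solve-∀

    exchange₃-eq : ∀ u e y A₂ B D x z →
      ((y + e * B) + u * (D * A₂ * B)) * (u * ((A₂ + z) * (D + x)) + e) ≡
      ((y + e * B) + u * ((D + x) * A₂ * B)) * (u * ((A₂ + z) * D) + e) + u * x * (y * (A₂ + z) + e * B * z)
    exchange₃-eq = solve-∀

    suc-out : ∀ u v x → u * suc x + v ≡ u * x + (u + v)
    suc-out = solve-∀

    suc-out₂ : ∀ u v x B → u * suc (suc x * B) + v ≡ ((u + v) + u * B) + u * (x * B)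
    suc-out₂ = solve-∀

    regroup : ∀ u v B y → (v * B + y) + u * B ≡ y + (u + v) * B
    regroup = solve-∀

-- The gain is `u * (u + v) * (A ∸ D) * (C ∸ B)`: a large subtree is worth most beside a large
-- sibling.
exchange₁ : ∀ {u} v {A B C D} → 0 < u → D < A → B < C →
            prodVal u v (suc (A * B)) (suc (C * D)) < prodVal u v (suc (A * C)) (suc (B * D))
exchange₁ {u} v {B = B} {D = D} u>0 lt₁ lt₂
  with x , x>0 , refl ← <⇒∃+ lt₁ | y , y>0 , refl ← <⇒∃+ lt₂ =
  <-by (exchange₁-eq u v B D x y) (pos-* (pos-* u>0 (≤-trans u>0 (m≤m+n u v))) (pos-* x>0 y>0))

-- The gain is `u * (A ∸ K) * (u + v ∸ v * B)`, and the weight condition says that the last factor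
-- is positive.
exchange₂ : ∀ {u v A B K} → 0 < u → v * B < u + v → K < A →
            prodVal u v (suc (A * B)) K < prodVal u v (suc (K * B)) A
exchange₂ {u} {v} {B = B} {K} u>0 cond lt
  with x , x>0 , refl ← <⇒∃+ lt | y , y>0 , eq ← <⇒∃+ cond =
  <-by (begin
    (u * suc (K * B) + v) * (u * (K + x) + v)             ≡⟨ cong (_* (u * (K + x) + v)) (out (K * B)) ⟩
    (u * (K * B) + (v * B + y)) * (u * (K + x) + v)       ≡⟨ exchange₂-eq u v B K x y ⟩
    (u * ((K + x) * B) + (v * B + y)) * (u * K + v) + u * x * y
      ≡⟨ cong (λ e → e * (u * K + v) + u * x * y) (sym (out ((K + x) * B))) ⟩
    (u * suc ((K + x) * B) + v) * (u * K + v) + u * x * y ∎) (pos-* (pos-* u>0 x>0) y>0)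
  where
  open ≡-Reasoning
  out : ∀ z → u * suc z + v ≡ u * z + (v * B + y)
  out z = trans (suc-out u v z) (cong (u * z +_) (sym eq))

-- `A₁` rises one level, which gains by the weight condition, and exchanges its sibling `A₂` for a
-- `C` that is no smaller.
exchange₃ : ∀ {u v A₁ A₂ B C D} → 0 < u → 0 < C → v * B < u + v → D < A₁ → A₂ ≤ C →
            prodVal u v (suc (suc (A₁ * A₂) * B)) (suc (C * D)) <
            prodVal u v (suc (suc (D * A₂) * B)) (suc (C * A₁))
exchange₃ {u} {v} {A₂ = A₂} {B} {D = D} u>0 C>0 cond lt le
  with x , x>0 , refl ← <⇒∃+ lt | y , y>0 , eq ← <⇒∃+ cond | z , refl ← m≤n⇒∃[o]m+o≡n le =
  <-by (begin
    (u * suc (suc (D * A₂) * B) + v) * (u * suc ((A₂ + z) * (D + x)) + v)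
      ≡⟨ cong₂ _*_ (out₂ (D * A₂)) (suc-out u v _) ⟩
    ((y + (u + v) * B) + u * (D * A₂ * B)) * (u * ((A₂ + z) * (D + x)) + (u + v))
      ≡⟨ exchange₃-eq u (u + v) y A₂ B D x z ⟩
    ((y + (u + v) * B) + u * ((D + x) * A₂ * B)) * (u * ((A₂ + z) * D) + (u + v)) + gain x y z
      ≡⟨ cong (_+ gain x y z) (cong₂ _*_ (sym (out₂ ((D + x) * A₂))) (sym (suc-out u v _))) ⟩
    (u * suc (suc ((D + x) * A₂) * B) + v) * (u * suc ((A₂ + z) * D) + v) + gain x y z ∎)
    (pos-* (pos-* u>0 x>0) (≤-trans (pos-* y>0 C>0) (m≤m+n (y * (A₂ + z)) _)))
  where
  open ≡-Reasoning
  gain : ℕ → ℕ → ℕ → ℕ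
  gain x y z = u * x * (y * (A₂ + z) + (u + v) * B * z)
  out₂ : ∀ w → u * suc (suc w * B) + v ≡ (y + (u + v) * B) + u * (w * B)
  out₂ w = trans (suc-out₂ u v w B)
    (cong (_+ u * (w * B)) (trans (cong (_+ u * B) (sym eq)) (regroup u v B y)))

private abstract
  prodVal-common-eq : ∀ u v A B D → (u * (1 + A * B) + v) * (u * (1 + B * D) + v) ≡
    (u * B * A + (u + v)) * (u * B * D + (u + v))
  prodVal-common-eq = solve-∀

  prodVal-skew-eq : ∀ u v B C D z →
    (D + z) * ((u * (1 + (D + z) * B) + v) * (u * (1 + C * D) + v)) ≡
    D * ((u * (D + z) * B + (u + v)) * (u * (D + z) * C + (u + v))) + (u + v) * z * (u * (D + z) * B + (u + v))
  prodVal-skew-eq = solve-∀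

-- Factoring the common grandchild B out of both factors turns the pair of weights (u , v) into (u * B , u + v).
prodVal-common : ∀ u v A B D → prodVal u v (suc (A * B)) (suc (B * D)) ≡ prodVal (u * B) (u + v) A D
prodVal-common = prodVal-common-eq

-- Here the two factors have different grandchildren A ≥ D; the surplus A ∸ D only weighs on B.
prodVal-skew : ∀ u v {A B B′ C C′ D} → 0 < A → D ≤ A → B ≤ B′ →
               prodVal (u * A) (u + v) B C ≤ prodVal (u * A) (u + v) B′ C′ →
               prodVal u v (suc (A * B)) (suc (C * D)) ≤ prodVal u v (suc (A * B′)) (suc (C′ * D))
prodVal-skew u v {A} {B} {B′} {C} {C′} {D} A>0 D≤A B≤ le
  -- Multiplied by `A`, the product becomes `D` copies of the reduced product of `B` and `C` plus a
  -- remainder that increases with `B` and does not involve `C`.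
  with z , refl ← m≤n⇒∃[o]m+o≡n D≤A = *-cancelˡ-≤ (D + z) {{>-nonZero A>0}} (begin
  (D + z) * prodVal u v (suc ((D + z) * B)) (suc (C * D)) ≡⟨ prodVal-skew-eq u v B C D z ⟩
  D * prodVal (u * (D + z)) (u + v) B C + (u + v) * z * (u * (D + z) * B + (u + v))
    ≤⟨ +-mono-≤ (*-monoʳ-≤ D le) (*-monoʳ-≤ ((u + v) * z) (+-monoˡ-≤ (u + v) (*-monoʳ-≤ (u * (D + z)) B≤))) ⟩
  D * prodVal (u * (D + z)) (u + v) B′ C′ + (u + v) * z * (u * (D + z) * B′ + (u + v))
    ≡⟨ prodVal-skew-eq u v B′ C′ D z ⟨
  (D + z) * prodVal u v (suc ((D + z) * B′)) (suc (C′ * D)) ∎)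
  where open ≤-Reasoning

-- Optimality of complete trees

n≤fullSize : ∀ n → n ≤ fullSize n
n≤fullSize zero    = z≤n
n≤fullSize (suc n) = s≤s (≤-trans (n≤fullSize n) (m≤m+n (fullSize n) _))

-- The cap on `j` and `k` keeps the subtrees of their complete trees within `fullSize N`, so that
-- the weight condition covers every `B` met in an exchange. Weights and level are quantified here
-- because the induction on `m` changes them.
SplitOptimal : ℕ → Set
SplitOptimal m = ∀ N u v {j k a b} → v * maxVal (fullSize N) < u + v →
  j ≤ fullSize (suc N) → k ≤ fullSize (suc N) → j + k ≡ m → Split a b → a + b ≡ m →
  prodVal u v (maxVal j) (maxVal k) ≤ prodVal u v (maxVal a) (maxVal b)

optimal⇒ : ∀ a b → SplitOptimal (a + b) → suc (maxVal a * maxVal b) ≤ maxVal (suc (a + b))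
optimal⇒ a b opt with a′ , b′ , s , eq ← split (a + b) = begin
  suc (maxVal a * maxVal b)             ≡⟨ cong suc (prodVal-10 (maxVal a) (maxVal b)) ⟨
  suc (prodVal 1 0 (maxVal a) (maxVal b))
    -- For weights 1 and 0 the condition is `0 < 1` at every level, so a level can be chosen whose
    -- cap admits both `a` and `b`.
    ≤⟨ s≤s (opt (a + b) 1 0 (s≤s z≤n) (in-range (m≤m+n a b)) (in-range (m≤n+m b a)) refl s eq) ⟩
  suc (prodVal 1 0 (maxVal a′) (maxVal b′)) ≡⟨ cong suc (prodVal-10 (maxVal a′) (maxVal b′)) ⟩
  suc (maxVal a′ * maxVal b′)           ≡⟨ maxVal-split s ⟨
  maxVal (suc (a′ + b′))           ≡⟨ cong (maxVal ∘ suc) eq ⟩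
  maxVal (suc (a + b))             ∎
  where
  open ≤-Reasoning
  prodVal-10 : ∀ x y → prodVal 1 0 x y ≡ x * y
  prodVal-10 x y = cong₂ _*_ (lem x) (lem y)
    where
    lem : ∀ x → 1 * x + 0 ≡ x
    lem x = trans (+-identityʳ (1 * x)) (*-identityˡ x)
  in-range : ∀ {i} → i ≤ a + b → i ≤ fullSize (suc (a + b))
  in-range i≤ = ≤-trans i≤ (≤-trans (n≤fullSize (a + b)) (<⇒≤ (fullSize-< (a + b))))

private
  abstract
    swap₂ : ∀ k b a → suc (k + b) + a ≡ suc (a + b) + k
    swap₂ = solve-∀

    swap₁ : ∀ a b c d → suc (a + c) + suc (b + d) ≡ suc (a + b) + suc (c + d)
    swap₁ = solve-∀

    swap₃ : ∀ a₁ a₂ b c d → suc (suc (d + a₂) + b) + suc (c + a₁) ≡ suc (suc (a₁ + a₂) + b) + suc (c + d)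
    swap₃ = solve-∀

    gather : ∀ p q b c → suc (q + b) + suc (c + p) ≡ (2 + q + p) + (b + c)
    gather = solve-∀

    gather′ : ∀ p b c → suc (b + p) + suc (p + c) ≡ (2 + p + p) + (b + c)
    gather′ = solve-∀

module BestSplit {m} (rec : ∀ {i} → i < m → SplitOptimal i) (N : ℕ) {u v : ℕ} (cond : v * maxVal (fullSize N) < u + v) where

  u>0 : 0 < u
  u>0 = +-cancelʳ-< v 0 u (≤-<-trans (m≤m*n v (maxVal (fullSize N)) {{>-nonZero (maxVal>0 (fullSize N))}}) cond)

  cond′ : ∀ {b} → b ≤ fullSize N → v * maxVal b < u + v
  cond′ b≤ = ≤-<-trans (*-monoʳ-≤ v (maxVal-mono-≤ b≤)) cond

  opt : ∀ a b → a + b < m → suc (maxVal a * maxVal b) ≤ maxVal (suc (a + b))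
  opt a b lt = optimal⇒ a b (rec lt)

  InRange : ℕ → Set
  InRange i = i ≤ fullSize (suc N)

  val : ℕ → ℕ → ℕ
  val j k = prodVal u v (maxVal j) (maxVal k)

  -- A maximising pair, so that an exchange with strict gain is a contradiction as soon as the new
  -- sizes stay in range.
  record Best (j k : ℕ) : Set where
    field
      j≤   : InRange j
      k≤   : InRange k
      sum  : j + k ≡ m
      ≥all : ∀ {j′ k′} → InRange j′ → InRange k′ → j′ + k′ ≡ m → val j′ k′ ≤ val j k

  BestSplit : ℕ → ℕ → Set
  BestSplit j k = ∃₂ λ a b → Split a b × a + b ≡ j + k × val j k ≤ val a b

  module _ {a b k} (s : Split a b) (best : Best (suc (a + b)) k) where
    open Best best

    a≤N : a ≤ fullSize N
    a≤N = split-parts-≤ N s j≤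

    b≤N : b ≤ fullSize N
    b≤N = ≤-trans (split-≥ s) a≤N

    -- Otherwise `exchange₂` lets the nephew `a` and its uncle `k` change places with strict gain,
    -- and `opt` replaces the changed tree by a complete one.
    nephew-≤ : a ≤ k
    nephew-≤ = ≮⇒≥ λ k<a → <⇒≱ (begin-strict
        prodVal u v (maxVal (suc (a + b))) (maxVal k)     ≡⟨ cong (λ x → prodVal u v x (maxVal k)) (maxVal-split s) ⟩
        prodVal u v (suc (maxVal a * maxVal b)) (maxVal k)     <⟨ exchange₂ u>0 (cond′ b≤N) (maxVal-mono-< k<a) ⟩
        prodVal u v (suc (maxVal k * maxVal b)) (maxVal a)     ≤⟨ prodVal-mono u v (opt k b (k+b< k<a)) ≤-refl ⟩
        prodVal u v (maxVal (suc (k + b))) (maxVal a)     ∎)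
      (≥all (≤-trans (s≤s (+-monoˡ-≤ b (<⇒≤ k<a))) j≤) (≤-trans (m≤n⇒m≤1+n (m≤m+n a b)) j≤)
            (trans (swap₂ k b a) sum))
      where
      open ≤-Reasoning
      k+b< : k < a → k + b < m
      k+b< k<a = subst (k + b <_) sum (s≤s (≤-trans (+-monoˡ-≤ b (<⇒≤ k<a)) (m≤m+n (a + b) k)))

  module _ {a b c d} (s : Split a b) (s′ : Split c d) (ord : suc (c + d) ≤ suc (a + b))
           (best : Best (suc (a + b)) (suc (c + d))) where
    open Best best

    c≤N : c ≤ fullSize N
    c≤N = split-parts-≤ N s′ k≤

    -- Otherwise `exchange₁` swaps `b` and `c`. It also asks for `d < a`, which holds because the
    -- first tree is at least as large as the second.
    cousins-≤ : c ≤ b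
    cousins-≤ = ≮⇒≥ λ b<c → <⇒≱ (begin-strict
        prodVal u v (maxVal (suc (a + b))) (maxVal (suc (c + d)))
          ≡⟨ cong₂ (prodVal u v) (maxVal-split s) (maxVal-split s′) ⟩
        prodVal u v (suc (maxVal a * maxVal b)) (suc (maxVal c * maxVal d))
          <⟨ exchange₁ v u>0 (maxVal-mono-< (d<a b<c)) (maxVal-mono-< b<c) ⟩
        prodVal u v (suc (maxVal a * maxVal c)) (suc (maxVal b * maxVal d))
          ≤⟨ prodVal-mono u v (opt a c a+c<) (opt b d b+d<) ⟩
        prodVal u v (maxVal (suc (a + c))) (maxVal (suc (b + d)))     ∎)
      (≥all (s≤s (+-mono-≤ (a≤N s best) c≤N)) (s≤s (+-mono-≤ (b≤N s best) (≤-trans (split-≥ s′) c≤N)))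
            (trans (swap₁ a b c d) sum))
      where
      open ≤-Reasoning
      d<a : b < c → d < a
      d<a b<c = ≰⇒> λ a≤d → <⇒≱ (+-mono-<-≤ b<c a≤d) (≤-trans (≤-pred ord) (≤-reflexive (+-comm a b)))
      a+c< : a + c < m
      a+c< = subst (a + c <_) sum (s≤s (+-mono-≤ (m≤m+n a b) (m≤n⇒m≤1+n (m≤m+n c d))))
      b+d< : b + d < m
      b+d< = subst (b + d <_) sum (s≤s (+-mono-≤ (m≤n+m b a) (m≤n⇒m≤1+n (m≤n+m d c))))

  module _ {a₁ a₂ b c d} (s : Split (suc (a₁ + a₂)) b) (s₁ : Split a₁ a₂) (s′ : Split c d)
           (best : Best (suc (suc (a₁ + a₂) + b)) (suc (c + d))) where
    open Best best

    no-deep-exchange : suc (c + d) ≤ suc (suc (a₁ + a₂) + b) → d < a₁ → a₂ ≤ c → ⊥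
    no-deep-exchange ord d<a₁ a₂≤c = <⇒≱ (begin-strict
        prodVal u v (maxVal (suc (suc (a₁ + a₂) + b))) (maxVal (suc (c + d)))
          ≡⟨ cong₂ (prodVal u v) (trans (maxVal-split s) (cong (λ x → suc (x * maxVal b)) (maxVal-split s₁)))
                (maxVal-split s′) ⟩
        prodVal u v (suc (suc (maxVal a₁ * maxVal a₂) * maxVal b)) (suc (maxVal c * maxVal d))
          <⟨ exchange₃ u>0 (maxVal>0 c) (cond′ (b≤N s best)) (maxVal-mono-< d<a₁) (maxVal-mono-≤ a₂≤c) ⟩
        prodVal u v (suc (suc (maxVal d * maxVal a₂) * maxVal b)) (suc (maxVal c * maxVal a₁))
          -- The first tree changes two levels down, so it is made complete in two stages, the inner
          -- subtree first.
          ≤⟨ prodVal-mono u v (≤-trans (s≤s (*-monoˡ-≤ (maxVal b) (opt d a₂ d+a₂<))) (opt (suc (d + a₂)) b d+a₂+b<))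
                (opt c a₁ c+a₁<) ⟩
        prodVal u v (maxVal (suc (suc (d + a₂) + b))) (maxVal (suc (c + a₁))) ∎)
      (≥all (≤-trans (s≤s (s≤s (+-monoˡ-≤ b (+-monoˡ-≤ a₂ (<⇒≤ d<a₁))))) j≤)
            (s≤s (+-mono-≤ (split-parts-≤ N s′ k≤) (≤-trans (m≤n⇒m≤1+n (m≤m+n a₁ a₂)) (a≤N s best))))
            (trans (swap₃ a₁ a₂ b c d) sum))
      where
      open ≤-Reasoning
      d+a₂+b< : suc (d + a₂) + b < m
      d+a₂+b< = subst (suc (d + a₂) + b <_) sum
        (s≤s (≤-trans (s≤s (+-monoˡ-≤ b (+-monoˡ-≤ a₂ (<⇒≤ d<a₁)))) (m≤m+n _ (suc (c + d)))))
      d+a₂< : d + a₂ < m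
      d+a₂< = <⇒≤ (≤-trans (s≤s (s≤s (m≤m+n (d + a₂) b))) d+a₂+b<)
      c+a₁< : c + a₁ < m
      c+a₁< = subst (c + a₁ <_) (trans (+-comm (suc (c + d)) _) sum)
        (s≤s (+-mono-≤ (m≤m+n c d) (≤-trans (m≤m+n a₁ (a₂ + b))
              (≤-trans (≤-reflexive (sym (+-assoc a₁ a₂ b))) (m≤n⇒m≤1+n (m≤n⇒m≤1+n ≤-refl))))))

  -- The splits make the old values exact; the new ones are only bounded from below, by optimality
  -- at smaller totals, and that is the direction required.
  value-≤ : ∀ {j k a b c d} → Split a b → Split c d → suc (a + b) + suc (c + d) ≡ m → ∀ {a′ b′ c′ d′} →
            suc (a′ + b′) + suc (c′ + d′) ≡ suc (a + b) + suc (c + d) →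
            j ≡ suc (a + b) → k ≡ suc (c + d) →
            prodVal u v (suc (maxVal a * maxVal b)) (suc (maxVal c * maxVal d)) ≤ prodVal u v
                  (suc (maxVal a′ * maxVal b′)) (suc (maxVal c′ * maxVal d′)) →
            val j k ≤ val (suc (a′ + b′)) (suc (c′ + d′))
  value-≤ {a = a} {b} {c} {d} s s′ sum {a′} {b′} {c′} {d′} sum′ refl refl le = begin
    prodVal u v (maxVal (suc (a + b))) (maxVal (suc (c + d)))
      ≡⟨ cong₂ (prodVal u v) (maxVal-split s) (maxVal-split s′) ⟩
    prodVal u v (suc (maxVal a * maxVal b)) (suc (maxVal c * maxVal d))         ≤⟨ le ⟩
    prodVal u v (suc (maxVal a′ * maxVal b′)) (suc (maxVal c′ * maxVal d′))
      ≤⟨ prodVal-mono u v (opt a′ b′ lt) (opt c′ d′ lt′) ⟩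
    prodVal u v (maxVal (suc (a′ + b′))) (maxVal (suc (c′ + d′)))     ∎
    where
    open ≤-Reasoning
    lt : a′ + b′ < m
    lt = subst (a′ + b′ <_) (trans sum′ sum) (m≤m+n (suc (a′ + b′)) (suc (c′ + d′)))
    lt′ : c′ + d′ < m
    lt′ = subst (c′ + d′ <_) (trans sum′ sum) (m≤n+m (suc (c′ + d′)) (suc (a′ + b′)))

  -- The perfect tree of height `h` hangs under both roots. `prodVal-common` factors it out and
  -- induction improves the remaining pair `a`, `d`; whether `a + d` exceeds two such perfect trees
  -- decides how the parts regroup into a split.
  same-sibling : ∀ h {a d} → fullSize h ≤ a → a ≤ fullSize (suc h) → Split (fullSize h) d →
                 Best (suc (a + fullSize h)) (suc (fullSize h + d)) →
                 BestSplit (suc (a + fullSize h)) (suc (fullSize h + d))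
  same-sibling zero {a} {d} ge le s best with z≤n ← split-≥ s =
    _ , _ , low 1 (s≤s z≤n) (s≤s (≤-trans (≤-reflexive (+-identityʳ a)) (≤-trans le (s≤s z≤n)))) , refl , ≤-refl
  same-sibling (suc h₀) {a} {d} ge le s best with a + d ≤? p + p
    where p = fullSize (suc h₀)
  ... | yes a+d≤ = low-case (m≤n⇒∃[o]m+o≡n (≤-trans ge (m≤m+n a d)))
    where
    p = fullSize (suc h₀)
    low-case : (∃ λ x → p + x ≡ a + d) → BestSplit (suc (a + p)) (suc (p + d))
    low-case (x , eq) = _ , _ , high (suc h₀) (m≤n⇒m≤1+n (m≤m+n p x)) (s≤s (+-monoʳ-≤ p x≤)) , sum≡ ,
      value-≤ (low (suc h₀) ge le) s (Best.sum best) sum≡ refl refl (begin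
        prodVal u v (suc (maxVal a * maxVal p)) (suc (maxVal p * maxVal d))
          ≡⟨ prodVal-common u v (maxVal a) (maxVal p) (maxVal d) ⟩
        prodVal (u * maxVal p) (u + v) (maxVal a) (maxVal d)
          ≤⟨ rec a+d< (suc h₀) (u * maxVal p) (u + v) cond″ le (≤-trans (split-≥ s) (<⇒≤ (fullSize-< (suc h₀)))) refl
                (high h₀ (≤-trans (split-right-≥ s (fullSize-< h₀)) d≤x) x≤) eq ⟩
        prodVal (u * maxVal p) (u + v) (maxVal p) (maxVal x)
          ≡⟨ prodVal-common u v (maxVal p) (maxVal p) (maxVal x) ⟨
        prodVal u v (suc (maxVal p * maxVal p)) (suc (maxVal p * maxVal x)) ∎)
      where
      open ≤-Reasoning
      x≤ : x ≤ p
      x≤ = +-cancelˡ-≤ p x p (≤-trans (≤-reflexive eq) a+d≤)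
      d≤x : d ≤ x
      d≤x = +-cancelˡ-≤ p d x (≤-trans (+-monoˡ-≤ d ge) (≤-reflexive (sym eq)))
      a+d< : a + d < m
      a+d< = subst (a + d <_) (Best.sum best) (s≤s (+-mono-≤ (m≤m+n a p) (m≤n⇒m≤1+n (m≤n+m d p))))
      -- The old condition at `p` with `u * maxVal p` added on both sides: the weight condition
      -- reproduces itself.
      cond″ : (u + v) * maxVal p < u * maxVal p + (u + v)
      cond″ = subst (_< u * maxVal p + (u + v)) (sym (*-distribʳ-+ (maxVal p) u v))
            (+-monoʳ-< (u * maxVal p) (cond′ (b≤N (low (suc h₀) ge le) best)))
      sum≡ : suc (p + p) + suc (p + x) ≡ suc (a + p) + suc (p + d)
      sum≡ = trans (gather′ p p x) (trans (cong (2 + p + p +_) eq) (sym (gather′ p a d)))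
  ... | no a+d≰ = high-case (m≤n⇒∃[o]m+o≡n (≤-trans ge (m≤m+n a d)))
    where
    p = fullSize (suc h₀)
    d≤p : d ≤ p
    d≤p = split-≥ s
    high-case : (∃ λ x → p + x ≡ a + d) → BestSplit (suc (a + p)) (suc (p + d))
    high-case (x , eq) = _ , _ , low (suc (suc h₀)) (s≤s (+-monoˡ-≤ p p≤x))
          (s≤s (+-mono-≤ x≤ (<⇒≤ (fullSize-< (suc h₀))))) , sum≡ ,
      value-≤ (low (suc h₀) ge le) s (Best.sum best) sum≡ refl refl (begin
        prodVal u v (suc (maxVal a * maxVal p)) (suc (maxVal p * maxVal d))
          ≡⟨ prodVal-common u v (maxVal a) (maxVal p) (maxVal d) ⟩
        prodVal (u * maxVal p) (u + v) (maxVal a) (maxVal d)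
          ≤⟨ rec a+d< (suc h₀) (u * maxVal p) (u + v) cond″ le (≤-trans d≤p (<⇒≤ (fullSize-< (suc h₀)))) refl
                (low (suc h₀) p≤x x≤) (trans (+-comm x p) eq) ⟩
        prodVal (u * maxVal p) (u + v) (maxVal x) (maxVal p)
          ≡⟨ prodVal-common u v (maxVal x) (maxVal p) (maxVal p) ⟨
        prodVal u v (suc (maxVal x * maxVal p)) (suc (maxVal p * maxVal p)) ∎)
      where
      open ≤-Reasoning
      p≤x : p ≤ x
      p≤x = +-cancelˡ-≤ p p x (≤-trans (<⇒≤ (≰⇒> a+d≰)) (≤-reflexive (sym eq)))
      x≤ : x ≤ fullSize (suc (suc h₀))
      x≤ = ≤-trans (+-cancelˡ-≤ p x a (≤-trans (≤-reflexive eq)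
            (≤-trans (+-monoʳ-≤ a d≤p) (≤-reflexive (+-comm a p))))) le
      a+d< : a + d < m
      a+d< = subst (a + d <_) (Best.sum best) (s≤s (+-mono-≤ (m≤m+n a p) (m≤n⇒m≤1+n (m≤n+m d p))))
      cond″ : (u + v) * maxVal p < u * maxVal p + (u + v)
      cond″ = subst (_< u * maxVal p + (u + v)) (sym (*-distribʳ-+ (maxVal p) u v))
            (+-monoʳ-< (u * maxVal p) (cond′ (b≤N (low (suc h₀) ge le) best)))
      sum≡ : suc (x + p) + suc (p + p) ≡ suc (a + p) + suc (p + d)
      sum≡ = trans (gather′ p x p) (trans (cong (2 + p + p +_) (trans (+-comm x p) eq)) (sym (gather′ p a d)))

  -- The perfect subtrees `q` and `p` differ by one level and cannot be factored out together.
  -- `prodVal-skew` tolerates the surplus of `q` provided that `b`, the sibling of `q`, is not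
  -- replaced by anything smaller, and the regrouping respects this.
  skew-siblings : ∀ h {b c} → Split (fullSize (suc h)) b → Split c (fullSize h) → fullSize h ≤ b → b ≤ fullSize
        (suc h) →
                  fullSize h ≤ c → c ≤ b →
                  Best (suc (fullSize (suc h) + b)) (suc (c + fullSize h)) →
                  BestSplit (suc (fullSize (suc h) + b)) (suc (c + fullSize h))
  skew-siblings h {b} {c} s s′ p≤b b≤q p≤c c≤b best with b + c ≤? fullSize h + fullSize (suc h)
  ... | yes b+c≤ = low-case (m≤n⇒∃[o]m+o≡n (≤-trans p≤b (m≤m+n b c)))
    where
    p = fullSize h
    q = fullSize (suc h)
    p≤q : p ≤ q
    p≤q = <⇒≤ (fullSize-< h)
    low-case : (∃ λ x → p + x ≡ b + c) → BestSplit (suc (q + b)) (suc (c + p))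
    low-case (x , eq) = _ , _ , low (suc h) (m≤n⇒m≤1+n (m≤m+n q x)) (s≤s (+-monoʳ-≤ q x≤q)) , sum≡ ,
      value-≤ s s′ (Best.sum best) sum≡ refl refl
        (prodVal-skew u v {C = maxVal c} {maxVal p} (maxVal>0 q) (maxVal-mono-≤ p≤q) (maxVal-mono-≤ b≤x)
          (rec b+c< h (u * maxVal q) (u + v) cond″ b≤q (≤-trans c≤b b≤q) refl (low h p≤x x≤q)
                (trans (+-comm x p) eq)))
      where
      b≤x : b ≤ x
      b≤x = +-cancelˡ-≤ p b x (≤-trans (+-monoˡ-≤ b p≤c) (≤-reflexive (trans (+-comm c b) (sym eq))))
      p≤x : p ≤ x
      p≤x = ≤-trans p≤b b≤x
      x≤q : x ≤ q
      x≤q = +-cancelˡ-≤ p x q (≤-trans (≤-reflexive eq) b+c≤)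
      b+c< : b + c < m
      b+c< = subst (b + c <_) (Best.sum best) (s≤s (+-mono-≤ (m≤n+m b q) (m≤n⇒m≤1+n (m≤m+n c p))))
      -- The weight carries `q`, while the level is that of `p`, whose cap `q` still admits `b` and
      -- `c`.
      cond″ : (u + v) * maxVal p < u * maxVal q + (u + v)
      cond″ = subst (_< u * maxVal q + (u + v)) (sym (*-distribʳ-+ (maxVal p) u v))
        (+-mono-≤-< (*-monoʳ-≤ u (maxVal-mono-≤ p≤q)) (cond′ (≤-trans p≤b (b≤N s best))))
      sum≡ : suc (q + x) + suc (p + p) ≡ suc (q + b) + suc (c + p)
      sum≡ = trans (gather p q x p) (trans (cong (2 + q + p +_) (trans (+-comm x p) eq)) (sym (gather p q b c)))
  ... | no b+c≰ = high-case (m≤n⇒∃[o]m+o≡n (≤-trans (m≤n+m (fullSize (suc h)) (fullSize h)) (<⇒≤ (≰⇒> b+c≰))))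
    where
    p = fullSize h
    q = fullSize (suc h)
    p≤q : p ≤ q
    p≤q = <⇒≤ (fullSize-< h)
    high-case : (∃ λ x → q + x ≡ b + c) → BestSplit (suc (q + b)) (suc (c + p))
    high-case (x , eq) = _ , _ , high (suc h) (s≤s (+-monoˡ-≤ p p≤x)) (s≤s (+-mono-≤ x≤q p≤q)) , sum≡ ,
      value-≤ s s′ (Best.sum best) sum≡ refl refl
        (prodVal-skew u v {C = maxVal c} {maxVal x} (maxVal>0 q) (maxVal-mono-≤ p≤q) (maxVal-mono-≤ b≤q)
          (rec b+c< h (u * maxVal q) (u + v) cond″ b≤q (≤-trans c≤b b≤q) refl (high h p≤x x≤q) eq))
      where
      p≤x : p ≤ x
      p≤x = +-cancelˡ-≤ q p x (≤-trans (≤-reflexive (+-comm q p)) (≤-trans (<⇒≤ (≰⇒> b+c≰)) (≤-reflexive (sym eq))))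
      x≤q : x ≤ q
      x≤q = ≤-trans (+-cancelˡ-≤ q x c (≤-trans (≤-reflexive eq) (+-monoˡ-≤ c b≤q))) (≤-trans c≤b b≤q)
      b+c< : b + c < m
      b+c< = subst (b + c <_) (Best.sum best) (s≤s (+-mono-≤ (m≤n+m b q) (m≤n⇒m≤1+n (m≤m+n c p))))
      cond″ : (u + v) * maxVal p < u * maxVal q + (u + v)
      cond″ = subst (_< u * maxVal q + (u + v)) (sym (*-distribʳ-+ (maxVal p) u v))
        (+-mono-≤-< (*-monoʳ-≤ u (maxVal-mono-≤ p≤q)) (cond′ (≤-trans p≤b (b≤N s best))))
      sum≡ : suc (q + q) + suc (x + p) ≡ suc (q + b) + suc (c + p)
      sum≡ = trans (gather p q q x) (trans (cong (2 + q + p +_) eq) (sym (gather p q b c)))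

  -- The exchange inequalities leave few constellations of grandchildren: the pair is a split
  -- already, or both trees share a perfect subtree, or they contain perfect subtrees of consecutive
  -- heights.
  refine : ∀ {j k} → k ≤ j → Best j k → BestSplit j k
  refine {zero} {zero} _ _ = 0 , 0 , low 0 z≤n z≤n , refl , ≤-refl
  refine {suc j} {k} k≤j best with a , b , s , refl ← split j = go (nephew-≤ s best) k≤j best s
    where
    go : ∀ {a b k} → a ≤ k → k ≤ suc (a + b) → Best (suc (a + b)) k → Split a b → BestSplit (suc (a + b)) k
    go {a} {b} {zero} z≤n _ _ s with z≤n ← split-≥ s = 1 , 0 , low 0 z≤n ≤-refl , refl , ≤-refl
    go {a} {b} {suc k} a≤k ord best s with c , d , s′ , refl ← split k = by-cases s s′ a≤k ord best
          (cousins-≤ s s′ ord best)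
      where
      by-cases : ∀ {a b c d} → Split a b → Split c d → a ≤ suc (c + d) → suc (c + d) ≤ suc (a + b) →
                 Best (suc (a + b)) (suc (c + d)) → c ≤ b → BestSplit (suc (a + b)) (suc (c + d))
      by-cases {a} {.(fullSize h)} {c} {d} s@(low h ge le) s′ a≤k ord best c≤b with c <? fullSize h
      ... | yes c< with h₀ , refl , refl , h₀≤c ← split-gap h s′ c< (≤-trans ge a≤k) = two-levels (split-unsuc ge)
        where
        split-unsuc : ∀ {a} → fullSize (suc h₀) ≤ a → ∃₂ λ a₁ a₂ → Split a₁ a₂ × a ≡ suc (a₁ + a₂)
        split-unsuc {suc a} _ with a₁ , a₂ , s₁ , refl ← split a = a₁ , a₂ , s₁ , refl
        two-levels : (∃₂ λ a₁ a₂ → Split a₁ a₂ × a ≡ suc (a₁ + a₂)) → BestSplit (suc (a + fullSize h)) (suc (c + d))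
        two-levels (a₁ , a₂ , s₁ , refl) with fullSize h₀ <? a₁
        ... | yes d<a₁ = ⊥-elim (no-deep-exchange s s₁ s′ best ord d<a₁ a₂≤c)
          where
          -- With `c < a₂` the parts of `a` would dominate those of its uncle, one of them strictly,
          -- against `a≤k`.
          a₂≤c : a₂ ≤ c
          a₂≤c = ≮⇒≥ λ c<a₂ → <⇒≱ (s≤s (+-mono-≤-< (≤-trans (fullSize-mono (n≤1+n h₀))
                (split-left-≥ s₁ (≤-<-trans h₀≤c c<a₂))) c<a₂))
            (≤-trans a≤k (s≤s (≤-reflexive (+-comm c d))))
        ... | no  a₁≤d = _ , _ , high h (≤-trans ge a≤k) (s≤s (+-mono-≤ (<⇒≤ c<) (≤-trans (split-≥ s′) (<⇒≤ c<)))) ,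
                         cong (λ x → suc (x + fullSize h) + suc (c + d)) (sym a≡) ,
                         ≤-reflexive (cong (λ x → val (suc (x + fullSize h)) (suc (c + d))) a≡)
          where
          -- Neither part exceeds `fullSize h₀`, yet `a` is no smaller than the perfect tree of
          -- height `suc h₀`. So it is perfect, and the pair is a split as it stands.
          a≡ : suc (a₁ + a₂) ≡ fullSize h
          a≡ = ≤-antisym (s≤s (+-mono-≤ (≮⇒≥ a₁≤d) (≤-trans (split-≥ s₁) (≮⇒≥ a₁≤d)))) ge
      by-cases {a} {.(fullSize h)} {c} {d} s@(low h ge le) s′ a≤k ord best c≤b | no c≮
        with refl ← ≤-antisym c≤b (≮⇒≥ c≮) = same-sibling h ge le s′ best
      by-cases {.(fullSize (suc h))} {b} {c} {d} s@(high h ge le) s′ a≤k ord best c≤b with b <? fullSize (suc h)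
      ... | no  b≮ with refl ← ≤-antisym le (≮⇒≥ b≮) =
        _ , _ , high (suc h) a≤k ord , refl , ≤-refl
      ... | yes b< with _ , refl , refl , h≤c ← split-gap (suc h) s′ (≤-<-trans c≤b b<) a≤k =
        skew-siblings h s s′ ge le h≤c c≤b best

  best-exists : ∀ {j k} → InRange j → InRange k → j + k ≡ m → ∃₂ λ j′ k′ → Best j′ k′ × val j k ≤ val j′ k′
  best-exists {j} {k} j≤ k≤ eq = i , m ∸ i ,
      record { j≤ = r₁ ; k≤ = r₂ ; sum = m+[n∸m]≡n i≤m ; ≥all = bound } , bound j≤ k≤ eq
    where
    Q? : U.Decidable (λ i → InRange i × InRange (m ∸ i))
    Q? i = (i ≤? fullSize (suc N)) ×-dec (m ∸ i ≤? fullSize (suc N))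
    candidates = filter Q? (upTo (suc m))
    rest≡ : ∀ {j k} → j + k ≡ m → m ∸ j ≡ k
    rest≡ {j} {k} eq = trans (cong (_∸ j) (sym eq)) (m+n∸m≡n j k)
    -- The default `j` is in range as well, so `argmax-all` gives a maximiser in range.
    i = argmax (λ i → val i (m ∸ i)) j candidates
    ok : (InRange i × InRange (m ∸ i)) × i ≤ m
    ok = argmax-all (λ i → val i (m ∸ i)) ((j≤ , subst InRange (sym (rest≡ eq)) k≤) , subst (j ≤_) eq (m≤m+n j k))
      (All.tabulate λ i∈ → let i∈′ , q = ∈-filter⁻ Q? {xs = upTo (suc m)} i∈ in q , ≤-pred (∈-upTo⁻ i∈′))
    r₁ = proj₁ (proj₁ ok)
    r₂ = proj₂ (proj₁ ok)
    i≤m = proj₂ ok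
    bound : ∀ {j k} → InRange j → InRange k → j + k ≡ m → val j k ≤ val i (m ∸ i)
    bound {j′} {k′} j≤ k≤ eq = subst (λ k → val j′ k ≤ val i (m ∸ i)) (rest≡ eq)
      (All.lookup (f[xs]≤f[argmax] {f = λ i → val i (m ∸ i)} j candidates)
        (∈-filter⁺ Q? (∈-upTo⁺ (s≤s (subst (j′ ≤_) eq (m≤m+n j′ k′)))) (j≤ , subst InRange (sym (rest≡ eq)) k≤)))

  best-split : ∀ {j k} → Best j k → BestSplit j k
  best-split {j} {k} best with ≤-total k j
  ... | inj₁ k≤j = refine k≤j best
  ... | inj₂ j≤k with a , b , s , eq , le ← refine j≤k (record
        { j≤ = Best.k≤ best ; k≤ = Best.j≤ best ; sum = trans (+-comm k j) (Best.sum best)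
        ; ≥all = λ r r′ eq → ≤-trans (Best.≥all best r r′ eq)
              (≤-reflexive (prodVal-comm u v (maxVal j) (maxVal k))) }) =
    a , b , s , trans eq (+-comm k j) , ≤-trans (≤-reflexive (prodVal-comm u v (maxVal j) (maxVal k))) le

splitOptimal : ∀ m → SplitOptimal m
splitOptimal m = go (<-wellFounded m)
  where
  go : ∀ {m} → Acc _<_ m → SplitOptimal m
  go (acc rec) N u v {j} {k} {a} {b} cond j≤ k≤ eq s eq′ = let
      open BestSplit (λ lt → go (rec lt)) N {u} {v} cond
      j₀ , k₀ , best , le = best-exists j≤ k≤ eq
      a₀ , b₀ , s₀ , eq₀ , le₀ = best-split best
      a≡ , b≡ = split-unique s₀ s (trans eq₀ (trans (Best.sum best) (sym eq′)))
    in ≤-trans le (≤-trans le₀ (≤-reflexive (cong₂ (λ x y → prodVal u v (maxVal x) (maxVal y)) a≡ b≡)))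

maxVal-optimal : ∀ a b → suc (maxVal a * maxVal b) ≤ maxVal (suc (a + b))
maxVal-optimal a b = optimal⇒ a b (splitOptimal (a + b))

-- Walks without backtracking

-- A nonempty walk from u to v without backtracking; a is its second and b its second to last vertex.
data Trail {n} (R : Rel (Fin n) 0ℓ) : ℕ → (u a b v : Fin n) → Set where
  one  : ∀ {u v} → R u v → Trail R 1 u v u v
  cons : ∀ {k u a c b v} → R u a → u ≢ c → Trail R k a c b v → Trail R (suc k) u a b v

module _ {R : Rel (Fin n) 0ℓ} where

  append : ∀ {u a b v c d w} → Trail R j u a b v → Trail R k v c d w → b ≢ c → Trail R (j + k) u a d w
  append (one e)       q b≢c = cons e b≢c q
  append (cons e ne p) q b≢c = cons e ne (append p q b≢c)

  trail⇒walk : ∀ {u a b v} → Trail R k u a b v → Walk R k u v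
  trail⇒walk (one e)      = e ∷ []
  trail⇒walk (cons e _ p) = e ∷ trail⇒walk p

  edge-first : ∀ {u a b v} → Trail R k u a b v → R u a
  edge-first (one e)      = e
  edge-first (cons e _ _) = e

  uncons : ∀ {u a b v} → Trail R k u a b v → v ≡ a ⊎ ∃₂ λ j c → u ≢ c × Trail R j a c b v
  uncons (one _)       = inj₁ refl
  uncons (cons _ ne p) = inj₂ (_ , _ , ne , p)

  -- An edge put in front of a trail can backtrack only at once, and then it cancels against the
  -- first edge of the trail.
  reduce : ∀ {u v} → Walk R k u v → u ≡ v ⊎ ∃ λ j → ∃₂ λ a b → Trail R j u a b v × j ≤ k
  reduce [] = inj₁ refl
  reduce (_∷_ {u = u} e w) with reduce w
  ... | inj₁ refl = inj₂ (1 , _ , _ , one e , s≤s z≤n)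
  ... | inj₂ (j , c , b , p , j≤) with u Fin.≟ c
  ...   | no  u≢c = inj₂ (suc j , _ , b , cons e u≢c p , s≤s j≤)
  ...   | yes refl with p
  ...     | one _      = inj₁ refl
  ...     | cons _ _ q = inj₂ (_ , _ , b , q , ≤-trans (n≤1+n _) (m≤n⇒m≤1+n j≤))

  _++ʷ_ : ∀ {u v w} → Walk R j u v → Walk R k v w → Walk R (j + k) u w
  []      ++ʷ q = q
  (e ∷ p) ++ʷ q = e ∷ (p ++ʷ q)

  module _ (symm : ∀ {u v} → R u v → R v u) where

    reverse : ∀ {u a b v} → Trail R k u a b v → Trail R k v b a u
    reverse (one e) = one (symm e)
    reverse {u = u} {a} {b} {v} (cons {k} e ne p) =
      subst (λ k → Trail R k v b a u) (+-comm k 1) (append (reverse p) (one (symm e)) (ne ∘ sym))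

    reverseʷ : ∀ {u v} → Walk R k u v → Walk R k v u
    reverseʷ [] = []
    reverseʷ {u = u} {v} (_∷_ {k = k} e w) = subst (λ k → Walk R k v u) (+-comm k 1) (reverseʷ w ++ʷ (symm e ∷ []))

module _ (G : Graph n) where
  open Graph G

  -- Unlike the cycles in `IsTree`, trails can be spliced by `append`, and every later uniqueness
  -- argument closes two trails up in this way. The two notions are shown equivalent below.
  Acyclic : Set
  Acyclic = ∀ {k u a b} → ¬ Trail _~_ k u a b u

  -- A certificate of acyclicity: each vertex has at most one neighbour of lower rank, its parent.
  record Ranking : Set where
    field
      rank         : Fin n → ℕ
      distinct     : ∀ {u v} → u ~ v → rank u ≢ rank v
      lower-unique : ∀ {u v w} → u ~ v → u ~ w → rank v < rank u → rank w < rank u → v ≡ w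

  module _ (ρ : Ranking) where

    open Ranking ρ

    -- After a step up, the only lower neighbour is the vertex just left, and going back to it would
    -- be backtracking.
    rising : ∀ {u a b v} → Trail _~_ k u a b v → rank u < rank a → rank u < rank v × rank b < rank v
    rising (one _) lt = lt , lt
    rising (cons {u = u} {a} {c} e u≢c p) lt with <-cmp (rank a) (rank c)
    ... | tri< a<c _ _ = let a<v , b<v = rising p a<c in <-trans lt a<v , b<v
    ... | tri> _ _ c<a = contradiction (lower-unique (symmetric e) (edge-first p) lt c<a) u≢c
    ... | tri≈ _ a≡c _ = contradiction a≡c (distinct (edge-first p))

    ranking⇒acyclic : Acyclic
    ranking⇒acyclic = closed (<-wellFounded _)
      where
      closed : Acc _<_ k → ∀ {u a b} → ¬ Trail _~_ k u a b u
      closed (acc rec) {u} {a} {b} p with <-cmp (rank u) (rank a) | <-cmp (rank u) (rank b)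
      ... | tri< lt _ _ | _           = <-irrefl refl (proj₁ (rising p lt))
      ... | tri≈ _ eq _ | _           = distinct (edge-first p) eq
      ... | tri> _ _ gt | tri< lt _ _ = <-irrefl refl (proj₁ (rising (reverse symmetric p) lt))
      ... | tri> _ _ gt | tri≈ _ eq _ = distinct (edge-first (reverse symmetric p)) eq
      -- Both ends go down from `u`, hence to the same neighbour; without its first and last edge
      -- the trail is a shorter closed one.
      ... | tri> _ _ gt | tri> _ _ gt′
        with refl ← lower-unique (edge-first p) (edge-first (reverse symmetric p)) gt gt′ with p
      ...   | one e = irrefl refl e
      ...   | cons {u = u} {c = c} e u≢c q with reverse symmetric q
      ...     | one _      = u≢c refl
      ...     | cons _ _ r = closed (rec (m≤n⇒m≤1+n ≤-refl)) r

  acyclic⇒isTree : Acyclic → IsTree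
  acyclic⇒isTree acyclic {k} c ((inj , adj) , close) =
    acyclic (append (path⇒trail c inj adj) (one close) λ eq → case inj eq of λ ())
    where
    path⇒trail : ∀ {k} (p : Fin (2 + k) → Fin n) → Injective _≡_ _≡_ p → (∀ i → p (inject₁ i) ~ p (suc i)) →
                 Trail _~_ (suc k) (p zero) (p (suc zero)) (p (inject₁ (fromℕ k))) (p (fromℕ (suc k)))
    path⇒trail {zero}  p inj adj = one (adj zero)
    path⇒trail {suc k} p inj adj =
      cons (adj zero) (λ eq → case inj eq of λ ()) (path⇒trail (p ∘ suc) (λ eq → Fin.suc-injective (inj eq))
            (adj ∘ suc))

  vertexAt : ∀ {u a b v} → Trail _~_ k u a b v → Fin (suc k) → Fin n
  vertexAt {u = u} _ zero    = u
  vertexAt (one {v = v} _) (suc i) = v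
  vertexAt (cons _ _ p) (suc i) = vertexAt p i

  vertexAt-last : ∀ {u a b v} (p : Trail _~_ k u a b v) → vertexAt p (fromℕ k) ≡ v
  vertexAt-last (one _)      = refl
  vertexAt-last (cons _ _ p) = vertexAt-last p

  vertexAt-adj : ∀ {u a b v} (p : Trail _~_ k u a b v) x y → toℕ y ≡ suc (toℕ x) → vertexAt p x ~ vertexAt p y
  vertexAt-adj (one e)      zero    (suc y) eq = e
  vertexAt-adj (one e) (suc zero) (suc zero) ()
  vertexAt-adj (cons e _ p@(one _))      zero (suc zero) eq = e
  vertexAt-adj (cons e _ p@(cons _ _ _)) zero (suc zero) eq = e
  vertexAt-adj (cons e _ p) (suc x) (suc y) eq = vertexAt-adj p x y (suc-injective eq)

  module _ (tree : IsTree) where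

    vertexAt-injective : ∀ {u a b v} (p : Trail _~_ k u a b v) → Injective _≡_ _≡_ (vertexAt p)
    -- A return to `u` would close a cycle with the part of the trail before it, whose vertices are
    -- distinct by the mutual induction. A return right after the first edge is excluded by `u ≢ c`.
    start-new : ∀ {u a c b v} → u ~ a → u ≢ c → (p : Trail _~_ k a c b v) → ∀ i → u ≢ vertexAt p i

    vertexAt-injective (one e) {zero} {zero} _ = refl
    vertexAt-injective (one e) {zero} {suc _} eq = contradiction e (irrefl eq)
    vertexAt-injective (one e) {suc _} {zero} eq = contradiction e (irrefl (sym eq))
    vertexAt-injective (one e) {suc zero} {suc zero} _ = refl
    vertexAt-injective (cons e ne p) {zero} {zero} _ = refl
    vertexAt-injective (cons e ne p) {zero} {suc y} eq = contradiction eq (start-new e ne p y)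
    vertexAt-injective (cons e ne p) {suc x} {zero} eq = contradiction (sym eq) (start-new e ne p x)
    vertexAt-injective (cons e ne p) {suc x} {suc y} eq = cong suc (vertexAt-injective p eq)

    start-new e ne p zero refl = irrefl refl e
    start-new e ne (one _) (suc zero) refl = ne refl
    start-new e ne (cons _ _ (one _)) (suc zero) refl = ne refl
    start-new e ne (cons _ _ (cons _ _ _)) (suc zero) refl = ne refl
    start-new {k} {u} {a} e ne p (suc (suc i)) eq = tree cycle ((cycle-inj , cycle-adj) , cycle-close)
      where
      end : Fin (suc k)
      end = suc (suc i)
      cycle : Fin (3 + toℕ i) → Fin n
      cycle zero    = u
      cycle (suc x) = vertexAt p (inject {i = end} x)
      ≢end : ∀ x → u ≢ vertexAt p (inject {i = end} x)
      ≢end x eq′ = <⇒≢ (Fin.toℕ<n x) (trans (sym (Fin.toℕ-inject {i = end} x))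
            (cong toℕ (vertexAt-injective p (trans (sym eq′) eq))))
      cycle-inj : Injective _≡_ _≡_ cycle
      cycle-inj {zero}  {zero}  _   = refl
      cycle-inj {zero}  {suc y} eq′ = contradiction eq′ (≢end y)
      cycle-inj {suc x} {zero}  eq′ = contradiction (sym eq′) (≢end x)
      cycle-inj {suc x} {suc y} eq′ = cong suc (Fin.toℕ-injective (trans (sym (Fin.toℕ-inject {i = end} x))
        (trans (cong toℕ (vertexAt-injective p eq′)) (Fin.toℕ-inject {i = end} y))))
      cycle-adj : ∀ x → cycle (inject₁ x) ~ cycle (suc x)
      cycle-adj zero    = e
      cycle-adj (suc x) = vertexAt-adj p (inject {i = end} (inject₁ x)) (inject {i = end} (suc x))
        (trans (Fin.toℕ-inject {i = end} (suc x)) (cong suc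
              (trans (sym (Fin.toℕ-inject₁ x)) (sym (Fin.toℕ-inject {i = end} (inject₁ x))))))
      cycle-close : cycle (fromℕ (2 + toℕ i)) ~ u
      cycle-close = subst (cycle (fromℕ (2 + toℕ i)) ~_) (sym eq)
        (vertexAt-adj p (inject {i = end} (fromℕ (1 + toℕ i))) end
          (cong suc (trans (sym (Fin.toℕ-fromℕ (suc (toℕ i))))
                (sym (Fin.toℕ-inject {i = end} (fromℕ (suc (toℕ i))))))))

    isTree⇒acyclic : Acyclic
    isTree⇒acyclic p@(one e)      = irrefl refl e
    isTree⇒acyclic p@(cons _ _ q) = case vertexAt-injective p {zero} {fromℕ _} (sym (vertexAt-last p)) of λ ()

    trail-length-< : ∀ {u a b v} → Trail _~_ k u a b v → k < n
    trail-length-< p = Fin.injective⇒≤ (vertexAt-injective p)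

-- Distances, eccentricities and uniqueness of trails

module _ (G : Graph n) where
  open Graph G

  dist-walk : ∀ u v → Walk _~_ (dist G u v) u v
  dist-walk u v = proj₁ (proj₂ (shortest G u v))

  dist-≤ : ∀ {u v} → Walk _~_ k u v → dist G u v ≤ k
  dist-≤ {u = u} {v} w = proj₂ (proj₂ (shortest G u v)) w

  dist-refl : ∀ {u} → dist G u u ≡ 0
  dist-refl = n≤0⇒n≡0 (dist-≤ [])

  dist-sym : ∀ u v → dist G u v ≡ dist G v u
  dist-sym u v = ≤-antisym (dist-≤ (reverseʷ symmetric (dist-walk v u))) (dist-≤ (reverseʷ symmetric (dist-walk u v)))

  dist-triangle : ∀ u v w → dist G u w ≤ dist G u v + dist G v w
  dist-triangle u v w = dist-≤ (dist-walk u v ++ʷ dist-walk v w)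

  dist≡0 : ∀ {u v} → dist G u v ≡ 0 → u ≡ v
  dist≡0 {u} {v} eq with dist G u v | dist-walk u v
  dist≡0 refl | .0 | [] = refl

  dist-≤-ecc : ∀ u v → dist G u v ≤ ecc G u
  dist-≤-ecc u v = All.lookup (All.map⁻ (xs≤max 0 (map (dist G u) (allFin n)))) (∈-allFin v)

  ecc-≤ : ∀ {u} → (∀ v → dist G u v ≤ k) → ecc G u ≤ k
  ecc-≤ le = max≤v⁺ z≤n (All.map⁺ (All.universal le (allFin n)))

  ecc-attained : ∀ u → ∃ λ v → dist G u v ≡ ecc G u
  ecc-attained u with Fin.any? (λ v → ecc G u ≤? dist G u v)
  ... | yes (v , le) = v , ≤-antisym (dist-≤-ecc u v) le
  ... | no  none     = ⊥-elim (absurd (ecc G u) refl)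
    where
    absurd : ∀ e → ecc G u ≡ e → ⊥
    absurd zero    eq = none (u , ≤-trans (≤-reflexive eq) z≤n)
    absurd (suc e) eq = <⇒≱ (≤-reflexive (sym eq)) (ecc-≤ λ v →
      ≤-pred (≤-trans (≰⇒> λ le → none (v , le)) (≤-reflexive eq)))

  setDist-≤ : ∀ {P Q : U.Pred (Fin n) 0ℓ} (P? : U.Decidable P) (Q? : U.Decidable Q) {u v} → P u → Q v →
              setDist G P? Q? ≤ dist G u v
  setDist-≤ P? Q? {u} {v} Pu Qv = All.lookup (All.map⁻ (min≤xs n _))
    (∈-cartesianProduct⁺ (∈-filter⁺ P? (∈-allFin u) Pu) (∈-filter⁺ Q? (∈-allFin v) Qv))

  ≤-setDist : ∀ {P Q : U.Pred (Fin n) 0ℓ} (P? : U.Decidable P) (Q? : U.Decidable Q) → k ≤ n →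
              (∀ {u v} → P u → Q v → k ≤ dist G u v) → k ≤ setDist G P? Q?
  ≤-setDist P? Q? k≤n bound = v≤min⁺ k≤n (All.map⁺ {xs = cartesianProduct (filter P? (allFin n))
        (filter Q? (allFin n))} (All.tabulate λ {(u , v)} uv∈ →
    let u∈ , v∈ = ∈-cartesianProduct⁻ (filter P? (allFin n)) (filter Q? (allFin n)) uv∈ in
    bound (proj₂ (∈-filter⁻ P? {xs = allFin n} u∈)) (proj₂ (∈-filter⁻ Q? {xs = allFin n} v∈))))

  module AcyclicProperties (acyclic : Acyclic G) where

    first-unique : ∀ {u a b v c d} → Trail _~_ j u a b v → Trail _~_ k u c d v → a ≡ c
    first-unique {a = a} {c = c} p q with a Fin.≟ c
    ... | yes a≡c = a≡c
    ... | no  a≢c = ⊥-elim (acyclic (append (reverse symmetric p) q a≢c))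

    last-unique : ∀ {u a b v c d} → Trail _~_ j u a b v → Trail _~_ k u c d v → b ≡ d
    last-unique p q = first-unique (reverse symmetric p) (reverse symmetric q)

    length-unique : ∀ {u a b v c d} → Trail _~_ j u a b v → Trail _~_ k u c d v → j ≡ k
    length-unique p q with refl ← first-unique p q with p | q
    ... | one _      | one _      = refl
    ... | one _      | cons _ _ q = ⊥-elim (acyclic q)
    ... | cons _ _ p | one _      = ⊥-elim (acyclic p)
    ... | cons _ _ p | cons _ _ q = cong suc (length-unique p q)

    dist-trail : ∀ {u a b v} → Trail _~_ k u a b v → dist G u v ≡ k
    dist-trail {u = u} {v = v} p with reduce (dist-walk u v)
    ... | inj₁ refl = ⊥-elim (acyclic p)
    ... | inj₂ (j , a , b , q , j≤) = ≤-antisym (dist-≤ (trail⇒walk p)) (subst (_≤ dist G u v) (length-unique q p) j≤)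

    trail : ∀ {u v} → u ≢ v → ∃₂ λ a b → Trail _~_ (dist G u v) u a b v
    trail {u} {v} u≢v with reduce (dist-walk u v)
    ... | inj₁ u≡v = contradiction u≡v u≢v
    ... | inj₂ (j , a , b , p , _) = a , b , subst (λ k → Trail _~_ k u a b v) (sym (dist-trail p)) p

-- Counting subtrees

-- The injection is given as a relation, so that one relation between subtrees and indices serves
-- for both inequalities of a count.
length-≤ : {A B : Set} (R : A → B → Set) → (∀ {x x′ y} → R x y → R x′ y → x ≡ x′) →
           ∀ {xs : List A} {ys : List B} → Unique xs → (∀ {x} → x ∈ xs → ∃ λ y → y ∈ ys × R x y) →
           length xs ≤ length ys
length-≤ R inj {[]}     _             _     = z≤n
length-≤ R inj {x ∷ xs} (x∉xs ∷ uniq) image with y , y∈ , r ← image (here refl)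
  with as , bs , refl ← ∈-∃++ y∈ = begin
  suc (length xs)              ≤⟨ s≤s (length-≤ R inj uniq image′) ⟩
  suc (length (as ++ bs))      ≡⟨ cong suc (length-++ as) ⟩
  suc (length as + length bs)  ≡⟨ +-suc (length as) (length bs) ⟨
  length as + suc (length bs)  ≡⟨ length-++ as ⟨
  length (as ++ y ∷ bs)        ∎
  where
  open ≤-Reasoning
  image′ : ∀ {x′} → x′ ∈ xs → ∃ λ y′ → y′ ∈ as ++ bs × R x′ y′
  image′ x′∈ with y′ , y′∈ , r′ ← image (there x′∈) with ∈-++⁻ as y′∈
  ... | inj₁ ∈as         = y′ , ∈-++⁺ˡ ∈as , r′
  ... | inj₂ (there ∈bs) = y′ , ∈-++⁺ʳ as ∈bs , r′
  ... | inj₂ (here refl) = contradiction (inj r r′) (All.lookup x∉xs x′∈)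

length-≡ : {A : Set} {xs ys : List A} → Unique xs → Unique ys →
           (∀ {x} → x ∈ xs → x ∈ ys) → (∀ {x} → x ∈ ys → x ∈ xs) → length xs ≡ length ys
length-≡ ux uy xs⊆ys ys⊆xs = ≤-antisym
  (length-≤ _≡_ (λ p q → trans p (sym q)) ux (λ {x} x∈ → x , xs⊆ys x∈ , refl))
  (length-≤ _≡_ (λ p q → trans p (sym q)) uy (λ {x} x∈ → x , ys⊆xs x∈ , refl))

walk-map : {R R′ : Rel (Fin n) 0ℓ} → (∀ {u v} → R u v → R′ u v) → ∀ {u v} → Walk R k u v → Walk R′ k u v
walk-map f []      = []
walk-map f (e ∷ w) = f e ∷ walk-map f w

trail-map : {R R′ : Rel (Fin n) 0ℓ} → (∀ {u v} → R u v → R′ u v) →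
            ∀ {u a b v} → Trail R k u a b v → Trail R′ k u a b v
trail-map f (one e)       = one (f e)
trail-map f (cons e ne p) = cons (f e) ne (trail-map f p)

module _ {P : U.Pred (Fin n) 0ℓ} (P? : U.Decidable P) where

  toSubset : Subset n
  toSubset = tabulate (does ∘ P?)

  ∈-toSubset⁺ : ∀ {x} → P x → x ∈ˢ toSubset
  ∈-toSubset⁺ {x} px = lookup⇒[]= x toSubset (trans (lookup∘tabulate (does ∘ P?) x) (dec-true (P? x) px))

  ∈-toSubset⁻ : ∀ {x} → x ∈ˢ toSubset → P x
  ∈-toSubset⁻ {x} x∈ with P? x | trans (sym (lookup∘tabulate (does ∘ P?) x)) ([]=⇒lookup x∈)
  ... | yes px | _ = px

lookup-ext : {A : Set} (xs ys : Vec A n) → (∀ i → lookup xs i ≡ lookup ys i) → xs ≡ ys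
lookup-ext xs ys eq = trans (sym (tabulate∘lookup xs)) (trans (tabulate-cong eq) (tabulate∘lookup ys))

∈-allVecs : {A : Set} {xs : List A} → (∀ x → x ∈ xs) → ∀ {k} (v : Vec A k) → v ∈ allVecs xs k
∈-allVecs all []      = here refl
∈-allVecs all (x ∷ v) = ∈-cartesianProductWith⁺ _∷_ (all x) (∈-allVecs all v)

allVecs-unique : {A : Set} {xs : List A} → Unique xs → ∀ k → Unique (allVecs xs k)
allVecs-unique uniq zero    = [] ∷ []
allVecs-unique uniq (suc k) = Unique.cartesianProductWith⁺ _∷_ ∷-injective uniq (allVecs-unique uniq k)

∈-allSubsets : (X : Subset n) → X ∈ allSubsets n
∈-allSubsets = ∈-allVecs λ { true → here refl ; false → there (here refl) }

allSubsets-unique : ∀ n → Unique (allSubsets n)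
allSubsets-unique = allVecs-unique (((λ ()) ∷ []) ∷ [] ∷ [])

∈-allSubs : (S : Sub n) → S ∈ allSubs n
∈-allSubs S = ∈-cartesianProductWith⁺ _ (∈-allSubsets (Sub.vertices S)) (∈-allVecs ∈-allSubsets (Sub.rows S))

allSubs-unique : ∀ n → Unique (allSubs n)
allSubs-unique n = Unique.cartesianProductWith⁺ _ (λ eq → cong Sub.vertices eq , cong Sub.rows eq)
  (allSubsets-unique n) (allVecs-unique (allSubsets-unique n) n)

module _ (G : Graph n) (acyclic : Acyclic G) where
  open Graph G
  open AcyclicProperties G acyclic
  open Sub

  -- A walk from `x` to `y` inside `S` reduces to a trail, and acyclicity makes that trail start
  -- with the edge `x ~ y`, which therefore belongs to `S`. Subtrees are thus determined by their
  -- vertices.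
  subtree-induced : ∀ S → IsSubtree G S → ∀ {x y} → x ∈ˢ vertices S → y ∈ˢ vertices S → x ~ y → Edge S x y
  subtree-induced S (isSub , _ , conn) {x} {y} x∈ y∈ x~y with k , w ← conn x y x∈ y∈ with reduce w
  ... | inj₁ refl = contradiction x~y (irrefl refl)
  ... | inj₂ (_ , a , _ , p , _) with refl ← first-unique (trail-map (λ {u} {v} e → proj₁ (isSub u v e)) p)
        (one x~y) with p
  ...   | one e      = e
  ...   | cons e _ _ = e

  subtree-≡ : ∀ S S′ → IsSubtree G S → IsSubtree G S′ → vertices S ≡ vertices S′ → S ≡ S′
  subtree-≡ S S′ sub@(isSub , _) sub′@(isSub′ , _) eq = Sub-≡ eq (lookup-ext (rows S) (rows S′) λ u →
    ⊆-antisym (λ e → transfer S S′ sub sub′ eq e) (λ e → transfer S′ S sub′ sub (sym eq) e))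
    where
    Sub-≡ : ∀ {S S′ : Sub n} → vertices S ≡ vertices S′ → rows S ≡ rows S′ → S ≡ S′
    Sub-≡ refl refl = refl
    transfer : ∀ S S′ → IsSubtree G S → IsSubtree G S′ → vertices S ≡ vertices S′ →
               ∀ {u w} → Edge S u w → Edge S′ u w
    transfer S S′ (isSub , _) sub′ refl {u} {w} e with u~w , e′ , u∈ ← isSub u w e =
      subtree-induced S′ sub′ u∈ (proj₂ (proj₂ (isSub w u e′))) u~w

  -- A duplicate-free list indexing the vertex sets of the subtrees that contain v.
  record Indexing (v : Fin n) : Set₁ where
    field
      {Index}   : Set
      indices   : List Index
      unique    : Unique indices
      complete  : ∀ κ → κ ∈ indices
      Mem       : Index → U.Pred (Fin n) 0ℓ
      mem?      : ∀ κ → U.Decidable (Mem κ)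
      injective : ∀ {κ κ′} → (∀ x → Mem κ x → Mem κ′ x) → (∀ x → Mem κ′ x → Mem κ x) → κ ≡ κ′
      index     : ∀ S → IsSubtree G S → v ∈ˢ vertices S →
                  ∃ λ κ → (∀ x → x ∈ˢ vertices S → Mem κ x) × (∀ x → Mem κ x → x ∈ˢ vertices S)
      contains  : ∀ κ → Mem κ v
      joined    : ∀ κ {x} → Mem κ x → Joined (λ u w → u ~ w × Mem κ u × Mem κ w) v x

  subtreeCount-indexing : ∀ {v} (I : Indexing v) → subtreeCount G v ≡ length (Indexing.indices I)
  subtreeCount-indexing {v} I = ≤-antisym
    (length-≤ Represents represents-inj (Unique.filter⁺ P? (allSubs-unique n)) λ {S} S∈ →
      let isSub , v∈ = proj₂ (∈-filter⁻ P? {xs = allSubs n} S∈)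
          κ , S⊆κ , κ⊆S = index S isSub v∈
      in κ , complete κ , isSub , S⊆κ , κ⊆S)
    (length-≤ (λ κ S → Represents S κ) (λ (_ , f , g) (_ , f′ , g′) → injective (λ x → f′ x ∘ g x)
          (λ x → f x ∘ g′ x)) unique λ {κ} _ →
      sub κ , ∈-filter⁺ P? (∈-allSubs (sub κ)) (sub-isSubtree κ , ∈-toSubset⁺ (mem? κ) (contains κ)) ,
      sub-isSubtree κ , (λ _ → ∈-toSubset⁻ (mem? κ)) , (λ _ → ∈-toSubset⁺ (mem? κ)))
    where
    open Indexing I

    P? : U.Decidable (λ S → IsSubtree G S × v ∈ˢ vertices S)
    P? S = isSubtree? G S ×-dec v ∈ˢ? vertices S

    Represents : Sub n → Index → Set
    Represents S κ = IsSubtree G S × (∀ x → x ∈ˢ vertices S → Mem κ x) × (∀ x → Mem κ x → x ∈ˢ vertices S)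

    represents-inj : ∀ {S S′ κ} → Represents S κ → Represents S′ κ → S ≡ S′
    represents-inj {S} {S′} (isSub , f , g) (isSub′ , f′ , g′) =
      subtree-≡ S S′ isSub isSub′ (⊆-antisym (λ {x} → g′ x ∘ f x) (λ {x} → g x ∘ f′ x))

    E? : ∀ κ u → U.Decidable (λ w → u ~ w × Mem κ u × Mem κ w)
    E? κ u w = (u ~? w) ×-dec mem? κ u ×-dec mem? κ w

    sub : Index → Sub n
    sub κ = record { vertices = toSubset (mem? κ) ; rows = tabulate (λ u → toSubset (E? κ u)) }

    edge⁺ : ∀ κ {u w} → u ~ w × Mem κ u × Mem κ w → Edge (sub κ) u w
    edge⁺ κ {u} {w} e = subst (w ∈ˢ_) (sym (lookup∘tabulate (λ u → toSubset (E? κ u)) u)) (∈-toSubset⁺ (E? κ u) e)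

    edge⁻ : ∀ κ {u w} → Edge (sub κ) u w → u ~ w × Mem κ u × Mem κ w
    edge⁻ κ {u} {w} e = ∈-toSubset⁻ (E? κ u) (subst (w ∈ˢ_) (lookup∘tabulate (λ u → toSubset (E? κ u)) u) e)

    flip : ∀ κ {u w} → u ~ w × Mem κ u × Mem κ w → w ~ u × Mem κ w × Mem κ u
    flip κ (e , u∈ , w∈) = symmetric e , w∈ , u∈

    sub-isSubtree : ∀ κ → IsSubtree G (sub κ)
    sub-isSubtree κ =
        (λ u w e → let u~w , u∈ , w∈ = edge⁻ κ e in
           u~w , edge⁺ κ (symmetric u~w , w∈ , u∈) , ∈-toSubset⁺ (mem? κ) u∈)
      , (v , ∈-toSubset⁺ (mem? κ) (contains κ))
      , λ x y x∈ y∈ →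
          let j , p = joined κ (∈-toSubset⁻ (mem? κ) x∈)
              k , q = joined κ (∈-toSubset⁻ (mem? κ) y∈)
          in j + k , walk-map (edge⁺ κ) (reverseʷ (flip κ) p ++ʷ q)

-- Rooted binary trees inside a graph

data Shape : Set where
  leaf : Shape
  node : Shape → Shape → Shape

private
  variable
    s t l r : Shape

inner : Shape → ℕ
inner leaf       = 0
inner (node l r) = suc (inner l + inner r)

depthˢ : Shape → ℕ
depthˢ leaf       = 0
depthˢ (node l r) = suc (depthˢ l ⊔ depthˢ r)

rootedSubtrees : Shape → ℕ
rootedSubtrees leaf       = 1
rootedSubtrees (node l r) = suc (rootedSubtrees l) * suc (rootedSubtrees r)

data Pos : Shape → Set where
  here  : Pos t
  left  : Pos l → Pos (node l r)
  right : Pos r → Pos (node l r)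

depth : Pos t → ℕ
depth here      = 0
depth (left p)  = suc (depth p)
depth (right p) = suc (depth p)

depth-≤ : (p : Pos t) → depth p ≤ depthˢ t
depth-≤ here      = z≤n
depth-≤ (left p)  = s≤s (m≤n⇒m≤n⊔o _ (depth-≤ p))
depth-≤ (right p) = s≤s (m≤n⇒m≤o⊔n _ (depth-≤ p))

deepest : ∀ t → ∃ λ (p : Pos t) → depth p ≡ depthˢ t
deepest leaf = here , refl
deepest (node l r) with ⊔-sel (depthˢ l) (depthˢ r) | deepest l | deepest r
... | inj₁ eq | p , eq′ | _ = left p , cong suc (trans eq′ (sym eq))
... | inj₂ eq | _ | p , eq′ = right p , cong suc (trans eq′ (sym eq))

depthˢ≤inner : ∀ t → depthˢ t ≤ inner t
depthˢ≤inner leaf       = z≤n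
depthˢ≤inner (node l r) = s≤s (⊔-lub (≤-trans (depthˢ≤inner l) (m≤m+n _ _)) (≤-trans (depthˢ≤inner r) (m≤n+m _ _)))

inner≤fullSize : ∀ t → inner t ≤ fullSize (depthˢ t)
inner≤fullSize leaf       = z≤n
inner≤fullSize (node l r) = s≤s (+-mono-≤
  (≤-trans (inner≤fullSize l) (fullSize-mono (m≤m⊔n (depthˢ l) _)))
  (≤-trans (inner≤fullSize r) (fullSize-mono (m≤n⊔m (depthˢ l) _))))

left-injective : {p q : Pos l} → left {r = r} p ≡ left q → p ≡ q
left-injective refl = refl

right-injective : {p q : Pos r} → right {l = l} p ≡ right q → p ≡ q
right-injective refl = refl

allPos : ∀ t → List (Pos t)
allPos leaf       = here ∷ []
allPos (node l r) = here ∷ map left (allPos l) ++ map right (allPos r)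

∈-allPos : (p : Pos t) → p ∈ allPos t
∈-allPos {leaf}     here      = here refl
∈-allPos {node l r} here      = here refl
∈-allPos {node l r} (left p)  = there (∈-++⁺ˡ (∈-map⁺ left (∈-allPos p)))
∈-allPos {node l r} (right p) = there (∈-++⁺ʳ (map left (allPos l)) (∈-map⁺ right (∈-allPos p)))

allPos-unique : ∀ t → Unique (allPos t)
allPos-unique leaf       = [] ∷ []
allPos-unique (node l r) = All.tabulate here≢ ∷
  Unique.++⁺ (Unique.map⁺ left-injective (allPos-unique l)) (Unique.map⁺ right-injective (allPos-unique r)) disjoint
  where
  here≢ : ∀ {p} → p ∈ map left (allPos l) ++ map right (allPos r) → here ≢ p
  here≢ p∈ refl with ∈-++⁻ (map left (allPos l)) p∈
  ... | inj₁ p∈l with ∈-map⁻ left p∈l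
  ...   | ()
  here≢ p∈ refl | inj₂ p∈r with ∈-map⁻ right p∈r
  ...   | ()
  disjoint : ∀ {p} → ¬ (p ∈ map left (allPos l) × p ∈ map right (allPos r))
  disjoint (p∈l , p∈r) with ∈-map⁻ left p∈l | ∈-map⁻ right p∈r
  ... | _ , _ , refl | _ , _ , ()

length-allPos : ∀ t → length (allPos t) ≡ suc (2 * inner t)
length-allPos leaf       = refl
length-allPos (node l r) = cong suc (begin
  length (map left (allPos l) ++ map right (allPos r))          ≡⟨ length-++ (map left (allPos l)) ⟩
  length (map left (allPos l)) + length (map right (allPos r))
    ≡⟨ cong₂ _+_ (length-map left (allPos l)) (length-map right (allPos r)) ⟩
  length (allPos l) + length (allPos r)                         ≡⟨ cong₂ _+_ (length-allPos l) (length-allPos r) ⟩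
  suc (2 * inner l) + suc (2 * inner r)                         ≡⟨ +-suc (suc (2 * inner l)) _ ⟩
  2 + (2 * inner l + 2 * inner r)                               ≡⟨ cong (2 +_) (*-distribˡ-+ 2 (inner l) (inner r)) ⟨
  2 + 2 * (inner l + inner r)                                   ≡⟨ *-distribˡ-+ 2 1 (inner l + inner r) ⟨
  2 * suc (inner l + inner r)                                   ∎)
  where open ≡-Reasoning

-- A subtree of a rooted binary tree that contains the root.
data Sel : Shape → Set where
  stop : Sel leaf
  fork : Maybe (Sel l) → Maybe (Sel r) → Sel (node l r)

infix 4 _∈ₛ_ _∈ₒ_

data _∈ₛ_ : Pos t → Sel t → Set

_∈ₒ_ : Pos t → Maybe (Sel t) → Set
p ∈ₒ m = Anyᵐ (p ∈ₛ_) m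

data _∈ₛ_ where
  here  : ∀ {σ : Sel t} → here ∈ₛ σ
  left  : ∀ {m : Maybe (Sel l)} {m′ : Maybe (Sel r)} {p} → p ∈ₒ m → left p ∈ₛ fork m m′
  right : ∀ {m : Maybe (Sel l)} {m′ : Maybe (Sel r)} {p} → p ∈ₒ m′ → right p ∈ₛ fork m m′

sel-ext : {σ σ′ : Sel t} → (∀ {p} → p ∈ₛ σ → p ∈ₛ σ′) → (∀ {p} → p ∈ₛ σ′ → p ∈ₛ σ) → σ ≡ σ′
opt-ext : {m m′ : Maybe (Sel t)} → (∀ {p} → p ∈ₒ m → p ∈ₒ m′) → (∀ {p} → p ∈ₒ m′ → p ∈ₒ m) → m ≡ m′

sel-ext {σ = stop}     {stop}     _ _ = refl
sel-ext {σ = fork _ _} {fork _ _} f g = cong₂ fork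
  (opt-ext (λ p∈ → case f (left p∈) of λ { (left q∈) → q∈ }) (λ p∈ → case g (left p∈) of λ { (left q∈) → q∈ }))
  (opt-ext (λ p∈ → case f (right p∈) of λ { (right q∈) → q∈ }) (λ p∈ → case g (right p∈) of λ { (right q∈) → q∈ }))

opt-ext {m = nothing} {nothing} f g = refl
opt-ext {m = nothing} {just σ}  f g with g (just here)
... | ()
opt-ext {m = just σ}  {nothing} f g with f (just here)
... | ()
opt-ext {m = just σ}  {just σ′} f g = cong just (sel-ext
  (λ p∈ → case f (just p∈) of λ { (just q∈) → q∈ }) (λ p∈ → case g (just p∈) of λ { (just q∈) → q∈ }))

allSel : ∀ t → List (Sel t)

allOpt : ∀ t → List (Maybe (Sel t))
allOpt t = nothing ∷ map just (allSel t)

allSel leaf       = stop ∷ []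
allSel (node l r) = cartesianProductWith fork (allOpt l) (allOpt r)

length-cartesianProductWith : {A B C : Set} (f : A → B → C) (xs : List A) (ys : List B) →
                              length (cartesianProductWith f xs ys) ≡ length xs * length ys
length-cartesianProductWith f []       ys = refl
length-cartesianProductWith f (x ∷ xs) ys = trans (length-++ (map (f x) ys))
  (cong₂ _+_ (length-map (f x) ys) (length-cartesianProductWith f xs ys))

length-allSel : ∀ t → length (allSel t) ≡ rootedSubtrees t
length-allOpt : ∀ t → length (allOpt t) ≡ suc (rootedSubtrees t)
length-allSel leaf       = refl
length-allSel (node l r) = trans (length-cartesianProductWith fork (allOpt l) (allOpt r))
  (cong₂ _*_ (length-allOpt l) (length-allOpt r))
length-allOpt t = cong suc (trans (length-map just (allSel t)) (length-allSel t))

∈-allSel : (σ : Sel t) → σ ∈ allSel t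
∈-allOpt : (m : Maybe (Sel t)) → m ∈ allOpt t
∈-allSel stop        = here refl
∈-allSel (fork m m′) = ∈-cartesianProductWith⁺ fork (∈-allOpt m) (∈-allOpt m′)
∈-allOpt nothing  = here refl
∈-allOpt (just σ) = there (∈-map⁺ just (∈-allSel σ))

allSel-unique : ∀ t → Unique (allSel t)
allOpt-unique : ∀ t → Unique (allOpt t)
allSel-unique leaf       = [] ∷ []
allSel-unique (node l r) = Unique.cartesianProductWith⁺ fork (λ { refl → refl , refl }) (allOpt-unique l)
      (allOpt-unique r)
allOpt-unique t = All.tabulate nothing≢ ∷ Unique.map⁺ just-injective (allSel-unique t)
  where
  nothing≢ : ∀ {m} → m ∈ map just (allSel t) → nothing ≢ m
  nothing≢ m∈ refl with ∈-map⁻ just m∈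
  ... | ()

module _ (G : Graph n) where
  open Graph G

  -- The component of v after deleting the edges from v to its neighbours in N is,
  -- as a tree rooted at v, of shape t.
  data Branch (N : U.Pred (Fin n) 0ℓ) (v : Fin n) : Shape → Set where
    leaf : (∀ {w} → v ~ w → N w) → Branch N v leaf
    node : ∀ {x y} → v ~ x → v ~ y → ¬ N x → ¬ N y → x ≢ y → (∀ {w} → v ~ w → N w ⊎ w ≡ x ⊎ w ≡ y) →
           Branch (_≡ v) x l → Branch (_≡ v) y r → Branch N v (node l r)

module _ (X : Subset n) where

  guarded : ∀ {x} → Dec (x ∈ˢ X) → Sel t → Maybe (Sel t)
  guarded (yes _) σ = just σ
  guarded (no  _) σ = nothing

  guarded-∈⁻ : ∀ {x} (d : Dec (x ∈ˢ X)) {σ : Sel t} {p} → p ∈ₒ guarded d σ → x ∈ˢ X × p ∈ₛ σ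
  guarded-∈⁻ (yes x∈) (just p∈) = x∈ , p∈

  guarded-∈⁺ : ∀ {x} (d : Dec (x ∈ˢ X)) {σ : Sel t} {p} → x ∈ˢ X → p ∈ₛ σ → p ∈ₒ guarded d σ
  guarded-∈⁺ (yes _)  _  p∈ = just p∈
  guarded-∈⁺ (no x∉) x∈ _  = contradiction x∈ x∉

module _ {G : Graph n} where
  open Graph G

  private
    variable
      N : U.Pred (Fin n) 0ℓ
      v : Fin n

  vert : Branch G N v t → Pos t → Fin n
  vert {v = v} _ here = v
  vert (node _ _ _ _ _ _ bl br) (left p)  = vert bl p
  vert (node _ _ _ _ _ _ bl br) (right p) = vert br p

  route : (b : Branch G N v t) (p : Pos t) →
          p ≡ here ⊎ ∃₂ λ c d → Trail _~_ (depth p) v c d (vert b p) × ¬ N c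
  route b here = inj₁ refl
  route (node ex _ ¬Nx _ _ _ bl _) (left p) with route bl p
  ... | inj₁ refl                = inj₂ (_ , _ , one ex , ¬Nx)
  ... | inj₂ (c , d , w , c≢v)   = inj₂ (_ , _ , cons ex (c≢v ∘ sym) w , ¬Nx)
  route (node _ ey _ ¬Ny _ _ _ br) (right p) with route br p
  ... | inj₁ refl                = inj₂ (_ , _ , one ey , ¬Ny)
  ... | inj₂ (c , d , w , c≢v)   = inj₂ (_ , _ , cons ey (c≢v ∘ sym) w , ¬Ny)

  locate : (b : Branch G N v t) → ∀ {c d x} → Trail _~_ k v c d x → ¬ N c → ∃ λ p → vert b p ≡ x × depth p ≡ k
  locate b@(leaf all) w ¬Nc with w
  ... | one e      = contradiction (all e) ¬Nc
  ... | cons e _ _ = contradiction (all e) ¬Nc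
  locate (node _ _ _ _ _ all bl br) (one e) ¬Nc with all e
  ... | inj₁ Nc          = contradiction Nc ¬Nc
  ... | inj₂ (inj₁ refl) = left here , refl , refl
  ... | inj₂ (inj₂ refl) = right here , refl , refl
  locate (node _ _ _ _ _ all bl br) (cons e v≢c w) ¬Nc with all e
  ... | inj₁ Nc          = contradiction Nc ¬Nc
  ... | inj₂ (inj₁ refl) with p , eq , eq′ ← locate bl w (v≢c ∘ sym) = left p , eq , cong suc eq′
  ... | inj₂ (inj₂ refl) with p , eq , eq′ ← locate br w (v≢c ∘ sym) = right p , eq , cong suc eq′

  InSel : Branch G N v t → Sel t → U.Pred (Fin n) 0ℓ
  InSel b σ x = ∃ λ p → p ∈ₛ σ × vert b p ≡ x

  InOpt : Branch G N v t → Maybe (Sel t) → U.Pred (Fin n) 0ℓ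
  InOpt b m x = ∃ λ p → p ∈ₒ m × vert b p ≡ x

  inSel? : (b : Branch G N v t) (σ : Sel t) → U.Decidable (InSel b σ)
  inOpt? : (b : Branch G N v t) (m : Maybe (Sel t)) → U.Decidable (InOpt b m)

  inSel? {v = v} b σ x with v Fin.≟ x
  ... | yes v≡x = yes (here , here , v≡x)
  inSel? (leaf _) stop x | no v≢x = no λ { (here , here , eq) → v≢x eq }
  inSel? (node _ _ _ _ _ _ bl br) (fork m m′) x | no v≢x with inOpt? bl m x | inOpt? br m′ x
  ... | yes (p , p∈ , eq) | _                 = yes (left p , left p∈ , eq)
  ... | no _              | yes (p , p∈ , eq) = yes (right p , right p∈ , eq)
  ... | no ¬l             | no ¬r             = no λ where
    (here , here , eq)      → v≢x eq
    (left p , left p∈ , eq) → ¬l (p , p∈ , eq)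
    (right p , right p∈ , eq) → ¬r (p , p∈ , eq)
  inOpt? b nothing  x = no λ { (_ , () , _) }
  inOpt? b (just σ) x = map′ (λ (p , p∈ , eq) → p , just p∈ , eq) (λ { (p , just p∈ , eq) → p , p∈ , eq })
        (inSel? b σ x)

  -- `M` is any superset, because in the induction the selection is a part of the one above it, and
  -- across an edge a part of a pair of selections.
  sel-joined : (b : Branch G N v t) {σ : Sel t} {M : U.Pred (Fin n) 0ℓ} → (∀ {x} → InSel b σ x → M x) →
               ∀ {p} → p ∈ₛ σ → Joined (λ u w → u ~ w × M u × M w) v (vert b p)
  sel-joined b ⊆M {here} _ = 0 , []
  sel-joined (node ex _ _ _ _ _ bl br) ⊆M (left (just p∈))
    with k , w ← sel-joined bl (λ (q , q∈ , eq) → ⊆M (left q , left (just q∈) , eq)) p∈ =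
    suc k , (ex , ⊆M (here , here , refl) , ⊆M (left here , left (just here) , refl)) ∷ w
  sel-joined (node _ ey _ _ _ _ bl br) ⊆M (right (just p∈))
    with k , w ← sel-joined br (λ (q , q∈ , eq) → ⊆M (right q , right (just q∈) , eq)) p∈ =
    suc k , (ey , ⊆M (here , here , refl) , ⊆M (right here , right (just here) , refl)) ∷ w

  module _ (X : Subset n) where

    -- The vertices reachable from the root inside `X`: the descent stops at the first vertex
    -- outside.
    pick : Branch G N v t → Sel t
    pick (leaf _) = stop
    pick (node {x = x} {y} _ _ _ _ _ _ bl br) = fork (guarded X (x ∈ˢ? X) (pick bl)) (guarded X (y ∈ˢ? X) (pick br))

    pick-sound : (b : Branch G N v t) → v ∈ˢ X → ∀ {p} → p ∈ₛ pick b → vert b p ∈ˢ X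
    pick-sound b v∈ {here} _ = v∈
    pick-sound (node {x = x} _ _ _ _ _ _ bl br) v∈ (left p∈) =
      let x∈ , p∈′ = guarded-∈⁻ X (x ∈ˢ? X) p∈ in pick-sound bl x∈ p∈′
    pick-sound (node {y = y} _ _ _ _ _ _ bl br) v∈ (right p∈) =
      let y∈ , p∈′ = guarded-∈⁻ X (y ∈ˢ? X) p∈ in pick-sound br y∈ p∈′

    -- Steps inside `X` leave the selection only through `N`. With `walk-closed` this shows that a
    -- connected `X` is picked up completely.
    pick-step : (b : Branch G N v t) → ∀ {p w} → p ∈ₛ pick b → vert b p ~ w → w ∈ˢ X → InSel b (pick b) w ⊎ N w
    pick-step (leaf all) {here} _ e w∈ = inj₂ (all e)
    pick-step (node {x = x} {y} _ _ _ _ _ all bl br) {here} _ e w∈ with all e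
    ... | inj₁ Nw          = inj₂ Nw
    ... | inj₂ (inj₁ refl) = inj₁ (left here , left (guarded-∈⁺ X (x ∈ˢ? X) w∈ here) , refl)
    ... | inj₂ (inj₂ refl) = inj₁ (right here , right (guarded-∈⁺ X (y ∈ˢ? X) w∈ here) , refl)
    pick-step (node {x = x} _ _ _ _ _ _ bl br) (left p∈) e w∈ with x∈ , p∈′ ← guarded-∈⁻ X (x ∈ˢ? X) p∈
      with pick-step bl p∈′ e w∈
    ... | inj₁ (q , q∈ , eq) = inj₁ (left q , left (guarded-∈⁺ X (x ∈ˢ? X) x∈ q∈) , eq)
    ... | inj₂ refl          = inj₁ (here , here , refl)
    pick-step (node {y = y} _ _ _ _ _ _ bl br) (right p∈) e w∈ with y∈ , p∈′ ← guarded-∈⁻ X (y ∈ˢ? X) p∈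
      with pick-step br p∈′ e w∈
    ... | inj₁ (q , q∈ , eq) = inj₁ (right q , right (guarded-∈⁺ X (y ∈ˢ? X) y∈ q∈) , eq)
    ... | inj₂ refl          = inj₁ (here , here , refl)

size : Shape → ℕ
size t = suc (2 * inner t)

walk-closed : {R : Rel (Fin n) 0ℓ} {M : U.Pred (Fin n) 0ℓ} → (∀ {x y} → M x → R x y → M y) →
              ∀ {u v} → Walk R k u v → M u → M v
walk-closed step []      Mu = Mu
walk-closed step (e ∷ w) Mu = walk-closed step w (step Mu e)

module _ {G : Graph n} (acyclic : Acyclic G) where
  open Graph G
  open AcyclicProperties G acyclic

  via : ∀ {u v} → u ~ v → (b : Branch G (_≡ u) v t) (p : Pos t) → ∃ λ d → Trail _~_ (suc (depth p)) u v d (vert b p)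
  via e b p with route b p
  ... | inj₁ refl              = _ , one e
  ... | inj₂ (c , d , w , c≢u) = d , cons e (c≢u ∘ sym) w

  vert-injective : ∀ {N v} (b : Branch G N v t) {p q : Pos t} → vert b p ≡ vert b q → p ≡ q
  vert-injective b {here} {here} _ = refl
  vert-injective (node ex _ _ _ _ _ bl br) {here} {left q} eq with d , w ← via ex bl q = ⊥-elim
        (acyclic (subst (Trail _~_ _ _ _ d) (sym eq) w))
  vert-injective (node _ ey _ _ _ _ bl br) {here} {right q} eq with d , w ← via ey br q = ⊥-elim
        (acyclic (subst (Trail _~_ _ _ _ d) (sym eq) w))
  vert-injective (node ex _ _ _ _ _ bl br) {left p} {here} eq with d , w ← via ex bl p = ⊥-elim
        (acyclic (subst (Trail _~_ _ _ _ d) eq w))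
  vert-injective (node _ ey _ _ _ _ bl br) {right p} {here} eq with d , w ← via ey br p = ⊥-elim
        (acyclic (subst (Trail _~_ _ _ _ d) eq w))
  vert-injective (node _ _ _ _ _ _ bl br) {left p} {left q} eq = cong left (vert-injective bl eq)
  vert-injective (node _ _ _ _ _ _ bl br) {right p} {right q} eq = cong right (vert-injective br eq)
  vert-injective (node ex ey _ _ x≢y _ bl br) {left p} {right q} eq =
    contradiction (first-unique (subst (Trail _~_ _ _ _ _) eq (proj₂ (via ex bl p))) (proj₂ (via ey br q))) x≢y
  vert-injective (node ex ey _ _ x≢y _ bl br) {right p} {left q} eq =
    contradiction (sym (first-unique (subst (Trail _~_ _ _ _ _) eq (proj₂ (via ey br p))) (proj₂ (via ex bl q)))) x≢y

  module _ {u v} (u~v : u ~ v) (A : Branch G (_≡ v) u s) (B : Branch G (_≡ u) v t) where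

    sides-disjoint : ∀ p q → vert A p ≢ vert B q
    sides-disjoint p q eq = opposite (subst (Trail _~_ _ _ _ _) eq (proj₂ (via (symmetric u~v) A p)))
          (proj₂ (via u~v B q))
      where
      opposite : ∀ {d d′ x} → Trail _~_ j v u d x → Trail _~_ k u v d′ x → ⊥
      opposite w (one e)          = acyclic w
      opposite w (cons e u≢c w′)  = u≢c (first-unique w w′)

    sides-cover : ∀ x → (∃ λ p → vert A p ≡ x) ⊎ (∃ λ q → vert B q ≡ x)
    sides-cover x with u Fin.≟ x
    ... | yes u≡x = inj₁ (here , u≡x)
    ... | no  u≢x with trail u≢x
    ...   | a , b , w with a Fin.≟ v
    ...     | no a≢v = let p , eq , _ = locate A w a≢v in inj₁ (p , eq)
    ...     | yes refl with uncons w
    ...       | inj₁ refl = inj₂ (here , refl)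
    ...       | inj₂ (_ , _ , u≢c , w′) = let q , eq , _ = locate B w′ (u≢c ∘ sym) in inj₂ (q , eq)

    sides-size : n ≡ size s + size t
    sides-size = begin
      n                                                           ≡⟨ length-tabulate {n = n} id ⟨
      length (allFin n)
        ≡⟨ length-≡ (Unique.allFin⁺ n) unique (λ {x} _ → complete x) (λ {x} _ → ∈-allFin x) ⟩
      length (map (vert A) (allPos s) ++ map (vert B) (allPos t)) ≡⟨ length-++ (map (vert A) (allPos s)) ⟩
      length (map (vert A) (allPos s)) + length (map (vert B) (allPos t))
        ≡⟨ cong₂ _+_ (trans (length-map (vert A) (allPos s)) (length-allPos s))
              (trans (length-map (vert B) (allPos t)) (length-allPos t)) ⟩
      size s + size t                                             ∎
      where
      open ≡-Reasoning
      unique : Unique (map (vert A) (allPos s) ++ map (vert B) (allPos t))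
      unique = Unique.++⁺ (Unique.map⁺ (vert-injective A) (allPos-unique s))
            (Unique.map⁺ (vert-injective B) (allPos-unique t))
        λ (x∈A , x∈B) → let p , _ , eq = ∈-map⁻ (vert A) x∈A
                            q , _ , eq′ = ∈-map⁻ (vert B) x∈B
                        in sides-disjoint p q (trans (sym eq) eq′)
      complete : ∀ x → x ∈ map (vert A) (allPos s) ++ map (vert B) (allPos t)
      complete x with sides-cover x
      ... | inj₁ (p , refl) = ∈-++⁺ˡ (∈-map⁺ (vert A) (∈-allPos p))
      ... | inj₂ (q , refl) = ∈-++⁺ʳ (map (vert A) (allPos s)) (∈-map⁺ (vert B) (∈-allPos q))

    -- A subtree through `u` is a pruned copy of the side of `u`, together with nothing or a pruned
    -- copy of the side of `v`; this is the source of the `suc` in the product formula.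
    edgeIndexing : Indexing G acyclic u
    edgeIndexing = record
      { Index     = Sel s × Maybe (Sel t)
      ; indices   = cartesianProduct (allSel s) (allOpt t)
      ; unique    = Unique.cartesianProduct⁺ (allSel-unique s) (allOpt-unique t)
      ; complete  = λ (σ , m) → ∈-cartesianProduct⁺ (∈-allSel σ) (∈-allOpt m)
      ; Mem       = Mem
      ; mem?      = λ (σ , m) x → inSel? A σ x ⊎-dec inOpt? B m x
      ; injective = λ f g → cong₂ _,_ (sel-ext (transferˡ f) (transferˡ g)) (opt-ext (transferʳ f) (transferʳ g))
      ; index     = λ S sub u∈ → index S sub u∈
      ; contains  = λ κ → inj₁ (here , here , refl)
      ; joined    = joined
      }
      where
      Mem : Sel s × Maybe (Sel t) → U.Pred (Fin n) 0ℓ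
      Mem (σ , m) x = InSel A σ x ⊎ InOpt B m x

      transferˡ : ∀ {σ σ′ m m′} → (∀ x → Mem (σ , m) x → Mem (σ′ , m′) x) → ∀ {p} → p ∈ₛ σ → p ∈ₛ σ′
      transferˡ f {p} p∈ with f (vert A p) (inj₁ (p , p∈ , refl))
      ... | inj₁ (q , q∈ , eq) = subst (_∈ₛ _) (vert-injective A eq) q∈
      ... | inj₂ (q , q∈ , eq) = contradiction (sym eq) (sides-disjoint p q)

      transferʳ : ∀ {σ σ′ m m′} → (∀ x → Mem (σ , m) x → Mem (σ′ , m′) x) → ∀ {p} → p ∈ₒ m → p ∈ₒ m′
      transferʳ f {p} p∈ with f (vert B p) (inj₂ (p , p∈ , refl))
      ... | inj₁ (q , q∈ , eq) = contradiction eq (sides-disjoint q p)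
      ... | inj₂ (q , q∈ , eq) = subst (_∈ₒ _) (vert-injective B eq) q∈

      index : ∀ S → IsSubtree G S → u ∈ˢ Sub.vertices S →
              ∃ λ κ → (∀ x → x ∈ˢ Sub.vertices S → Mem κ x) × (∀ x → Mem κ x → x ∈ˢ Sub.vertices S)
      index S (isSub , _ , conn) u∈ = (pick X A , guarded X (v ∈ˢ? X) (pick X B)) ,
        (λ x x∈ → walk-closed step (proj₂ (conn u x u∈ x∈)) (inj₁ (here , here , refl))) , sound
        where
        X = Sub.vertices S
        M : U.Pred (Fin n) 0ℓ
        M = Mem (pick X A , guarded X (v ∈ˢ? X) (pick X B))
        sound : ∀ x → M x → x ∈ˢ X
        sound x (inj₁ (p , p∈ , refl)) = pick-sound X A u∈ p∈
        sound x (inj₂ (p , p∈ , refl)) = let v∈ , p∈′ = guarded-∈⁻ X (v ∈ˢ? X) p∈ in pick-sound X B v∈ p∈′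
        step : ∀ {x y} → M x → Sub.Edge S x y → M y
        step {x} {y} Mx e with isSub x y e
        ... | x~y , e′ , _ with proj₂ (proj₂ (isSub y x e′)) | Mx
        ...   | y∈ | inj₁ (p , p∈ , refl) with pick-step X A p∈ x~y y∈
        ...     | inj₁ My   = inj₁ My
        ...     | inj₂ refl = inj₂ (here , guarded-∈⁺ X (v ∈ˢ? X) y∈ here , refl)
        step {x} {y} Mx e | x~y , e′ , _ | y∈ | inj₂ (p , p∈ , refl) with v∈ , p∈′ ← guarded-∈⁻ X (v ∈ˢ? X) p∈
          with pick-step X B p∈′ x~y y∈
        ...     | inj₁ (q , q∈ , eq) = inj₂ (q , guarded-∈⁺ X (v ∈ˢ? X) v∈ q∈ , eq)
        ...     | inj₂ refl          = inj₁ (here , here , refl)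

      joined : ∀ κ {x} → Mem κ x → Joined (λ y z → y ~ z × Mem κ y × Mem κ z) u x
      joined κ (inj₁ (p , p∈ , refl)) = sel-joined A inj₁ p∈
      joined κ (inj₂ (p , just p∈ , refl))
        with k , w ← sel-joined B {M = Mem κ} (λ (q , q∈ , eq) → inj₂ (q , just q∈ , eq)) p∈ =
        suc k , (u~v , inj₁ (here , here , refl) , inj₂ (here , just here , refl)) ∷ w

    subtreeCount-edge : subtreeCount G u ≡ rootedSubtrees s * suc (rootedSubtrees t)
    subtreeCount-edge = trans (subtreeCount-indexing G acyclic edgeIndexing)
      (trans (length-cartesianProductWith _,_ (allSel s) (allOpt t)) (cong₂ _*_ (length-allSel s) (length-allOpt t)))

  module _ {root} (b : Branch G (λ _ → ⊥) root t) where

    root-cover : ∀ x → ∃ λ p → vert b p ≡ x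
    root-cover x with root Fin.≟ x
    ... | yes r≡x = here , r≡x
    ... | no  r≢x = let _ , _ , w = trail r≢x
                        p , eq , _ = locate b w id
                    in p , eq

    root-size : n ≡ size t
    root-size = begin
      n                                ≡⟨ length-tabulate {n = n} id ⟨
      length (allFin n)
        ≡⟨ length-≡ (Unique.allFin⁺ n) (Unique.map⁺ (vert-injective b) (allPos-unique t)) (λ {x} _ → complete x)
              (λ {x} _ → ∈-allFin x) ⟩
      length (map (vert b) (allPos t)) ≡⟨ length-map (vert b) (allPos t) ⟩
      length (allPos t)                ≡⟨ length-allPos t ⟩
      size t                           ∎
      where
      open ≡-Reasoning
      complete : ∀ x → x ∈ map (vert b) (allPos t)
      complete x with p , refl ← root-cover x = ∈-map⁺ (vert b) (∈-allPos p)

    root-depth : ∀ p → dist G root (vert b p) ≡ depth p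
    root-depth p with route b p
    ... | inj₁ refl            = dist-refl G
    ... | inj₂ (_ , _ , w , _) = dist-trail w

    rootIndexing : Indexing G acyclic root
    rootIndexing = record
      { Index     = Sel t
      ; indices   = allSel t
      ; unique    = allSel-unique t
      ; complete  = ∈-allSel
      ; Mem       = InSel b
      ; mem?      = inSel? b
      ; injective = λ f g → sel-ext (transfer f) (transfer g)
      ; index     = λ S sub r∈ → index S sub r∈
      ; contains  = λ σ → here , here , refl
      ; joined    = λ { σ (p , p∈ , refl) → sel-joined b id p∈ }
      }
      where
      transfer : ∀ {σ σ′} → (∀ x → InSel b σ x → InSel b σ′ x) → ∀ {p} → p ∈ₛ σ → p ∈ₛ σ′
      transfer f {p} p∈ with q , q∈ , eq ← f (vert b p) (p , p∈ , refl) = subst (_∈ₛ _) (vert-injective b eq) q∈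

      index : ∀ S → IsSubtree G S → root ∈ˢ Sub.vertices S →
              ∃ λ σ → (∀ x → x ∈ˢ Sub.vertices S → InSel b σ x) × (∀ x → InSel b σ x → x ∈ˢ Sub.vertices S)
      index S (isSub , _ , conn) r∈ = pick X b ,
        (λ x x∈ → walk-closed step (proj₂ (conn root x r∈ x∈)) (here , here , refl)) ,
        λ { x (p , p∈ , refl) → pick-sound X b r∈ p∈ }
        where
        X = Sub.vertices S
        step : ∀ {x y} → InSel b (pick X b) x → Sub.Edge S x y → InSel b (pick X b) y
        step {x} {y} (p , p∈ , refl) e with isSub x y e
        ... | x~y , e′ , _ with pick-step X b p∈ x~y (proj₂ (proj₂ (isSub y x e′)))
        ...   | inj₁ My = My

    subtreeCount-root : subtreeCount G root ≡ rootedSubtrees t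
    subtreeCount-root = trans (subtreeCount-indexing G acyclic rootIndexing) (length-allSel t)

-- Degrees, and branches read off from a binary tree

module _ (G : Graph n) where
  open Graph G

  degree-≡ : ∀ {v ys} → Unique ys → (∀ {x} → x ∈ ys → v ~ x) → (∀ {x} → v ~ x → x ∈ ys) → degree v ≡ length ys
  degree-≡ {v} {ys} uniq sound complete = length-≡ (Unique.filter⁺ (v ~?_) (Unique.allFin⁺ n)) uniq
    (λ x∈ → complete (proj₂ (∈-filter⁻ (v ~?_) {xs = allFin n} x∈)))
    (λ {x} x∈ → ∈-filter⁺ (v ~?_) (∈-allFin x) (sound x∈))

  neighbours : ∀ v → ∃ λ ys → degree v ≡ length ys × Unique ys × (∀ {x} → x ∈ ys → v ~ x) × (∀ {x} → v ~ x → x ∈ ys)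
  neighbours v = filter (v ~?_) (allFin n) , refl , Unique.filter⁺ (v ~?_) (Unique.allFin⁺ n) ,
    (λ x∈ → proj₂ (∈-filter⁻ (v ~?_) {xs = allFin n} x∈)) , (λ {x} e → ∈-filter⁺ (v ~?_) (∈-allFin x) e)

  degree≡1⁺ : ∀ {u v} → v ~ u → (∀ {w} → v ~ w → w ≡ u) → degree v ≡ 1
  degree≡1⁺ e all = degree-≡ ([] ∷ []) (λ { (here refl) → e }) (λ e′ → here (all e′))

  degree≡1⁻ : ∀ {u v} → degree v ≡ 1 → v ~ u → ∀ {w} → v ~ w → w ≡ u
  degree≡1⁻ {v = v} deg e e′ with neighbours v
  ... | [] , eq , _ = case trans (sym deg) eq of λ ()
  ... | _ ∷ _ ∷ _ , eq , _ = case trans (sym deg) eq of λ ()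
  ... | y ∷ [] , _ , _ , _ , complete with complete e | complete e′
  ...   | here refl | here refl = refl

  degree≡2⁻ : ∀ {v} → degree v ≡ 2 → ∃₂ λ x y → v ~ x × v ~ y × x ≢ y × (∀ {w} → v ~ w → w ≡ x ⊎ w ≡ y)
  degree≡2⁻ {v} deg with neighbours v
  ... | [] , eq , _ = case trans (sym deg) eq of λ ()
  ... | _ ∷ [] , eq , _ = case trans (sym deg) eq of λ ()
  ... | _ ∷ _ ∷ _ ∷ _ , eq , _ = case trans (sym deg) eq of λ ()
  ... | x ∷ y ∷ [] , _ , (x≢y ∷ []) ∷ _ , sound , complete =
    x , y , sound (here refl) , sound (there (here refl)) , x≢y ,
    λ e → case complete e of λ { (here eq) → inj₁ eq ; (there (here eq)) → inj₂ eq }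

  degree≡3⁻ : ∀ {u v} → degree v ≡ 3 → v ~ u →
              ∃₂ λ x y → v ~ x × v ~ y × x ≢ u × y ≢ u × x ≢ y × (∀ {w} → v ~ w → w ≡ u ⊎ w ≡ x ⊎ w ≡ y)
  degree≡3⁻ {v = v} deg e with neighbours v
  ... | [] , eq , _ = case trans (sym deg) eq of λ ()
  ... | _ ∷ [] , eq , _ = case trans (sym deg) eq of λ ()
  ... | _ ∷ _ ∷ [] , eq , _ = case trans (sym deg) eq of λ ()
  ... | _ ∷ _ ∷ _ ∷ _ ∷ _ , eq , _ = case trans (sym deg) eq of λ ()
  ... | x ∷ y ∷ z ∷ [] , _ , (x≢y ∷ x≢z ∷ []) ∷ (y≢z ∷ []) ∷ _ , sound , complete with complete e
  ...   | here refl = y , z , sound (there (here refl)) , sound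
        (there (there (here refl))) , x≢y ∘ sym , x≢z ∘ sym , y≢z ,
    λ e → case complete e of λ { (here eq) → inj₁ eq ; (there (here eq)) → inj₂ (inj₁ eq) ;
          (there (there (here eq))) → inj₂ (inj₂ eq) }
  ...   | there (here refl) = x , z , sound (here refl) , sound (there (there (here refl))) , x≢y , y≢z ∘ sym , x≢z ,
    λ e → case complete e of λ { (here eq) → inj₂ (inj₁ eq) ; (there (here eq)) → inj₁ eq ;
          (there (there (here eq))) → inj₂ (inj₂ eq) }
  ...   | there (there (here refl)) = x , y , sound (here refl) , sound (there (here refl)) , x≢z , y≢z , x≢y ,
    λ e → case complete e of λ { (here eq) → inj₂ (inj₁ eq) ; (there (here eq)) → inj₂ (inj₂ eq) ;
          (there (there (here eq))) → inj₁ eq }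

  module _ (tree : IsTree) {root : Fin n} (degree-1-or-3 : ∀ v → v ≢ root → degree v ≡ 1 ⊎ degree v ≡ 3) where

    private
      acyclic : Acyclic G
      acyclic = isTree⇒acyclic G tree

      -- The descent prolongs a trail from the root. A trail in a tree has fewer than `n` edges, so
      -- `fuel` cannot run out before the leaves are reached.
      build : ∀ fuel {k a u v} → Trail _~_ k root a u v → v ~ u → n ≤ fuel + k → ∃ λ t → Branch G (_≡ u) v t
      build zero       w e n≤ = contradiction (trail-length-< G tree w) (≤⇒≯ n≤)
      build (suc fuel) {k} {v = v} w e n≤ with degree-1-or-3 v (λ { refl → acyclic w })
      ... | inj₁ deg = leaf , leaf (degree≡1⁻ deg e)
      ... | inj₂ deg with x , y , ex , ey , x≢u , y≢u , x≢y , all ← degree≡3⁻ deg e =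
        let t₁ , b₁ = build fuel (append w (one ex) (x≢u ∘ sym)) (symmetric ex) n≤′
            t₂ , b₂ = build fuel (append w (one ey) (y≢u ∘ sym)) (symmetric ey) n≤′
        in node t₁ t₂ , node ex ey x≢u y≢u x≢y all b₁ b₂
        where
        n≤′ : n ≤ fuel + (k + 1)
        n≤′ = ≤-trans n≤ (≤-reflexive (trans (sym (+-suc fuel k)) (cong (fuel +_) (sym (+-comm k 1)))))

    branch-exists : ∀ {v} → root ~ v → ∃ λ t → Branch G (_≡ root) v t
    branch-exists e = build n (one e) (symmetric e) (m≤m+n n 1)

  binary-branch : IsBinaryTree G → ∀ {u v} → u ~ v → ∃ λ t → Branch G (_≡ u) v t
  binary-branch (tree , deg) {u} = branch-exists tree {u} λ v _ → case degree v ≟ 1 of λ where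
    (yes eq) → inj₁ eq
    (no  ≢1) → inj₂ (deg v ≢1)

  rooted-branch : ∀ {root} → IsRootedBinaryTree G root → ∃ λ t → Branch G (λ _ → ⊥) root t
  rooted-branch {root} (tree , inj₁ refl) = leaf , leaf λ e → irrefl (fin1 root _) e
    where
    fin1 : (x y : Fin 1) → x ≡ y
    fin1 zero zero = refl
  rooted-branch {root} (tree , inj₂ (deg , deg′)) with x , y , ex , ey , x≢y , all ← degree≡2⁻ deg =
    let t₁ , b₁ = branch-exists tree deg′ ex
        t₂ , b₂ = branch-exists tree deg′ ey
    in node t₁ t₂ , node ex ey id id x≢y (inj₂ ∘ all) b₁ b₂

-- Rgood trees

join : ∀ {h i j x y} → HeapVal h i x → HeapVal h j y → i ≡ fullSize h ⊎ i ≡ fullSize (suc h) →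
       HeapVal (suc h) (suc (i + j)) (suc (x * y))
join {h} p q (inj₁ refl) with refl ← heapVal-unique p (bottom h) = low q
join {h} p q (inj₂ refl) with refl ← heapVal-unique p (top h) = high q

join′ : ∀ {h i j x y} → HeapVal h i x → HeapVal h j y → j ≡ fullSize h ⊎ j ≡ fullSize (suc h) →
        HeapVal (suc h) (suc (i + j)) (suc (x * y))
join′ {h} {i} {j} {x} {y} p q full = subst₂ (λ i x → HeapVal (suc h) (suc i) (suc x)) (+-comm j i) (*-comm y x)
      (join q p full)

module RGood {R : Graph n} {root : Fin n} (rgood : IsRGood R root) where
  open Graph R
  open IsRGood rgood
  open IsOrdering isOrdering

  data Descendant : ℕ → Fin n → Fin n → Set where
    []  : ∀ {v} → Descendant 0 v v
    _∷_ : ∀ {u v w} → _ParentOf_ R root u v → Descendant k v w → Descendant (suc k) u w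

  precedes⇒≢ : ∀ {x y} → height R root x ≡ height R root y → x ≺ y → x ≢ y
  precedes⇒≢ {x} {y} eq x≺y x≡y = IsStrictTotalOrder.irrefl (linear (height R root y)) {x , eq} {y , refl} x≡y x≺y

  -- Compatibility iterated along the generations; it asks for distinct parents, which irreflexivity
  -- of the order supplies.
  descendants-ordered : ∀ {d x y p q} → height R root x ≡ height R root y → x ≺ y →
                        Descendant d x p → Descendant d y q → height R root p ≡ height R root q × p ≺ q
  descendants-ordered eq x≺y [] [] = eq , x≺y
  descendants-ordered eq x≺y (e@(_ , hx) ∷ p) (e′@(_ , hy) ∷ q) =
    let eq′ = trans hx (trans (cong suc eq) (sym hy))
    in descendants-ordered eq′ (compatible eq′ e e′ (precedes⇒≢ eq x≺y) x≺y) p q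

  module _ {H : ℕ} (≤H : ∀ w → height R root w ≤ H) {bot : Fin n} (pendant : Pendant bot) (height-bot : height R root bot ≡ H) where

    -- A branch rooted at level k whose vertices at depth suc h lie on the lowest level H.
    record Hanging (h k : ℕ) (u v : Fin n) (t : Shape) : Set₁ where
      constructor hanging
      field
        edge   : v ~ u
        branch : Branch R (_≡ u) v t
        levels : ∀ p → height R root (vert branch p) ≡ k + depth p
        above  : height R root u < k
        lowest : suc (h + k) ≡ H

    height-root : ∀ {h u v} → Hanging h k u v t → height R root v ≡ k
    height-root b = trans (Hanging.levels b here) (+-identityʳ _)

    childˡ : ∀ {h u v} → Hanging (suc h) k u v (node l r) → ∃ λ x → Hanging h (suc k) v x l × _ParentOf_ R root v x
    childˡ {k} {h = h} b@(hanging _ (node {x = x} ex _ _ _ _ _ bl _) levels _ lowest) = x ,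
      hanging (symmetric ex) bl (λ p → trans (levels (left p)) (+-suc k _)) (s≤s (≤-reflexive (height-root b)))
              (trans (cong suc (+-suc h k)) lowest) ,
      ex , trans (levels (left here)) (trans (+-suc k 0) (cong suc (sym (levels here))))

    childʳ : ∀ {h u v} → Hanging (suc h) k u v (node l r) → ∃ λ y → Hanging h (suc k) v y r × _ParentOf_ R root v y
    childʳ {k} {h = h} b@(hanging _ (node {y = y} _ ey _ _ _ _ _ br) levels _ lowest) = y ,
      hanging (symmetric ey) br (λ p → trans (levels (right p)) (+-suc k _)) (s≤s (≤-reflexive (height-root b)))
              (trans (cong suc (+-suc h k)) lowest) ,
      ey , trans (levels (right here)) (trans (+-suc k 0) (cong suc (sym (levels here))))

    leaf-pendant : ∀ {h u v} → Hanging h k u v leaf → Pendant v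
    leaf-pendant (hanging e (leaf all) _ _ _) = degree≡1⁺ R e all

    not-leaf : ∀ {h u v} → ¬ Hanging (suc h) k u v leaf
    not-leaf {k} {h} b = <⇒≱ (subst (suc k <_) (Hanging.lowest b) (s≤s (s≤s (m≤n+m k h))))
      (≤-trans (≤-reflexive (sym height-bot)) (≤-trans (balanced pendant (leaf-pendant b))
            (s≤s (≤-reflexive (height-root b)))))

    too-deep : ∀ {h u v} → Hanging h k u v t → (p : Pos t) → depth p ≤ suc h
    too-deep {k} {h = h} b p = +-cancelˡ-≤ k _ _ (≤-trans (≤-reflexive (sym (Hanging.levels b p)))
      (≤-trans (≤H _) (≤-reflexive (trans (sym (Hanging.lowest b))
            (trans (cong suc (+-comm h k)) (sym (+-suc k h)))))))

    shallow : ∀ {u v} → Hanging 0 k u v (node l r) → l ≡ leaf × r ≡ leaf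
    shallow {l = leaf}     {leaf}     b = refl , refl
    shallow {l = node _ _} {_}        b = case too-deep b (left (left here)) of λ { (s≤s ()) }
    shallow {l = leaf}     {node _ _} b = case too-deep b (right (left here)) of λ { (s≤s ()) }

    parent-of-lowest : ∀ {u v} → Hanging 0 k u v (node l r) → HighestPendantParent R root v
    parent-of-lowest {k} b@(hanging _ (node {x = x} ex _ _ _ _ _ bl _) levels _ lowest) with shallow b
    parent-of-lowest {k} b@(hanging _ (node {x = x} ex _ _ _ _ _ (leaf all) _) levels _ lowest) | refl , refl =
      x , degree≡1⁺ R (symmetric ex) all ,
      (λ w → ≤-trans (≤H w) (≤-reflexive (trans (sym lowest) (trans (+-comm 1 k) (sym (levels (left here))))))) ,
      ex , trans (levels (left here)) (trans (+-suc k 0) (cong suc (sym (levels here))))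

    -- A branch without a parent of a lowest pendant vertex has all its leaves one level higher and
    -- is perfect. In the other case the final segment has a starting point.
    full-or-lowest : ∀ {h u v} → Hanging h k u v t →
                     inner t ≡ fullSize h ⊎ ∃ λ p → Descendant h v p × HighestPendantParent R root p
    full-or-lowest {t = leaf}     {zero}  b = inj₁ refl
    full-or-lowest {t = node l r} {zero}  b = inj₂ (_ , [] , parent-of-lowest b)
    full-or-lowest {t = leaf}     {suc h} b = ⊥-elim (not-leaf b)
    full-or-lowest {t = node l r} {suc h} b with x , bl , px ← childˡ b | y , br , py ← childʳ b
      with full-or-lowest bl | full-or-lowest br
    ... | inj₁ eq | inj₁ eq′          = inj₁ (cong suc (cong₂ _+_ eq eq′))
    ... | inj₂ (p , d , hpp) | _      = inj₂ (p , px ∷ d , hpp)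
    ... | inj₁ _ | inj₂ (p , d , hpp) = inj₂ (p , py ∷ d , hpp)

    all-lowest : ∀ {h u v} → Hanging h k u v t → (∀ {p} → Descendant h v p → HighestPendantParent R root p) →
                 inner t ≡ fullSize (suc h)
    all-lowest {t = node l r} {zero} b f with refl , refl ← shallow b = refl
    -- A leaf cannot be a parent here: its only neighbour `u` lies above it.
    all-lowest {k} {t = leaf} {zero} {u} {v} b@(hanging e (leaf all) _ above _) f with w , _ , _ , e′ , hw ← f []
      with refl ← all e′ =
      contradiction above (≤⇒≯ (≤-trans (≤-reflexive (sym (height-root b)))
            (≤-trans (n≤1+n _) (≤-reflexive (sym hw)))))
    all-lowest {t = leaf}     {suc h} b f = ⊥-elim (not-leaf b)
    all-lowest {t = node l r} {suc h} b f with x , bl , px ← childˡ b | y , br , py ← childʳ b =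
      cong suc (cong₂ _+_ (all-lowest bl λ d → f (px ∷ d)) (all-lowest br λ d → f (py ∷ d)))

    -- If the earlier branch reaches the lowest level, the final segment contains all vertices of
    -- the later branch on the level before, so that the later branch is full down to the lowest
    -- level.
    one-side-full : ∀ {h u v x y} → Hanging h k u x l → Hanging h k v y r → x ≺ y →
                    inner l ≡ fullSize h ⊎ inner r ≡ fullSize (suc h)
    one-side-full bl br x≺y with full-or-lowest bl
    ... | inj₁ eq = inj₁ eq
    ... | inj₂ (p , d , hpp) = inj₂ (all-lowest br λ d′ →
      let eq , p≺q = descendants-ordered (trans (height-root bl) (sym (height-root br))) x≺y d d′
      in finalSegment hpp (sym eq) p≺q)

    join-branches : ∀ {h u v x y} → x ≢ y → Hanging h k u x l → Hanging h k v y r →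
                    HeapVal h (inner l) (suc (rootedSubtrees l)) → HeapVal h (inner r) (suc (rootedSubtrees r)) →
                    HeapVal (suc h) (inner (node l r)) (suc (rootedSubtrees (node l r)))
    join-branches {k} {x = x} {y} x≢y bl br p q
      with IsStrictTotalOrder.compare (linear k) (x , height-root bl) (y , height-root br)
    ... | tri≈ _ x≡y _ = contradiction x≡y x≢y
    ... | tri< x≺y _ _ with one-side-full bl br x≺y
    ...   | inj₁ eq = join p q (inj₁ eq)
    ...   | inj₂ eq = join′ p q (inj₂ eq)
    join-branches {k} {x = x} {y} x≢y bl br p q | tri> _ _ y≺x with one-side-full br bl y≺x
    ...   | inj₁ eq = join′ p q (inj₁ eq)
    ...   | inj₂ eq = join p q (inj₂ eq)

    children-≢ : ∀ {h u v} → (b : Hanging (suc h) k u v (node l r)) → proj₁ (childˡ b) ≢ proj₁ (childʳ b)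
    children-≢ (hanging _ (node _ _ _ _ x≢y _ _ _) _ _ _) = x≢y

    heapVal-branch : ∀ {h u v} → Hanging h k u v t → HeapVal h (inner t) (suc (rootedSubtrees t))
    heapVal-branch {t = leaf}     {zero}  b = leaf
    heapVal-branch {t = node l r} {zero}  b with refl , refl ← shallow b = cherry
    heapVal-branch {t = leaf}     {suc h} b = ⊥-elim (not-leaf b)
    heapVal-branch {t = node l r} {suc h} b =
      let _ , bl , _ = childˡ b ; _ , br , _ = childʳ b
      in join-branches (children-≢ b) bl br (heapVal-branch bl) (heapVal-branch br)

    -- Strictness pins down the height: no shape of depth `h` has that many inner vertices, which
    -- makes an rgood tree as low as its order allows.
    deep-inner : ∀ {h u v} → Hanging h k u v t → depthˢ t ≡ suc h → fullSize h < inner t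
    deep-inner {t = node l r} {zero} b eq = s≤s z≤n
    deep-inner {t = node l r} {suc h} b eq with _ , bl , _ ← childˡ b | _ , br , _ ← childʳ b with ⊔-sel (depthˢ l)
          (depthˢ r)
    ... | inj₁ ⊔≡ = s≤s (+-mono-<-≤ (deep-inner bl (trans (sym ⊔≡) (suc-injective eq)))
          (heapVal-≥ (heapVal-branch br)))
    ... | inj₂ ⊔≡ = s≤s (+-mono-≤-< (heapVal-≥ (heapVal-branch bl))
          (deep-inner br (trans (sym ⊔≡) (suc-injective eq))))

module _ {G : Graph n} where
  open Graph G

  pendant-at-bottom : ∀ {u v} → v ~ u → (b : Branch G (_≡ u) v t) → ∃ λ p → depth p ≡ depthˢ t × Pendant (vert b p)
  pendant-at-bottom e (leaf all) = here , refl , degree≡1⁺ G e all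
  pendant-at-bottom {t = node l r} e (node ex ey _ _ _ _ bl br) with ⊔-sel (depthˢ l) (depthˢ r)
  ... | inj₁ eq = let p , eq′ , pend = pendant-at-bottom (symmetric ex) bl in left p , cong suc (trans eq′ (sym eq)) , pend
  ... | inj₂ eq = let p , eq′ , pend = pendant-at-bottom (symmetric ey) br in right p , cong suc (trans eq′ (sym eq)) , pend

shallow-shape : ∀ l r → depthˢ l ⊔ depthˢ r ≡ 0 →
                ∃ λ h → HeapVal h (inner (node l r)) (suc (rootedSubtrees (node l r))) ×
                        (∀ {s} → inner (node l r) ≤ inner s → depthˢ (node l r) ≤ depthˢ s)
shallow-shape (node _ _) leaf       ()
shallow-shape (node _ _) (node _ _) ()
shallow-shape leaf       (node _ _) ()
shallow-shape leaf       leaf       _ = 0 , cherry , λ { {node _ _} _ → s≤s z≤n }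

module _ {R : Graph n} {root : Fin n} (rgood : IsRGoodBinaryTree R root) where

  private
    acyclic : Acyclic R
    acyclic = isTree⇒acyclic R (proj₁ (proj₁ rgood))

    open RGood (proj₂ rgood)
    open Graph R using (symmetric)

  rgood-shape : (b : Branch R (λ _ → ⊥) root t) →
                ∃ (λ h → HeapVal h (inner t) (suc (rootedSubtrees t)) ×
                      (∀ {s} → inner t ≤ inner s → depthˢ t ≤ depthˢ s))
  rgood-shape (leaf _) = 0 , leaf , λ _ → z≤n
  rgood-shape {t = node l r} b@(node {x = x} {y} ex ey _ _ x≢y _ bl br) = go (depthˢ l ⊔ depthˢ r) refl
    where
    H = depthˢ (node l r)

    height-≤ : ∀ w → height R root w ≤ H
    height-≤ w with p , refl ← root-cover acyclic b w = ≤-trans (≤-reflexive (root-depth acyclic b p)) (depth-≤ p)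

    bottom-exists : ∃ λ (p : Pos (node l r)) → depth p ≡ H × Graph.Pendant R (vert b p)
    bottom-exists with ⊔-sel (depthˢ l) (depthˢ r)
    ... | inj₁ eq = let p , eq′ , pend = pendant-at-bottom (symmetric ex) bl in left p , cong suc (trans eq′ (sym eq)) , pend
    ... | inj₂ eq = let p , eq′ , pend = pendant-at-bottom (symmetric ey) br in right p , cong suc (trans eq′ (sym eq)) , pend

    go : ∀ d → depthˢ l ⊔ depthˢ r ≡ d →
         ∃ λ h → HeapVal h (inner (node l r)) (suc (rootedSubtrees (node l r))) ×
               (∀ {s} → inner (node l r) ≤ inner s → H ≤ depthˢ s)
    go zero eq = shallow-shape l r eq
    go (suc h) eq = suc h , join-branches ≤H pend height-bot x≢y Bl Br
                              (heapVal-branch ≤H pend height-bot Bl)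
                                    (heapVal-branch ≤H pend height-bot Br) , depth-mono
      where
      ≤H = height-≤
      pend = proj₂ (proj₂ bottom-exists)
      height-bot = trans (root-depth acyclic b (proj₁ bottom-exists)) (proj₁ (proj₂ bottom-exists))
      root-height : height R root root < 1
      root-height = s≤s (≤-reflexive (dist-refl R))
      Bl : Hanging ≤H pend height-bot h 1 root x l
      Bl = hanging (symmetric ex) bl (λ p → root-depth acyclic b (left p)) root-height
            (cong suc (trans (+-comm h 1) (sym eq)))
      Br : Hanging ≤H pend height-bot h 1 root y r
      Br = hanging (symmetric ey) br (λ p → root-depth acyclic b (right p)) root-height
            (cong suc (trans (+-comm h 1) (sym eq)))
      many : fullSize (suc h) < inner (node l r)
      many with ⊔-sel (depthˢ l) (depthˢ r)
      ... | inj₁ ⊔≡ = s≤s (+-mono-<-≤ (deep-inner ≤H pend height-bot Bl (trans (sym ⊔≡) eq))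
            (heapVal-≥ (heapVal-branch ≤H pend height-bot Br)))
      ... | inj₂ ⊔≡ = s≤s (+-mono-≤-< (heapVal-≥ (heapVal-branch ≤H pend height-bot Bl))
            (deep-inner ≤H pend height-bot Br (trans (sym ⊔≡) eq)))
      depth-mono : ∀ {s} → inner (node l r) ≤ inner s → H ≤ depthˢ s
      depth-mono {s} le = subst (λ d → suc d ≤ depthˢ s) (sym eq)
        (fullSize-cancel-< (suc h) (depthˢ s) (<-≤-trans many (≤-trans le (inner≤fullSize s))))

  record RGoodShape : Set₁ where
    field
      {shape}    : Shape
      branch     : Branch R (λ _ → ⊥) root shape
      value      : suc (rootedSubtrees shape) ≡ maxVal (inner shape)
      depth-least : ∀ {s} → inner shape ≤ inner s → depthˢ shape ≤ depthˢ s

    order : n ≡ size shape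
    order = root-size acyclic branch

    count : suc (subtreeCount R root) ≡ maxVal (inner shape)
    count = trans (cong suc (subtreeCount-root acyclic branch)) value

  rgoodShape : RGoodShape
  rgoodShape with t , b ← rooted-branch R (proj₁ rgood) with h , hv , least ← rgood-shape b =
    record { branch = b ; value = sym (maxVal≡ hv) ; depth-least = least }

-- Extremal numbers of root subtrees

rootedSubtrees-≤ : ∀ t → suc (rootedSubtrees t) ≤ maxVal (inner t)
rootedSubtrees-≤ leaf       = ≤-reflexive (sym (maxVal≡ leaf))
rootedSubtrees-≤ (node l r) = ≤-trans (s≤s (*-mono-≤ (rootedSubtrees-≤ l) (rootedSubtrees-≤ r)))
      (maxVal-optimal (inner l) (inner r))

private abstract
  caterpillar-bound : ∀ x y → 2 * (3 * ((1 + x) * (1 + y))) + 3 * x * y ≡ (3 * x + 2) * (3 * y + 2) + 2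
  caterpillar-bound = solve-∀

-- With `x` and `y` one less than the powers of two of the two sides, the inductive step is an
-- identity with slack `3 * x * y`. The slack vanishes just when one side is a leaf, so caterpillars
-- are extremal.
rootedSubtrees-≥ : ∀ t → 3 * 2 ^ inner t ≤ rootedSubtrees t + 2
rootedSubtrees-≥ leaf       = ≤-refl
rootedSubtrees-≥ (node l r) = begin
  3 * (2 * 2 ^ (inner l + inner r))        ≡⟨ *-swap 3 2 (2 ^ (inner l + inner r)) ⟩
  2 * (3 * 2 ^ (inner l + inner r))
    ≡⟨ cong (λ z → 2 * (3 * z)) (trans (^-distribˡ-+-* 2 (inner l) (inner r)) (cong₂ _*_ (sym eqx) (sym eqy))) ⟩
  2 * (3 * (suc x * suc y))                ≤⟨ m≤m+n _ (3 * x * y) ⟩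
  2 * (3 * (suc x * suc y)) + 3 * x * y    ≡⟨ caterpillar-bound x y ⟩
  (3 * x + 2) * (3 * y + 2) + 2
    ≤⟨ +-monoˡ-≤ 2 (*-mono-≤ (bound (inner l) (rootedSubtrees-≥ l) eqx) (bound (inner r) (rootedSubtrees-≥ r) eqy)) ⟩
  suc (rootedSubtrees l) * suc (rootedSubtrees r) + 2 ∎
  where
  open ≤-Reasoning
  *-swap : ∀ a b c → a * (b * c) ≡ b * (a * c)
  *-swap a b c = trans (sym (*-assoc a b c)) (trans (cong (_* c) (*-comm a b)) (*-assoc b a c))
  x = pred (2 ^ inner l)
  y = pred (2 ^ inner r)
  eqx : suc x ≡ 2 ^ inner l
  eqx = suc-pred (2 ^ inner l) {{m^n≢0 2 (inner l)}}
  eqy : suc y ≡ 2 ^ inner r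
  eqy = suc-pred (2 ^ inner r) {{m^n≢0 2 (inner r)}}
  bound : ∀ i {f z} → 3 * 2 ^ i ≤ f + 2 → suc z ≡ 2 ^ i → 3 * z + 2 ≤ suc f
  bound i {f} {z} le eq = ≤-pred (begin
    suc (3 * z + 2)    ≡⟨ trans (sym (+-suc (3 * z) 2)) (trans (+-comm (3 * z) 3) (sym (*-suc 3 z))) ⟩
    3 * suc z          ≡⟨ cong (3 *_) eq ⟩
    3 * 2 ^ i          ≤⟨ le ⟩
    f + 2              ≡⟨ +-comm f 2 ⟩
    suc (suc f)        ∎)

-- Existence of rgood trees

data Child : ℕ → ℕ → Set where
  odd  : ∀ p → Child p (1 + (p + p))
  even : ∀ p → Child p (2 + (p + p))

child? : ∀ p v → Dec (Child p v)
child? p v with v ≟ 1 + (p + p) | v ≟ 2 + (p + p)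
... | yes refl | _        = yes (odd p)
... | no _     | yes refl = yes (even p)
... | no ≢o    | no ≢e    = no λ { (odd _) → ≢o refl ; (even _) → ≢e refl }

child-≥ : ∀ {p v} → Child p v → 1 + (p + p) ≤ v
child-≥ (odd p)  = ≤-refl
child-≥ (even p) = n≤1+n _

child-≤ : ∀ {p v} → Child p v → v ≤ 2 + (p + p)
child-≤ (odd p)  = n≤1+n _
child-≤ (even p) = ≤-refl

child-< : ∀ {p v} → Child p v → p < v
child-< {p} c = ≤-trans (s≤s (m≤m+n p p)) (child-≥ c)

child-mono : ∀ {p q u v} → Child p u → Child q v → p < q → u < v
child-mono {p} {q} c d p<q = ≤-trans (s≤s (child-≤ c)) (≤-trans
  (s≤s (≤-trans (≤-reflexive (cong suc (sym (+-suc p p)))) (+-mono-≤ p<q p<q))) (child-≥ d))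

child-parent-≤ : ∀ {p q u v} → Child p u → Child q v → u ≤ v → p ≤ q
child-parent-≤ c d u≤v = ≮⇒≥ λ q<p → <⇒≱ (child-mono d c q<p) u≤v

parent : ∀ v → ∃ λ p → Child p (suc v)
parent zero = 0 , odd 0
parent (suc v) with parent v
... | p , odd _  = p , even p
... | p , even _ = suc p , subst (Child (suc p)) (cong (2 +_) (+-suc p p)) (odd (suc p))

double-cancel-< : ∀ {p i} → p + p < i + i → p < i
double-cancel-< {p} {i} lt = ≰⇒> λ i≤p → <⇒≱ lt (+-mono-≤ i≤p i≤p)

-- The complete binary tree in breadth-first numbering: the children of p are 2p + 1 and 2p + 2.
-- The last level fills up from its small end, so that the order _≺_ reverses the numbering.
module CompleteTree (i : ℕ) where

  V : Set
  V = Fin (suc (i + i))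

  Adjacent : Rel V 0ℓ
  Adjacent u v = Child (toℕ u) (toℕ v) ⊎ Child (toℕ v) (toℕ u)

  swap : ∀ {u v} → Adjacent u v → Adjacent v u
  swap (inj₁ c) = inj₂ c
  swap (inj₂ c) = inj₁ c

  parentᶠ : ∀ v → toℕ v ≡ 0 ⊎ ∃ λ p → Child (toℕ p) (toℕ v)
  parentᶠ v with toℕ v in eq
  ... | zero  = inj₁ refl
  ... | suc m with p , c ← parent m =
    inj₂ (Fin.fromℕ< p< , subst (λ p → Child p (suc m)) (sym (Fin.toℕ-fromℕ< p<)) c)
    where
    p< : p < suc (i + i)
    p< = <-trans (child-< c) (subst (_< suc (i + i)) eq (Fin.toℕ<n v))

  abstract
    to-root : ∀ {m} → Acc _<_ m → ∀ v → toℕ v ≡ m → Joined Adjacent zero v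
    to-root (acc rec) v refl with parentᶠ v
    ... | inj₁ eq with refl ← Fin.toℕ-injective {i = v} {zero} eq = 0 , []
    ... | inj₂ (p , c) with k , w ← to-root (rec (child-< c)) p refl = k + 1 , w ++ʷ (inj₁ c ∷ [])

  graph : Graph (suc (i + i))
  graph = record
    { _~_       = Adjacent
    ; _~?_      = λ u v → child? (toℕ u) (toℕ v) ⊎-dec child? (toℕ v) (toℕ u)
    ; symmetric = λ {u} {v} → swap {u} {v}
    ; irrefl    = λ { refl (inj₁ c) → <-irrefl refl (child-< c) ; refl (inj₂ c) → <-irrefl refl (child-< c) }
    ; connected = λ u v →
        let j , p = to-root (<-wellFounded _) u refl
            k , q = to-root (<-wellFounded _) v refl
        in j + k , reverseʷ (λ {u} {v} → swap {u} {v}) p ++ʷ q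
    }

  open Graph graph using (degree; Pendant; symmetric; _~_)

  parent-unique : ∀ {p q v} → Child p v → Child q v → p ≡ q
  parent-unique c d = ≤-antisym (child-parent-≤ c d ≤-refl) (child-parent-≤ d c ≤-refl)

  ranking : Ranking graph
  ranking = record
    { rank         = toℕ
    ; distinct     = λ { (inj₁ c) eq → <⇒≢ (child-< c) eq ; (inj₂ c) eq → <⇒≢ (child-< c) (sym eq) }
    ; lower-unique = λ where
        (inj₁ c) _        v<u _   → contradiction v<u (<-asym (child-< c))
        (inj₂ _) (inj₁ d) _   w<u → contradiction w<u (<-asym (child-< d))
        (inj₂ c) (inj₂ d) _   _   → Fin.toℕ-injective (parent-unique c d)
    }

  acyclic : Acyclic graph
  acyclic = ranking⇒acyclic graph ranking

  open AcyclicProperties graph acyclic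

  levelOf : V → ℕ
  levelOf = height graph zero

  levelOf-child : ∀ {p v : V} → Child (toℕ p) (toℕ v) → levelOf v ≡ suc (levelOf p)
  levelOf-child {p} {v} c with zero Fin.≟ p
  ... | yes refl = trans (dist-trail (one (inj₁ c))) (cong suc (sym (dist-refl graph {zero})))
  ... | no 0≢p with a , b , w ← trail 0≢p =
    trans (dist-trail (append w (one (inj₁ c)) b≢v)) (+-comm (levelOf p) 1)
    where
    0<a : 0 < toℕ a
    0<a with edge-first w
    ... | inj₁ c′ = child-< c′
    ... | inj₂ c′ = contradiction (child-< c′) λ ()
    -- The trail `w` rises all the way, so `b` has a smaller number than `p`, and `v` has a larger
    -- one.
    b≢v : b ≢ v
    b≢v refl = <-asym (child-< c) (proj₂ (rising graph ranking w 0<a))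

  -- In breadth-first numbering parents are ordered as their children, so the comparison passes from
  -- `u` and `v` to their parents.
  levelOf-mono : ∀ {m} → Acc _<_ m → ∀ u v → toℕ v ≡ m → toℕ u ≤ toℕ v → levelOf u ≤ levelOf v
  levelOf-mono (acc rec) u v refl u≤v with parentᶠ u | parentᶠ v
  ... | inj₁ eq | _ with refl ← Fin.toℕ-injective {i = u} {zero} eq = ≤-trans
        (≤-reflexive (dist-refl graph {zero})) z≤n
  ... | inj₂ (p , c) | inj₁ eq = contradiction (child-< c) (≤⇒≯ (≤-trans u≤v (≤-trans (≤-reflexive eq) z≤n)))
  ... | inj₂ (p , c) | inj₂ (q , d) = subst₂ _≤_ (sym (levelOf-child c)) (sym (levelOf-child d))
    (s≤s (levelOf-mono (rec (child-< d)) p q refl (child-parent-≤ c d u≤v)))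

  children : ∀ {v : V} → toℕ v < i → ∃₂ λ (x y : V) → toℕ x ≡ 1 + (toℕ v + toℕ v) × toℕ y ≡ 2 + (toℕ v + toℕ v)
  children {v} v<i = Fin.fromℕ< x< , Fin.fromℕ< y< , Fin.toℕ-fromℕ< x< , Fin.toℕ-fromℕ< y<
    where
    y< : 2 + (toℕ v + toℕ v) < suc (i + i)
    y< = s≤s (≤-trans (≤-reflexive (cong suc (sym (+-suc (toℕ v) _)))) (+-mono-≤ v<i v<i))
    x< : 1 + (toℕ v + toℕ v) < suc (i + i)
    x< = <-trans ≤-refl y<

  child-inner : ∀ {v w : V} → Child (toℕ v) (toℕ w) → toℕ v < i
  child-inner {v} {w} c = double-cancel-< (≤-pred (≤-trans (s≤s (child-≥ c)) (Fin.toℕ<n w)))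

  degree-root : 0 < i → degree zero ≡ 2
  degree-root 0<i with x , y , eqx , eqy ← children {zero} 0<i =
    degree-≡ graph {ys = x ∷ y ∷ []} ((x≢y ∷ []) ∷ [] ∷ []) sound complete
    where
    x≢y : x ≢ y
    x≢y refl = case trans (sym eqx) eqy of λ ()
    sound : ∀ {z} → z ∈ x ∷ y ∷ [] → zero ~ z
    sound (here refl)         = inj₁ (subst (Child 0) (sym eqx) (odd 0))
    sound (there (here refl)) = inj₁ (subst (Child 0) (sym eqy) (even 0))
    complete : ∀ {z} → zero ~ z → z ∈ x ∷ y ∷ []
    complete {z} (inj₁ c) with toℕ z in eqz | c
    ... | _ | odd _  = here (Fin.toℕ-injective (trans eqz (sym eqx)))
    ... | _ | even _ = there (here (Fin.toℕ-injective (trans eqz (sym eqy))))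
    complete (inj₂ c) = contradiction (child-< c) λ ()

  degree-leaf : ∀ {p v : V} → Child (toℕ p) (toℕ v) → i ≤ toℕ v → degree v ≡ 1
  degree-leaf {p} {v} c i≤v = degree≡1⁺ graph (inj₂ c) λ where
    (inj₁ d) → contradiction (child-inner d) (≤⇒≯ i≤v)
    (inj₂ d) → Fin.toℕ-injective (parent-unique d c)

  degree-inner : ∀ {p v : V} → Child (toℕ p) (toℕ v) → toℕ v < i → degree v ≡ 3
  degree-inner {p} {v} c v<i with x , y , eqx , eqy ← children {v} v<i =
    degree-≡ graph {ys = p ∷ x ∷ y ∷ []} ((p≢ eqx (n≤1+n _) ∷ p≢ eqy (≤-trans (n≤1+n _) (n≤1+n _)) ∷ []) ∷
          (x≢y ∷ []) ∷ [] ∷ []) sound complete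
    where
    p≢ : ∀ {z : V} {m} → toℕ z ≡ m → toℕ v + toℕ v ≤ m → p ≢ z
    p≢ eqz le refl = <⇒≱ (child-< c) (≤-trans (m≤m+n (toℕ v) _) (≤-trans le (≤-reflexive (sym eqz))))
    x≢y : x ≢ y
    x≢y refl = 1+n≢n (trans (sym eqy) eqx)
    sound : ∀ {z} → z ∈ p ∷ x ∷ y ∷ [] → v ~ z
    sound (here refl)                 = inj₂ c
    sound (there (here refl))         = inj₁ (subst (Child (toℕ v)) (sym eqx) (odd (toℕ v)))
    sound (there (there (here refl))) = inj₁ (subst (Child (toℕ v)) (sym eqy) (even (toℕ v)))
    complete : ∀ {z} → v ~ z → z ∈ p ∷ x ∷ y ∷ []
    complete {z} (inj₁ d) with toℕ z in eqz | d
    ... | _ | odd _  = there (here (Fin.toℕ-injective (trans eqz (sym eqx))))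
    ... | _ | even _ = there (there (here (Fin.toℕ-injective (trans eqz (sym eqy)))))
    complete (inj₂ d) = here (Fin.toℕ-injective (parent-unique d c))

  pendant⇒≥ : ∀ {v} → Pendant v → i ≤ toℕ v
  pendant⇒≥ {v} pend = ≮⇒≥ λ v<i → case parentᶠ v of λ where
    (inj₁ eq)      → case trans (sym pend) (trans (cong degree (Fin.toℕ-injective {i = v} {zero} eq))
          (degree-root (≤-trans (s≤s z≤n) v<i))) of λ ()
    (inj₂ (p , c)) → case trans (sym pend) (degree-inner {p} {v} c v<i) of λ ()

  isRootedBinaryTree : IsRootedBinaryTree graph zero
  isRootedBinaryTree = acyclic⇒isTree graph acyclic , cases (0 <? i)
    where
    i≡0⇒ : ¬ 0 < i → suc (i + i) ≡ 1
    i≡0⇒ ≮ with z≤n ← ≮⇒≥ ≮ = refl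
    degrees : ∀ v → v ≢ zero → degree v ≡ 1 ⊎ degree v ≡ 3
    degrees v v≢0 with parentᶠ v | toℕ v <? i
    ... | inj₁ eq | _ = contradiction (Fin.toℕ-injective eq) v≢0
    ... | inj₂ (p , c) | yes v<i = inj₂ (degree-inner {p} {v} c v<i)
    ... | inj₂ (p , c) | no  v≮i = inj₁ (degree-leaf {p} {v} c (≮⇒≥ v≮i))
    cases : Dec (0 < i) → suc (i + i) ≡ 1 ⊎ (degree zero ≡ 2 × (∀ v → v ≢ zero → degree v ≡ 1 ⊎ degree v ≡ 3))
    cases (yes 0<i) = inj₂ (degree-root 0<i , degrees)
    cases (no  0≮i) = inj₁ (i≡0⇒ 0≮i)

  parentOf⇒child : ∀ {p v : V} → _ParentOf_ graph zero p v → Child (toℕ p) (toℕ v)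
  parentOf⇒child (inj₁ c , _) = c
  parentOf⇒child {p} {v} (inj₂ c , eq) = contradiction (trans eq (cong suc (levelOf-child {v} {p} c)))
        (<⇒≢ (m≤n⇒m≤1+n ≤-refl))

  isRGood : IsRGood graph zero
  isRGood = record
    { balanced     = balanced
    ; _≺_          = λ u v → v Fin.< u
    ; isOrdering   = record
      { linear     = λ h → On.isStrictTotalOrder proj₁ (Flip.isStrictTotalOrder Fin.<-isStrictTotalOrder)
      ; compatible = λ _ p→u q→v _ q<p → child-mono (parentOf⇒child q→v) (parentOf⇒child p→u) q<p
      }
    ; finalSegment = finalSegment
    }
    where
    -- The parent of `u` is inner and the pendant `v` is not, so the parent has the smaller number
    -- and no greater level.
    balanced : ∀ {u v} → Pendant u → Pendant v → levelOf u ≤ suc (levelOf v)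
    balanced {u} {v} _ pend with parentᶠ u
    ... | inj₁ eq = ≤-trans (levelOf-mono (<-wellFounded _) u v refl (≤-trans (≤-reflexive eq) z≤n)) (n≤1+n _)
    ... | inj₂ (p , c) = ≤-trans (≤-reflexive (levelOf-child {p} {u} c))
      (s≤s (levelOf-mono (<-wellFounded _) p v refl (<⇒≤ (<-≤-trans (child-inner {p} {u} c) (pendant⇒≥ pend)))))

    -- Having a smaller number than the inner vertex `p`, also `q` is inner. Its child is on the
    -- highest level and can have no children itself.
    finalSegment : ∀ {p q} → HighestPendantParent graph zero p → levelOf q ≡ levelOf p → q Fin.< p →
                   HighestPendantParent graph zero q
    finalSegment {p} {q} (x , _ , highest , p→x@(_ , hx)) eq q<p
      with y , _ , eqy , _ ← children {q} (<-trans q<p (child-inner {p} {x} (parentOf⇒child p→x))) =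
      y , degree-leaf {q} {y} q→y (≮⇒≥ not-inner) , (λ w → subst (levelOf w ≤_) hx≡hy (highest w)) , inj₁ q→y , hy
      where
      q→y : Child (toℕ q) (toℕ y)
      q→y = subst (Child (toℕ q)) (sym eqy) (odd (toℕ q))
      hy : levelOf y ≡ suc (levelOf q)
      hy = levelOf-child {q} {y} q→y
      hx≡hy : levelOf x ≡ levelOf y
      hx≡hy = trans hx (trans (cong suc (sym eq)) (sym hy))
      not-inner : ¬ toℕ y < i
      not-inner y<i with z , _ , eqz , _ ← children {y} y<i =
        <⇒≱ (≤-reflexive (trans (cong suc hx≡hy) (sym (levelOf-child {y} {z}
              (subst (Child (toℕ y)) (sym eqz) (odd (toℕ y))))))) (highest z)

-- The witness against which leastness of `l` is used.
complete-rgood : ∀ i → IsRGoodBinaryTree (CompleteTree.graph i) zero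
complete-rgood i = CompleteTree.isRootedBinaryTree i , CompleteTree.isRGood i

complete-count : ∀ i → suc (subtreeCount (CompleteTree.graph i) zero) ≡ maxVal i
complete-count i = trans (RGoodShape.count shape) (cong maxVal
      (*-cancelˡ-≡ _ _ 2 (suc-injective (trans (sym (RGoodShape.order shape))
      (cong (λ z → suc (i + z)) (sym (+-identityʳ i)))))))
  where
  shape = rgoodShape (complete-rgood i)

-- The bound for an arbitrary binary tree

module _ (G : Graph n) (acyclic : Acyclic G) where
  open Graph G
  open AcyclicProperties G acyclic

  drop-first : ∀ {u a b v} → Trail _~_ k u a b v → suc (dist G a v) ≡ k ×
        (v ≡ a ⊎ ∃ λ c → u ≢ c × Trail _~_ (dist G a v) a c b v)
  drop-first (one _)      = cong suc (dist-refl G) , inj₁ refl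
  drop-first (cons {c = c} {b} {v} _ ne p) with refl ← dist-trail p = refl , inj₂ (c , ne , p)

  depth-from : ∀ {N u v b x} (B : Branch G N v t) → Trail _~_ k u v b x → (∀ {c} → u ≢ c → ¬ N c) → k ≤ suc (depthˢ t)
  depth-from {x = x} B w ¬N with drop-first w
  ... | refl , inj₁ refl = s≤s (≤-trans (≤-reflexive (dist-refl G)) z≤n)
  ... | refl , inj₂ (c , u≢c , w′) with p , _ , eq ← locate B w′ (¬N u≢c) = s≤s
        (≤-trans (≤-reflexive (sym eq)) (depth-≤ p))

module _ (T : Graph n) (binary : IsBinaryTree T) where
  open Graph T

  private
    acyclic : Acyclic T
    acyclic = isTree⇒acyclic T (proj₁ binary)

    open AcyclicProperties T acyclic

  -- near and far are the components of the first edge of a path of length d from a core vertex,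
  -- which lies in near, to a center vertex.
  record CoreEdge (d : ℕ) : Set where
    field
      {near far} : Shape
      order      : n ≡ size near + size far
      heavier    : rootedSubtrees far < rootedSubtrees near
      room       : d + (d + depthˢ near) ≤ suc (inner far)

  -- A vertex `x` farthest from `c′` lies beyond `c`, since otherwise `c` would be even farther from
  -- it. By the jump in eccentricity `x` is at distance at least `k + depthˢ near` from `c`;
  -- prolonged back to `s`, the trail gains `k` more and stays in `far` after its first edge. A
  -- shape is no deeper than its number of inner vertices.
  core-edge : ∀ {c s s′ c′} → Trail _~_ k s s′ c′ c → ecc T c < ecc T c′ → subtreeCount T s′ < subtreeCount T s →
              CoreEdge k
  core-edge {k} {c} {s} {s′} {c′} w ecc< count< with binary-branch T binary
        (symmetric (edge-first w)) | binary-branch T binary (edge-first w)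
  ... | near , A | far , B = record
    { order   = sides-size acyclic s~s′ A B
    ; heavier = lighter (subst₂ _<_ (subtreeCount-edge acyclic (symmetric s~s′) B A)
          (subtreeCount-edge acyclic s~s′ A B) count<)
    ; room    = beyond (trail c′≢x)
    }
    where
    s~s′ : s ~ s′
    s~s′ = edge-first w

    lighter : ∀ {a b} → b * suc a < a * suc b → b < a
    lighter {a} {b} lt = +-cancelʳ-< (b * a) b a (subst₂ _<_ (*-suc b a)
          (trans (*-suc a b) (cong (a +_) (*-comm a b))) lt)

    back : Trail _~_ k c c′ s′ s
    back = reverse symmetric w

    deep : k + depthˢ near ≤ ecc T c
    deep with p , eq ← deepest near with route A p
    ... | inj₁ refl = subst (λ d → k + d ≤ ecc T c) eq (≤-trans
          (≤-reflexive (trans (+-identityʳ k) (sym (dist-trail back)))) (dist-≤-ecc T c s))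
    ... | inj₂ (a , b , w′ , a≢s′) = subst (λ d → k + d ≤ ecc T c) eq
      (≤-trans (≤-reflexive (sym (dist-trail (append back w′ (a≢s′ ∘ sym))))) (dist-≤-ecc T c _))

    x : Fin n
    x = proj₁ (ecc-attained T c′)

    far-x : suc (k + depthˢ near) ≤ dist T c′ x
    far-x = ≤-trans (s≤s deep) (≤-trans ecc< (≤-reflexive (sym (proj₂ (ecc-attained T c′)))))

    c′≢x : c′ ≢ x
    c′≢x eq = case ≤-trans far-x (≤-reflexive (trans (cong (dist T c′) (sym eq)) (dist-refl T))) of λ ()

    k>0 : 0 < k
    k>0 = subst (0 <_) (proj₁ (drop-first T acyclic w)) (s≤s z≤n)

    beyond : (∃₂ λ e b → Trail _~_ (dist T c′ x) c′ e b x) → k + (k + depthˢ near) ≤ suc (inner far)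
    beyond (e , b , w′) with e Fin.≟ c
    ... | no e≢c = contradiction ecc< (≤⇒≯ (≤-trans (≤-reflexive (sym (proj₂ (ecc-attained T c′))))
      (≤-trans (n≤1+n _) (≤-trans (≤-reflexive (sym (dist-trail (cons (edge-first back) (e≢c ∘ sym) w′))))
            (dist-≤-ecc T c x)))))
    ... | yes refl with drop-first T acyclic w′
    -- If `x` were `c`, its distance from `c′` would be 1, whereas `far-x` asks for at least 2
    -- because `k > 0`.
    ...   | eq , inj₁ x≡c = contradiction (≤-trans (s≤s (≤-trans k>0 (m≤m+n k _))) far-x)
      (<⇒≱ (s≤s (≤-reflexive (trans (sym eq) (cong suc (trans (cong (dist T c) x≡c) (dist-refl T)))))))
    ...   | eq , inj₂ (g , c′≢g , w″) = ≤-trans (+-monoʳ-≤ k (≤-pred (≤-trans far-x (≤-reflexive (sym eq)))))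
      (≤-trans (depth-from T acyclic B (append w w″ c′≢g) (λ s≢c → s≢c ∘ sym)) (s≤s (depthˢ≤inner far)))

  -- Either end of the trail moves inwards as long as its neighbour is again a center or core
  -- vertex. When both are stuck, eccentricity and count change strictly there, as `core-edge`
  -- demands.
  centerCoreDist-bound : ∀ {c s} d → Center T c → SubtreeCore T s → dist T c s ≡ d →
                         ∃ λ k → centerCoreDist T ≤ k × (k ≡ 0 ⊎ CoreEdge k)
  centerCoreDist-bound {c} {s} zero Cc Ss eq = 0 , ≤-trans (setDist-≤ T (center? T) (subtreeCore? T) Cc Ss)
        (≤-reflexive eq) , inj₁ refl
  centerCoreDist-bound {c} {s} (suc d) Cc Ss eq
    with s′ , c′ , w ← trail (λ s≡c → case trans (sym eq) (trans (cong (dist T c) s≡c) (dist-refl T)) of λ ()) =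
    by-cases (center? T c′) (subtreeCore? T s′)
    where
    by-cases : Dec (Center T c′) → Dec (SubtreeCore T s′) → _
    by-cases (yes Cc′) _ = centerCoreDist-bound d Cc′ Ss
      (suc-injective (trans (proj₁ (drop-first T acyclic (reverse symmetric w))) (trans (dist-sym T s c) eq)))
    by-cases (no _) (yes Ss′) = centerCoreDist-bound d Cc Ss′
      (suc-injective (trans (cong suc (dist-sym T c s′))
            (trans (proj₁ (drop-first T acyclic w)) (trans (dist-sym T s c) eq))))
    by-cases (no ¬Cc′) (no ¬Ss′) = dist T s c ,
      ≤-trans (setDist-≤ T (center? T) (subtreeCore? T) Cc Ss) (≤-reflexive (dist-sym T c s)) ,
      inj₂ (core-edge w
        (≰⇒> λ le → ¬Cc′ λ u → ≤-trans le (Cc u))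
        (≰⇒> λ le → ¬Ss′ λ u → ≤-trans (Ss u) le))

  centerCoreDist-≤ : Fin n → ∃ λ k → centerCoreDist T ≤ k × (k ≡ 0 ⊎ CoreEdge k)
  centerCoreDist-≤ v = centerCoreDist-bound _
    (λ u → All.lookup (f[argmin]≤f[xs] {f = ecc T} v (allFin n)) (∈-allFin u))
    (λ u → All.lookup (f[xs]≤f[argmax] {f = subtreeCount T} v (allFin n)) (∈-allFin u)) refl

-- Caterpillars

data Caterpillar : Shape → Set where
  leaf  : Caterpillar leaf
  nodeˡ : Caterpillar t → Caterpillar (node t leaf)
  nodeʳ : Caterpillar t → Caterpillar (node leaf t)

caterpillar-depth : Caterpillar t → depthˢ t ≡ inner t
caterpillar-depth leaf      = refl
caterpillar-depth (nodeˡ c) = cong suc (trans (⊔-identityʳ _) (trans (caterpillar-depth c) (sym (+-identityʳ _))))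
caterpillar-depth (nodeʳ c) = cong suc (caterpillar-depth c)

-- The equality case of `rootedSubtrees-≥`: the threshold for `l` is the count of such a shape.
caterpillar-count : Caterpillar t → rootedSubtrees t + 2 ≡ 3 * 2 ^ inner t
caterpillar-count leaf = refl
caterpillar-count (nodeˡ {t = t} c) = trans (double (rootedSubtrees t)) (trans (cong (2 *_) (caterpillar-count c))
  (trans (swap (2 ^ inner t)) (cong (λ i → 3 * (2 * 2 ^ i)) (sym (+-identityʳ (inner t))))))
  where
  double : ∀ f → suc f * 2 + 2 ≡ 2 * (f + 2)
  double f = trans (cong (_+ 2) (*-comm (suc f) 2)) (sym
        (trans (cong (2 *_) (+-comm f 2)) (trans (*-distribˡ-+ 2 1 (suc f)) (+-comm 2 (2 * suc f)))))
  swap : ∀ x → 2 * (3 * x) ≡ 3 * (2 * x)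
  swap x = trans (sym (*-assoc 2 3 x)) (*-assoc 3 2 x)
caterpillar-count (nodeʳ {t = t} c) = trans (double (rootedSubtrees t))
      (trans (cong (2 *_) (caterpillar-count c)) (swap (2 ^ inner t)))
  where
  double : ∀ f → 2 * suc f + 2 ≡ 2 * (f + 2)
  double f = sym (trans (cong (2 *_) (+-comm f 2)) (trans (*-distribˡ-+ 2 1 (suc f)) (+-comm 2 (2 * suc f))))
  swap : ∀ x → 2 * (3 * x) ≡ 3 * (2 * x)
  swap x = trans (sym (*-assoc 2 3 x)) (*-assoc 3 2 x)

trail-length>0 : {R : Rel (Fin n) 0ℓ} → ∀ {u a b v} → Trail R k u a b v → 0 < k
trail-length>0 (one _)      = s≤s z≤n
trail-length>0 (cons _ _ _) = s≤s z≤n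

module PathProperties {G : Graph n} (acyclic : Acyclic G) where
  open Graph G
  open AcyclicProperties G acyclic

  path-trail : ∀ {k} (p : Fin (2 + k) → Fin n) → IsPath p → (j : Fin (suc k)) →
               ∃ λ b → Trail _~_ (suc (toℕ j)) (p zero) (p (suc zero)) b (p (suc j))
  path-trail p (inj , adj) zero = _ , one (adj zero)
  path-trail {suc k} p (inj , adj) (suc j)
    with b , w ← path-trail (p ∘ suc) ((λ eq → Fin.suc-injective (inj eq)) , adj ∘ suc) j =
    b , cons (adj zero) (λ eq → case inj eq of λ ()) w

  path-dist : ∀ {k} (p : Fin (suc k) → Fin n) → IsPath p → ∀ i j → toℕ i ≤ toℕ j →
              dist G (p i) (p j) + toℕ i ≡ toℕ j
  path-dist p path zero zero _ = trans (+-identityʳ _) (dist-refl G)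
  path-dist {suc k} p path zero (suc j) _ = trans (+-identityʳ _) (dist-trail (proj₂ (path-trail p path j)))
  path-dist {suc k} p (inj , adj) (suc i) (suc j) (s≤s i≤j) =
    trans (+-suc _ (toℕ i)) (cong suc (path-dist (p ∘ suc) ((λ eq → Fin.suc-injective (inj eq)) , adj ∘ suc) i j i≤j))

  module _ {k} (p : Fin (suc k) → Fin n) (path : IsPath p) (v : Fin n) where

    -- The path meets the component of a after deleting the edge from v to its neighbour a.
    Meets : Fin n → Set
    Meets a = ∃ λ i → ∃₂ λ k b → Trail _~_ k v a b (p i)

    private
      -- Distances add along the path, so the middle index would give `(α + β) + (β + γ) ≡ α + γ`,
      -- against `β > 0`.
      sorted : ∀ {a b c} → a ≢ b → a ≢ c → b ≢ c → ((i , _) : Meets a) ((j , _) : Meets b) ((k , _) : Meets c) →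
               toℕ i ≤ toℕ j → toℕ j ≤ toℕ k → ⊥
      sorted a≢b a≢c b≢c (i , α , _ , w₁) (j , β , _ , w₂) (k , γ , _ , w₃) i≤j j≤k =
        <⇒≱ (+-mono-<-≤ (m<m+n α (trail-length>0 w₂)) (m≤n+m γ β)) (≤-reflexive (begin
          (α + β) + (β + γ)                                 ≡⟨ cong₂ _+_ (apart a≢b w₁ w₂) (apart b≢c w₂ w₃) ⟨
          dist G (p i) (p j) + dist G (p j) (p k)           ≡⟨ +-comm (dist G (p i) (p j)) _ ⟩
          dist G (p j) (p k) + dist G (p i) (p j)           ≡⟨ +-cancelʳ-≡ (toℕ i) _ _ (begin
            (dist G (p j) (p k) + dist G (p i) (p j)) + toℕ i ≡⟨ +-assoc (dist G (p j) (p k)) _ _ ⟩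
            dist G (p j) (p k) + (dist G (p i) (p j) + toℕ i)
              ≡⟨ cong (dist G (p j) (p k) +_) (path-dist p path i j i≤j) ⟩
            dist G (p j) (p k) + toℕ j                        ≡⟨ path-dist p path j k j≤k ⟩
            toℕ k                                             ≡⟨ path-dist p path i k (≤-trans i≤j j≤k) ⟨
            dist G (p i) (p k) + toℕ i                        ∎) ⟩
          dist G (p i) (p k)                                ≡⟨ apart a≢c w₁ w₃ ⟩
          α + γ                                             ∎))
        where
        open ≡-Reasoning
        apart : ∀ {a b x y d e α β} → a ≢ b → Trail _~_ α v a d x → Trail _~_ β v b e y → dist G x y ≡ α + β
        apart a≢b w w′ = dist-trail (append (reverse symmetric w) w′ a≢b)

    meets-two : ∀ {a b c} → a ≢ b → a ≢ c → b ≢ c → Meets a → Meets b → Meets c → ⊥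
    meets-two a≢b a≢c b≢c A@(i , _) B@(j , _) C@(k , _) with ≤-total (toℕ i) (toℕ j) | ≤-total (toℕ j)
          (toℕ k) | ≤-total (toℕ i) (toℕ k)
    ... | inj₁ ij | inj₁ jk | _       = sorted a≢b a≢c b≢c A B C ij jk
    ... | inj₁ ij | inj₂ kj | inj₁ ik = sorted a≢c a≢b (b≢c ∘ sym) A C B ik kj
    ... | inj₁ ij | inj₂ kj | inj₂ ki = sorted (a≢c ∘ sym) (b≢c ∘ sym) a≢b C A B ki ij
    ... | inj₂ ji | inj₁ jk | inj₁ ik = sorted (a≢b ∘ sym) b≢c a≢c B A C ji ik
    ... | inj₂ ji | inj₁ jk | inj₂ ki = sorted b≢c (a≢b ∘ sym) (a≢c ∘ sym) B C A jk ki
    ... | inj₂ ji | inj₂ kj | _       = sorted (b≢c ∘ sym) (a≢c ∘ sym) (a≢b ∘ sym) C B A kj ji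

    -- The path has to contain `a′` or a neighbour of it. Such a neighbour is `a` or lies beyond
    -- `a′`, so in each case the path enters the leg.
    dominated-leg : (∀ w → (∀ i → p i ≢ w) → ∃ λ i → w ~ p i) →
                    ∀ {a a′} → v ~ a → a ~ a′ → v ≢ a′ → Meets a
    dominated-leg dom {a} {a′} v~a a~a′ v≢a′ with Fin.any? (λ i → p i Fin.≟ a′)
    ... | yes (i , refl) = i , _ , _ , cons v~a v≢a′ (one a~a′)
    ... | no none with i , a′~pi ← dom a′ (λ i eq → none (i , eq)) with a Fin.≟ p i
    ...   | yes refl = i , _ , _ , one v~a
    ...   | no  a≢pi = i , _ , _ , cons v~a v≢a′ (cons a~a′ a≢pi (one a′~pi))

module _ {H : Graph n} (caterpillar : IsBinaryCaterpillar H) {h : Fin n} (peripheral : ∀ u → ecc H u ≤ ecc H h) where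
  open Graph H

  private
    binary = proj₁ caterpillar
    p      = proj₁ (proj₂ (proj₂ caterpillar))
    path   = proj₁ (proj₂ (proj₂ (proj₂ caterpillar)))
    dominating = proj₂ (proj₂ (proj₂ (proj₂ caterpillar)))

    acyclicH : Acyclic H
    acyclicH = isTree⇒acyclic H (proj₁ binary)

  open AcyclicProperties H acyclicH
  open PathProperties {G = H} acyclicH

  -- Two inner children of `v` and the edge behind `u` would be three legs of length two at `v`, all
  -- met by the dominating path, which can enter only two.
  caterpillar-branch : ∀ {u v u′} → v ~ u → u ~ u′ → v ≢ u′ → Branch H (_≡ u) v t → Caterpillar t
  caterpillar-branch v~u u~u′ v≢u′ (leaf _) = leaf
  caterpillar-branch v~u u~u′ v≢u′ (node ex ey x≢u _ _ _ bl (leaf _)) =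
    nodeˡ (caterpillar-branch (symmetric ex) v~u x≢u bl)
  caterpillar-branch v~u u~u′ v≢u′ (node ex ey _ y≢u _ _ (leaf _) br@(node _ _ _ _ _ _ _ _)) =
    nodeʳ (caterpillar-branch (symmetric ey) v~u y≢u br)
  caterpillar-branch {v = v} v~u u~u′ v≢u′
    (node ex ey x≢u y≢u x≢y _ (node ex′ _ x′≢v _ _ _ _ _) (node ey′ _ y′≢v _ _ _ _ _)) =
    ⊥-elim (meets-two p path v (x≢u ∘ sym) (y≢u ∘ sym) x≢y
      (dominated-leg p path v dominating v~u u~u′ v≢u′)
      (dominated-leg p path v dominating ex ex′ (x′≢v ∘ sym))
      (dominated-leg p path v dominating ey ey′ (y′≢v ∘ sym)))

  record Spine : Set where
    field
      {next}      : Fin n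
      edge        : h ~ next
      only        : ∀ {w} → h ~ w → w ≡ next
      {shape}     : Shape
      branch      : Branch H (_≡ h) next shape
      slender     : Caterpillar shape
      ecc≡        : ecc H h ≡ suc (inner shape)

    order : n ≡ suc (size shape)
    order = sides-size acyclicH edge (leaf only) branch

  -- A second neighbour of `h` would see the farthest vertex at distance one more than the maximal
  -- eccentricity, so `h` is an end. Below it, at most one child of each vertex is inner.
  spine : ∀ {y} → h ≢ y → Spine
  spine {y} h≢y = build (trail h≢x)
    where
    x = proj₁ (ecc-attained H h)
    dist-x : dist H h x ≡ ecc H h
    dist-x = proj₂ (ecc-attained H h)
    h≢x : h ≢ x
    h≢x h≡x = h≢y (dist≡0 H (n≤0⇒n≡0 (≤-trans (dist-≤-ecc H h y)
      (≤-reflexive (trans (sym dist-x) (trans (cong (dist H h) (sym h≡x)) (dist-refl H)))))))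

    too-far : ∀ {u a b v} → Trail _~_ (suc (ecc H h)) u a b v → ⊥
    too-far {u} w = <⇒≱ (≤-reflexive (sym (dist-trail w))) (≤-trans (dist-≤-ecc H u _) (peripheral u))

    build : (∃₂ λ g b → Trail _~_ (dist H h x) h g b x) → Spine
    build (g , _ , w) with t , B ← binary-branch H binary (edge-first w) = record
      { edge = h~g ; only = only ; branch = B ; slender = cat B ecc≡depth
      ; ecc≡ = trans ecc≡depth (cong suc (caterpillar-depth (cat B ecc≡depth))) }
      where
      h~g = edge-first w
      only : ∀ {z} → h ~ z → z ≡ g
      only {z} h~z with z Fin.≟ g
      ... | yes z≡g = z≡g
      ... | no  z≢g = ⊥-elim (too-far (subst (λ k → Trail _~_ (suc k) z h _ x) dist-x (cons (symmetric h~z) z≢g w)))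
      ecc≡depth : ecc H h ≡ suc (depthˢ t)
      ecc≡depth = ≤-antisym
        (≤-trans (≤-reflexive (sym dist-x)) (depth-from H acyclicH B w (λ h≢c → h≢c ∘ sym)))
        (≤-trans (≤-reflexive (sym (trans (dist-trail (proj₂ (via acyclicH h~g B (proj₁ (deepest t)))))
              (cong suc (proj₂ (deepest t))))))
          (dist-≤-ecc H h _))
      too-far′ : ∀ {D u a b v z} → ecc H h ≡ suc (suc D) → u ~ a → u ≢ b → a ~ b → a ≢ v →
                 (∃ λ c → Trail _~_ (suc D) b v c z) → ⊥
      too-far′ {D} {u} {a} {z = z} eq u~a u≢b a~b a≢v (c , w) =
        too-far (subst (λ k → Trail _~_ (suc k) u a c z) (sym eq) (cons u~a u≢b (cons a~b a≢v w)))
      cat : ∀ {t} → Branch H (_≡ h) g t → ecc H h ≡ suc (depthˢ t) → Caterpillar t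
      cat (leaf _) _ = leaf
      cat (node ex ey x≢h _ _ _ bl (leaf _)) _ = nodeˡ (caterpillar-branch (symmetric ex) (symmetric h~g) x≢h bl)
      cat (node ex ey _ y≢h _ _ (leaf _) br@(node _ _ _ _ _ _ _ _)) _ = nodeʳ
            (caterpillar-branch (symmetric ey) (symmetric h~g) y≢h br)
      -- The leg behind `g` is just `h`, too short for the three-leg argument. Instead, a trail from
      -- a child of the other side through `g` to the deepest vertex exceeds the maximal
      -- eccentricity.
      cat {node l r} (node ex ey _ _ x≢y _ bl@(node ex′ _ x′≢g _ _ _ _ _) br@(node ey′ _ y′≢g _ _ _ _ _)) eq
        with ⊔-sel (depthˢ l) (depthˢ r)
      ... | inj₁ ⊔≡ = ⊥-elim (too-far′ (trans eq (cong 2+ (trans ⊔≡ (sym (proj₂ (deepest l))))))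
        (symmetric ey′) y′≢g (symmetric ey) (x≢y ∘ sym) (via acyclicH ex bl (proj₁ (deepest l))))
      ... | inj₂ ⊔≡ = ⊥-elim (too-far′ (trans eq (cong 2+ (trans ⊔≡ (sym (proj₂ (deepest r))))))
        (symmetric ex′) x′≢g (symmetric ex) x≢y (via acyclicH ey br (proj₁ (deepest r))))

-- Crg trees

module _ {G : Graph n} (acyclic : Acyclic G) where
  open Graph G
  open AcyclicProperties G acyclic

  adjacent-levels : ∀ {r u v} → u ~ v →
    dist G r v ≡ suc (dist G r u) ⊎ (dist G r u ≡ suc (dist G r v) × ∃₂ λ k a → Trail _~_ k r a v u)
  adjacent-levels {r} {u} {v} u~v with r Fin.≟ u
  ... | yes refl = inj₁ (trans (dist-trail (one u~v)) (cong suc (sym (dist-refl G))))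
  ... | no r≢u with a , b , w ← trail r≢u with b Fin.≟ v
  ...   | no  b≢v  = inj₁ (trans (dist-trail (append w (one u~v) b≢v)) (+-comm _ 1))
  ...   | yes refl = inj₂ (
      trans (sym (proj₁ (drop-first G acyclic (reverse symmetric w)))) (cong suc (dist-sym G b r)) , _ , a , w)

  -- The rank is the distance to a fixed vertex. In this form acyclicity can be glued: two rankings
  -- that vanish at the shared vertex combine into one.
  acyclic⇒ranking : Fin n → Ranking G
  acyclic⇒ranking r = record
    { rank         = dist G r
    ; distinct     = λ e eq → case adjacent-levels {r} e of λ where
        (inj₁ up)         → 1+n≢n (trans (sym up) (sym eq))
        (inj₂ (down , _)) → 1+n≢n (trans (sym down) eq)
    ; lower-unique = λ e e′ lt lt′ → lower (adjacent-levels {r} e) (adjacent-levels {r} e′) lt lt′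
    }
    where
    lower : ∀ {u v w} →
      dist G r v ≡ suc (dist G r u) ⊎ (dist G r u ≡ suc (dist G r v) × ∃₂ λ k a → Trail _~_ k r a v u) →
      dist G r w ≡ suc (dist G r u) ⊎ (dist G r u ≡ suc (dist G r w) × ∃₂ λ k a → Trail _~_ k r a w u) →
      dist G r v < dist G r u → dist G r w < dist G r u → v ≡ w
    lower (inj₁ up) _         lt _   = contradiction lt (<⇒≯ (≤-reflexive (sym up)))
    lower (inj₂ _) (inj₁ up)  _  lt′ = contradiction lt′ (<⇒≯ (≤-reflexive (sym up)))
    lower (inj₂ (_ , _ , _ , w)) (inj₂ (_ , _ , _ , w′)) _ _ = last-unique w w′

split-trail : {R : Rel (Fin n) 0ℓ} → ∀ i {j u a b v} → Trail R (suc i + suc j) u a b v →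
              ∃₂ λ m c → ∃ λ e → Trail R (suc i) u a c m × Trail R (suc j) m e b v × c ≢ e
split-trail zero    (cons e ne w) = _ , _ , _ , one e , w , ne
split-trail (suc i) (cons e ne w) with m , c , d , w₁ , w₂ , c≢d ← split-trail i w =
  m , c , d , cons e ne w₁ , w₂ , c≢d

module Embedding {H : Graph m} {G : Graph n} (φ : Fin m → Fin n) (φ-inj : ∀ {x y} → φ x ≡ φ y → x ≡ y)
                 (hom : ∀ {x y} → Graph._~_ H x y → Graph._~_ G (φ x) (φ y)) where
  private
    module G = Graph G
    module H = Graph H

  φ-walk : ∀ {x y} → Walk H._~_ k x y → Walk G._~_ k (φ x) (φ y)
  φ-walk []      = []
  φ-walk (e ∷ w) = hom e ∷ φ-walk w

  φ-dist : ∀ x y → dist G (φ x) (φ y) ≤ dist H x y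
  φ-dist x y = dist-≤ G (φ-walk (dist-walk H x y))

  φ-trail : ∀ {x a b y} → Trail H._~_ k x a b y → Trail G._~_ k (φ x) (φ a) (φ b) (φ y)
  φ-trail (one e)       = one (hom e)
  φ-trail (cons e ne w) = cons (hom e) (ne ∘ φ-inj) (φ-trail w)

  module _ (acyclicH : Acyclic H) {base : Fin m}
           (closed : ∀ {x w} → x ≢ base → φ x G.~ w → ∃ λ y → φ y ≡ w × x H.~ y) where

    -- The trail from `base` keeps the branch away from `base`, the one vertex that may have further
    -- neighbours in `G`.
    φ-branch : ∀ {u v a} → Trail H._~_ k base a u v → Branch H (_≡ u) v t → Branch G (_≡ φ u) (φ v) t
    φ-branch {u = u} {v} w b with (λ (eq : v ≡ base) → acyclicH (subst (λ z → Trail H._~_ _ _ _ _ z) eq w))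
    φ-branch {u = u} {v} w (leaf all) | v≢base = leaf λ e → case closed v≢base e of λ where
      (y , refl , e′) → cong φ (all e′)
    φ-branch {u = u} {v} w (node {x = x} {y} ex ey x≢u y≢u x≢y all bl br) | v≢base =
      node (hom ex) (hom ey) (x≢u ∘ φ-inj) (y≢u ∘ φ-inj) (x≢y ∘ φ-inj) all′
        (φ-branch (append w (one ex) (x≢u ∘ sym)) bl) (φ-branch (append w (one ey) (y≢u ∘ sym)) br)
      where
      all′ : ∀ {z} → φ v G.~ z → z ≡ φ u ⊎ z ≡ φ x ⊎ z ≡ φ y
      all′ e with z , refl , e′ ← closed v≢base e with all e′
      ... | inj₁ refl        = inj₁ refl
      ... | inj₂ (inj₁ refl) = inj₂ (inj₁ refl)
      ... | inj₂ (inj₂ refl) = inj₂ (inj₂ refl)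

module _ {G : Graph n} (acyclic : Acyclic G) where
  open Graph G

  -- Moving on to a child, the side left behind absorbs the other child and grows, while the side
  -- ahead shrinks. So the inequality between the sides persists, and the count falls at every step.
  count-descends : ∀ {u v} → u ~ v → Branch G (_≡ v) u s → (B : Branch G (_≡ u) v t) →
                   rootedSubtrees t < rootedSubtrees s → ∀ p → subtreeCount G (vert B p) < subtreeCount G u
  count-descends {s = s} {t} {u} {v} u~v A B lt = go B lt
    where
    edge< : ∀ {s t u v} → u ~ v → Branch G (_≡ v) u s → Branch G (_≡ u) v t → rootedSubtrees t < rootedSubtrees s →
            subtreeCount G v < subtreeCount G u
    edge< {s} {t} u~v A B lt = subst₂ _<_ (sym (subtreeCount-edge acyclic (symmetric u~v) B A))
          (sym (subtreeCount-edge acyclic u~v A B))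
      (subst₂ _<_ (sym (*-suc (rootedSubtrees t) _))
                  (sym (trans (*-suc (rootedSubtrees s) _)
                        (cong (rootedSubtrees s +_) (*-comm (rootedSubtrees s) _))))
                  (+-monoˡ-< (rootedSubtrees t * rootedSubtrees s) lt))
    go : (B : Branch G (_≡ u) v t) → rootedSubtrees t < rootedSubtrees s → ∀ p → subtreeCount G
          (vert B p) < subtreeCount G u
    go B lt here = edge< u~v A B lt
    go B@(node {l = l} {r} ex ey x≢u y≢u x≢y all bl br) lt (left p) = <-trans
      (count-descends ex (node (symmetric u~v) ey (x≢u ∘ sym) (x≢y ∘ sym) (y≢u ∘ sym)
          (λ e → case all e of λ { (inj₁ eq) → inj₂ (inj₁ eq) ; (inj₂ (inj₁ eq)) → inj₁ eq ; (inj₂ (inj₂ eq)) → inj₂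
                (inj₂ eq) }) A br) bl
        (<-≤-trans (≤-<-trans (m≤n⇒m≤1+n (≤-trans (n≤1+n _)
              (m≤m*n (suc (rootedSubtrees l)) (suc (rootedSubtrees r))))) (s≤s lt))
              (m≤m*n _ (suc (rootedSubtrees r)))) p)
      (edge< u~v A B lt)
    go B@(node {l = l} {r} ex ey x≢u y≢u x≢y all bl br) lt (right p) = <-trans
      (count-descends ey (node (symmetric u~v) ex (y≢u ∘ sym) x≢y (x≢u ∘ sym)
          (λ e → case all e of λ { (inj₁ eq) → inj₂ (inj₁ eq) ; (inj₂ (inj₁ eq)) → inj₂ (inj₂ eq) ; (inj₂ (inj₂ eq)) →
                inj₁ eq }) A bl) br
        (<-≤-trans (≤-<-trans (m≤n⇒m≤1+n (≤-trans (n≤1+n _)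
              (m≤n*m (suc (rootedSubtrees r)) (suc (rootedSubtrees l))))) (s≤s lt))
              (m≤m*n _ (suc (rootedSubtrees l)))) p)
      (edge< u~v A B lt)

module Crg {G : Graph n} {R : Graph a} {r : Fin a} {H : Graph b} {h : Fin b}
           (identification : IsIdentification G R r H h) (acyclicR : Acyclic R) (acyclicH : Acyclic H) where

  open IsIdentification identification
  private
    module G = Graph G
    module R = Graph R
    module H = Graph H

  φ-hom : ∀ {x y} → x R.~ y → φ x G.~ φ y
  φ-hom e = Equivalence.from edges (inj₁ (_ , _ , refl , refl , e))

  ψ-hom : ∀ {x y} → x H.~ y → ψ x G.~ ψ y
  ψ-hom e = Equivalence.from edges (inj₂ (_ , _ , refl , refl , e))

  ψ-closed : ∀ {y w} → y ≢ h → ψ y G.~ w → ∃ λ y′ → ψ y′ ≡ w × y H.~ y′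
  ψ-closed y≢h e with Equivalence.to edges e
  ... | inj₁ (_ , _ , eq , _ , _) = contradiction (proj₂ (disjoint eq)) y≢h
  ... | inj₂ (_ , y′ , eq , eq′ , e′) with refl ← ψ-inj eq = y′ , eq′ , e′

  φ-closed : ∀ {x w} → x ≢ r → φ x G.~ w → ∃ λ x′ → φ x′ ≡ w × x R.~ x′
  φ-closed x≢r e with Equivalence.to edges e
  ... | inj₂ (_ , _ , eq , _ , _) = contradiction (proj₁ (disjoint (sym eq))) x≢r
  ... | inj₁ (_ , x′ , eq , eq′ , e′) with refl ← φ-inj eq = x′ , eq′ , e′

  module φ = Embedding {H = R} {G} φ φ-inj φ-hom
  module ψ = Embedding {H = H} {G} ψ ψ-inj ψ-hom

  private
    module RankR = Ranking (acyclic⇒ranking {G = R} acyclicR r)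
    module RankH = Ranking (acyclic⇒ranking {G = H} acyclicH h)

  -- Either part measures the distance to the shared vertex, where both give 0, so the choice made
  -- by `cover` does not matter.
  rank : Fin n → ℕ
  rank v with cover v
  ... | inj₁ (x , _) = dist R r x
  ... | inj₂ (y , _) = dist H h y

  rank-φ : ∀ x → rank (φ x) ≡ dist R r x
  rank-φ x with cover (φ x)
  ... | inj₁ (x′ , eq) = cong (dist R r) (φ-inj eq)
  ... | inj₂ (y , eq) with refl , refl ← disjoint (sym eq) = trans (dist-refl H) (sym (dist-refl R))

  rank-ψ : ∀ y → rank (ψ y) ≡ dist H h y
  rank-ψ y with cover (ψ y)
  ... | inj₂ (y′ , eq) = cong (dist H h) (ψ-inj eq)
  ... | inj₁ (x , eq) with refl , refl ← disjoint eq = trans (dist-refl R) (sym (dist-refl H))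

  acyclicG : Acyclic G
  acyclicG = ranking⇒acyclic G record { rank = rank ; distinct = distinct ; lower-unique = lower }
    where
    distinct : ∀ {u v} → u G.~ v → rank u ≢ rank v
    distinct e eq with Equivalence.to edges e
    ... | inj₁ (x , x′ , refl , refl , e′) = RankR.distinct e′ (trans (sym (rank-φ x)) (trans eq (rank-φ x′)))
    ... | inj₂ (y , y′ , refl , refl , e′) = RankH.distinct e′ (trans (sym (rank-ψ y)) (trans eq (rank-ψ y′)))
    -- Neighbours from different parts occur only at the shared vertex, whose rank is 0.
    nothing-below : ∀ {x y} v → φ x ≡ ψ y → rank v < rank (φ x) → ⊥
    nothing-below v eq lt with refl , refl ← disjoint eq = case subst (rank v <_)
          (trans (rank-φ r) (dist-refl R)) lt of λ ()
    lower : ∀ {u v w} → u G.~ v → u G.~ w → rank v < rank u → rank w < rank u → v ≡ w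
    lower {u} {v} {w} e e′ lt lt′ with Equivalence.to edges e | Equivalence.to edges e′
    ... | inj₁ (x , x₁ , refl , refl , f) | inj₁ (x′ , x₂ , eq , refl , f′) with refl ← φ-inj eq =
      cong φ (RankR.lower-unique f f′ (subst₂ _<_ (rank-φ x₁) (rank-φ x) lt) (subst₂ _<_ (rank-φ x₂) (rank-φ x) lt′))
    ... | inj₂ (y , y₁ , refl , refl , f) | inj₂ (y′ , y₂ , eq , refl , f′) with refl ← ψ-inj eq =
      cong ψ (RankH.lower-unique f f′ (subst₂ _<_ (rank-ψ y₁) (rank-ψ y) lt) (subst₂ _<_ (rank-ψ y₂) (rank-ψ y) lt′))
    ... | inj₁ (x , _ , refl , _) | inj₂ (y , _ , eq , _) = ⊥-elim (nothing-below v (sym eq) lt)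
    ... | inj₂ (y , _ , refl , _) | inj₁ (x , _ , eq , _) = ⊥-elim
          (nothing-below v eq (subst (λ z → rank v < rank z) (sym eq) lt))

  module DistG = AcyclicProperties G acyclicG
  module DistH = AcyclicProperties H acyclicH
  module DistR = AcyclicProperties R acyclicR

  module _ {g : Fin b} (h~g : h H.~ g) (only : ∀ {y} → h H.~ y → y ≡ g) where

    head-branch : Branch R (λ _ → ⊥) r s → Branch G (_≡ ψ g) (ψ h) s
    head-branch {s} B = subst (λ z → Branch G (_≡ ψ g) z s) identified (go B)
      where
      next : ∀ {w} → φ r G.~ w → w ≡ ψ g ⊎ ∃ λ x → φ x ≡ w × r R.~ x
      next e with Equivalence.to edges e
      ... | inj₁ (_ , x , eq , eq′ , e′) with refl ← φ-inj eq = inj₂ (x , eq′ , e′)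
      ... | inj₂ (_ , y , eq , refl , e′) with refl ← proj₂ (disjoint (sym eq)) = inj₁ (cong ψ (only e′))
      φ≢ψg : ∀ {x} → φ x ≢ ψ g
      φ≢ψg eq with refl ← proj₂ (disjoint eq) = H.irrefl refl h~g
      go : Branch R (λ _ → ⊥) r s → Branch G (_≡ ψ g) (φ r) s
      go (leaf all) = leaf λ e → case next e of λ where
        (inj₁ eq)            → eq
        (inj₂ (_ , _ , e′))  → ⊥-elim (all e′)
      go (node {x = x} {y} ex ey _ _ x≢y all bl br) = node (φ-hom ex) (φ-hom ey) φ≢ψg φ≢ψg (x≢y ∘ φ-inj) all′
        (φ.φ-branch acyclicR φ-closed (one ex) bl) (φ.φ-branch acyclicR φ-closed (one ey) br)
        where
        all′ : ∀ {w} → φ r G.~ w → w ≡ ψ g ⊎ w ≡ φ x ⊎ w ≡ φ y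
        all′ e with next e
        ... | inj₁ eq = inj₁ eq
        ... | inj₂ (z , refl , e′) with all e′
        ...   | inj₂ (inj₁ refl) = inj₂ (inj₁ refl)
        ...   | inj₂ (inj₂ refl) = inj₂ (inj₂ refl)

    -- The head outweighs the tail, so counts fall strictly from `ψ h` into the tail.
    core-in-head : Branch R (λ _ → ⊥) r s → Branch H (_≡ h) g t → rootedSubtrees t < rootedSubtrees s →
                   ∀ {v} → SubtreeCore G v → ∃ λ x → φ x ≡ v
    core-in-head {s} {t} A B lt {v} core with cover v
    ... | inj₁ x = x
    ... | inj₂ (y , refl) with h Fin.≟ y
    ...   | yes refl = r , identified
    ...   | no  h≢y  = contradiction (core (ψ h)) (<⇒≱ (fewer (proj₂ (proj₂ (DistH.trail h≢y)))))
      where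
      tail : Branch G (_≡ ψ h) (ψ g) t
      tail = ψ.φ-branch acyclicH ψ-closed (one h~g) B
      fewer′ : ∀ p → subtreeCount G (vert tail p) < subtreeCount G (ψ h)
      fewer′ = count-descends acyclicG (ψ-hom h~g) (head-branch A) tail lt
      fewer : ∀ {k c d} → Trail H._~_ k h c d y → subtreeCount G (ψ y) < subtreeCount G (ψ h)
      fewer w with refl ← only (edge-first w) with uncons w
      ... | inj₁ refl = fewer′ here
      ... | inj₂ (_ , _ , h≢c , w′) with p , eq , _ ← locate tail (ψ.φ-trail w′) (λ eq → h≢c (sym (ψ-inj eq))) =
        subst (λ z → subtreeCount G z < subtreeCount G (ψ h)) eq (fewer′ p)

  module _ (peripheral : ∀ u → ecc H u ≤ ecc H h) {D} (shallow : ∀ x → dist R r x ≤ D) where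

    -- m lies at distance suc d from h on a longest path of H, which starts at h.
    module _ {d j x₀ g e c f m} (w₁ : Trail H._~_ (suc d) h g c m) (w₂ : Trail H._~_ (suc j) m e f x₀) (c≢e : c ≢ e)
             (ecc≡ : ecc H h ≡ suc d + suc j) (room : suc d + D ≤ suc j) where

      private
        d≤j : suc d ≤ suc j
        d≤j = ≤-trans (m≤m+n (suc d) D) room

      -- A vertex of `H` that is not reached through `c` is compared with `h` at the far end of
      -- `w₁`, one reached through `c` with `x₀`; neither has more than the maximal eccentricity.
      -- Vertices of the head are covered by `room`.
      middle-ecc : ecc G (ψ m) ≤ suc j
      middle-ecc = ecc-≤ G λ v → by-side (cover v)
        where
        open ≤-Reasoning
        bound : ∀ y → dist H m y ≤ suc j
        bound y with m Fin.≟ y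
        ... | yes refl = ≤-trans (≤-reflexive (dist-refl H)) z≤n
        ... | no m≢y with e′ , _ , w ← DistH.trail m≢y with c Fin.≟ e′
        ...   | no  c≢e′ = +-cancelˡ-≤ (suc d) _ _ (≤-trans (≤-reflexive (sym (DistH.dist-trail (append w₁ w c≢e′))))
          (≤-trans (dist-≤-ecc H h y) (≤-reflexive ecc≡)))
        ...   | yes refl = ≤-trans (+-cancelˡ-≤ (suc j) _ _ (≤-trans
            (≤-reflexive (sym (DistH.dist-trail (append (reverse H.symmetric w₂) w (c≢e ∘ sym)))))
            (≤-trans (dist-≤-ecc H x₀ y) (≤-trans (peripheral x₀)
                  (≤-reflexive (trans ecc≡ (+-comm (suc d) _))))))) d≤j

        by-side : ∀ {v} → (∃ λ x → φ x ≡ v) ⊎ (∃ λ y → ψ y ≡ v) → dist G (ψ m) v ≤ suc j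
        by-side (inj₁ (x , refl)) = begin
          dist G (ψ m) (φ x)                       ≤⟨ dist-triangle G (ψ m) (ψ h) (φ x) ⟩
          dist G (ψ m) (ψ h) + dist G (ψ h) (φ x)  ≡⟨ cong (λ z → dist G (ψ m) (ψ h) + dist G z (φ x)) identified ⟨
          dist G (ψ m) (ψ h) + dist G (φ r) (φ x)  ≤⟨ +-mono-≤ (ψ.φ-dist m h) (≤-trans (φ.φ-dist r x) (shallow x)) ⟩
          dist H m h + D                           ≡⟨ cong (_+ D) (trans (dist-sym H m h) (DistH.dist-trail w₁)) ⟩
          suc d + D                                ≤⟨ room ⟩
          suc j                                    ∎
        by-side (inj₂ (y , refl)) = ≤-trans (ψ.φ-dist m y) (bound y)

      far-end : ∀ x → suc d + suc j ≤ dist G (φ x) (ψ x₀)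
      far-end x with r Fin.≟ x
      ... | yes refl = ≤-reflexive (sym (trans (cong (λ z → dist G z (ψ x₀)) identified)
        (DistG.dist-trail (ψ.φ-trail (append w₁ w₂ c≢e)))))
      ... | no r≢x with _ , _ , w ← DistR.trail r≢x = ≤-trans (m≤n+m _ _)
        (≤-reflexive (sym (DistG.dist-trail (append (reverse G.symmetric (φ.φ-trail w))
          (subst (λ z → Trail G._~_ (suc d + suc j) z (ψ g) (ψ f) (ψ x₀)) (sym identified)
                (ψ.φ-trail (append w₁ w₂ c≢e))) φ≢ψ))))
        where
        φ≢ψ : ∀ {x} → φ x ≢ ψ g
        φ≢ψ eq with refl ← proj₂ (disjoint eq) = H.irrefl refl (edge-first w₁)

      -- A center vertex is within `suc j` of `x₀`, by comparison with `m`, while the head is at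
      -- least `suc d + suc j` away from `x₀`.
      center-far : ∀ {u} x → Center G u → suc d ≤ dist G u (φ x)
      center-far {u} x Cu = +-cancelʳ-≤ (suc j) _ _ (begin
        suc d + suc j                               ≤⟨ far-end x ⟩
        dist G (φ x) (ψ x₀)                         ≤⟨ dist-triangle G (φ x) u (ψ x₀) ⟩
        dist G (φ x) u + dist G u (ψ x₀)
          ≤⟨ +-mono-≤ (≤-reflexive (dist-sym G (φ x) u))
                (≤-trans (dist-≤-ecc G u _) (≤-trans (Cu (ψ m)) middle-ecc)) ⟩
        dist G u (φ x) + suc j                      ∎)
        where open ≤-Reasoning

    center-distance : ∀ {d j} → ecc H h ≡ suc d + suc j → suc d + D ≤ suc j →
                      ∀ {u} x → Center G u → suc d ≤ dist G u (φ x)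
    center-distance {d} {j} ecc≡ room {u} x Cu = from (DistH.trail h≢x₀)
      where
      x₀ = proj₁ (ecc-attained H h)
      dist-x₀ : dist H h x₀ ≡ ecc H h
      dist-x₀ = proj₂ (ecc-attained H h)
      h≢x₀ : h ≢ x₀
      h≢x₀ h≡ = case trans (sym ecc≡) (trans (sym dist-x₀) (trans (cong (dist H h) (sym h≡)) (dist-refl H))) of λ ()
      from : (∃₂ λ g f → Trail H._~_ (dist H h x₀) h g f x₀) → suc d ≤ dist G u (φ x)
      from (g , f , w) =
        let m , c , e , w₁ , w₂ , c≢e = split-trail d (subst (λ k → Trail H._~_ k h g f x₀) (trans dist-x₀ ecc≡) w)
        in center-far w₁ w₂ c≢e ecc≡ room x Cu

-- Sizes, the threshold for `l` and the comparison of both trees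

other-vertex : 2 ≤ n → (h : Fin n) → ∃ λ y → h ≢ y
other-vertex (s≤s (s≤s _)) zero    = suc zero , λ ()
other-vertex (s≤s (s≤s _)) (suc h) = zero , λ ()

odd-suc-double : ∀ i → Odd (suc (i + i))
odd-suc-double i 2∣ = case ∣1⇒≡1 (∣m+n∣m⇒∣n {m = i + i} (subst (2 ∣_) (+-comm 1 (i + i)) 2∣)
  (divides i (trans (cong (i +_) (sym (+-identityʳ i))) (*-comm 2 i)))) of λ ()

size-inner : ∀ m t → m + size t ∸ m ∸ 1 ≡ inner t * 2
size-inner m t = trans (cong (_∸ 1) (m+n∸m≡n m (size t))) (*-comm 2 (inner t))

-- The exponent in the definition of `l` is the number of inner vertices of the shape that is left
-- beside `m` vertices.
threshold : ∀ m t → n ≡ m + size t → 3 * 2 ^ ((n ∸ m ∸ 1) / 2) ∸ 2 ≡ 3 * 2 ^ inner t ∸ 2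
threshold m t refl = cong (λ e → 3 * 2 ^ e ∸ 2) (trans (cong (_/ 2) (size-inner m t)) (m*n/n≡m (inner t) 2))

-- The threshold is the least count possible for `t`; the heavier `s` exceeds it, and the complete
-- tree with as many inner vertices does no worse than `s`.
complete-exceeds : n ≡ size s + size t → rootedSubtrees t < rootedSubtrees s → RootCountExceeds n
      (suc (inner s + inner s))
complete-exceeds {n} {s} {t} n≡ heavier =
  CompleteTree.graph (inner s) , zero , complete-rgood (inner s) , (begin-strict
    3 * 2 ^ ((n ∸ suc (inner s + inner s) ∸ 1) / 2) ∸ 2
      ≡⟨ threshold (suc (inner s + inner s)) t (trans n≡
            (cong (λ z → suc (inner s + z) + size t) (+-identityʳ (inner s)))) ⟩
    3 * 2 ^ inner t ∸ 2
      ≤⟨ m≤n+o⇒m∸n≤o (3 * 2 ^ inner t) 2 (≤-trans (rootedSubtrees-≥ t) (≤-reflexive (+-comm (rootedSubtrees t) 2))) ⟩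
    rootedSubtrees t              <⟨ heavier ⟩
    rootedSubtrees s
      ≤⟨ ≤-pred (≤-trans (rootedSubtrees-≤ s) (≤-reflexive (sym (complete-count (inner s))))) ⟩
    subtreeCount (CompleteTree.graph (inner s)) zero ∎)
  where open ≤-Reasoning

size-cancel-≤ : ∀ s t → size s ≤ size t → inner s ≤ inner t
size-cancel-≤ s t (s≤s le) = *-cancelˡ-≤ 2 le

-- Only sizes pass from one tree to the other: a head with at most `size s` vertices is no higher
-- than `s`, and the tail has at least the inner vertices of `t`.
crg-bound : ∀ {n l d} {G : Graph n} (s : Shape) {t : Shape} → n ≡ size s + size t → suc d + (suc d + depthˢ s) ≤ suc
      (inner t) →
            l ≤ size s → RootCountExceeds n l → IsCrg n l G → suc d ≤ centerCoreDist G
crg-bound {n} {l} {d} {G} s {t} n≡ room l≤ (R′ , r′ , rgood′ , exceeds)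
      (R , r , rgood , H , h , cat , peripheral , ident) =
  ≤-setDist G (center? G) (subtreeCore? G) d≤n λ {u} {v} Cu Sv →
    let x , φx≡v = Cr.core-in-head Sp.edge Sp.only RS.branch Sp.branch heavier Sv
    in subst (λ v → suc d ≤ dist G u v) φx≡v (far x Cu)
  where
  module RS = RGoodShape (rgoodShape rgood)
  module RS′ = RGoodShape (rgoodShape rgood′)

  acyclicR : Acyclic R
  acyclicR = isTree⇒acyclic R (proj₁ (proj₁ rgood))
  acyclicH : Acyclic H
  acyclicH = isTree⇒acyclic H (proj₁ (proj₁ cat))

  module Cr = Crg ident acyclicR acyclicH

  l<n : l < n
  l<n = <-≤-trans (s≤s (≤-trans l≤ (m≤m+n (size s) (2 * inner t))))
        (≤-reflexive (trans (sym (+-suc (size s) _)) (sym n≡)))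

  -- Because of `l < n` the caterpillar has at least two vertices, hence one other than `h`.
  module Sp = Spine (spine {H = H} cat peripheral (proj₂
        (other-vertex (≤-trans (s≤s (m<n⇒0<n∸m l<n)) (≤-reflexive (+-comm 1 (n ∸ l)))) h)))

  n≡′ : n ≡ l + size Sp.shape
  n≡′ = trans (sym (m+[n∸m]≡n (<⇒≤ l<n))) (cong (l +_) (suc-injective (trans (+-comm 1 (n ∸ l)) Sp.order)))

  -- The rgood trees in the bound on `l` and in the crg tree may be different copies; both counts
  -- come from `maxVal` at the same number.
  heavier : rootedSubtrees Sp.shape < rootedSubtrees RS.shape
  heavier = begin-strict
    rootedSubtrees Sp.shape              ≡⟨ m+n∸n≡m (rootedSubtrees Sp.shape) 2 ⟨
    rootedSubtrees Sp.shape + 2 ∸ 2      ≡⟨ cong (_∸ 2) (caterpillar-count Sp.slender) ⟩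
    3 * 2 ^ inner Sp.shape ∸ 2           ≡⟨ threshold l Sp.shape n≡′ ⟨
    3 * 2 ^ ((n ∸ l ∸ 1) / 2) ∸ 2        <⟨ exceeds ⟩
    subtreeCount R′ r′
      ≡⟨ suc-injective (trans RS′.count (trans (cong maxVal inner≡) (sym RS.value))) ⟩
    rootedSubtrees RS.shape              ∎
    where
    open ≤-Reasoning
    inner≡ : inner RS′.shape ≡ inner RS.shape
    inner≡ = *-cancelˡ-≡ _ _ 2 (suc-injective (trans (sym RS′.order) RS.order))

  inner-R : inner RS.shape ≤ inner s
  inner-R = size-cancel-≤ RS.shape s (≤-trans (≤-reflexive (sym RS.order)) l≤)

  inner-H : inner t ≤ inner Sp.shape
  inner-H = size-cancel-≤ t Sp.shape (+-cancelˡ-≤ l _ _ (≤-trans (+-monoˡ-≤ (size t) l≤)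
        (≤-reflexive (trans (sym n≡) n≡′))))

  room′ : suc d + (suc d + depthˢ RS.shape) ≤ suc (inner Sp.shape)
  room′ = ≤-trans (+-monoʳ-≤ (suc d) (+-monoʳ-≤ (suc d) (RS.depth-least {s} inner-R))) (≤-trans room (s≤s inner-H))

  -- Required because `setDist` is a minimum that includes the default value `n`.
  d≤n : suc d ≤ n
  d≤n = ≤-trans (m≤m+n (suc d) _) (≤-trans room′ (≤-trans (s≤s (m≤m+n (inner Sp.shape) _))
        (≤-trans (m≤n+m (size Sp.shape) l) (≤-reflexive (sym n≡′)))))

  shallow : ∀ x → dist R r x ≤ depthˢ RS.shape
  shallow x with p , refl ← root-cover acyclicR RS.branch x = ≤-trans (≤-reflexive (root-depth acyclicR RS.branch p))
        (depth-≤ p)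

  far : ∀ {u} x → Center G u → suc d ≤ dist G u (IsIdentification.φ ident x)
  -- The slack `o` goes to the far part of the spine, so that the two lengths add up to the
  -- eccentricity of `h`.
  far x Cu = let o , eq = m≤n⇒∃[o]m+o≡n room′ in
    Cr.center-distance peripheral shallow
      (trans Sp.ecc≡ (trans (sym eq) (+-assoc (suc d) (suc d + depthˢ RS.shape) o)))
      (m≤m+n (suc d + depthˢ RS.shape) o) x Cu

corollary3p10 : ∀ (n : ℕ) → n ≥ 12 →
    ∀ (T : Graph n) → IsBinaryTree T →
    ∀ (l : ℕ) → IsLeastOddExceeding n l →
    ∀ (G : Graph n) → IsCrg n l G →
    centerCoreDist T ≤ centerCoreDist G
corollary3p10 n n≥12 T binary l (_ , exceeds , least) G crg =
  conclude (centerCoreDist-≤ T binary (Fin.fromℕ< (≤-trans (s≤s z≤n) n≥12)))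
  where
  conclude : (∃ λ k → centerCoreDist T ≤ k × (k ≡ 0 ⊎ CoreEdge T binary k)) → centerCoreDist T ≤ centerCoreDist G
  conclude (zero  , D≤ , _)      = ≤-trans D≤ z≤n
  conclude (suc d , D≤ , inj₂ e) = ≤-trans D≤ (crg-bound near order room l≤ exceeds crg)
    where
    open CoreEdge {T = T} {binary} e
    l≤ : l ≤ size near
    l≤ = ≤-trans (least _ (odd-suc-double (inner near)) (complete-exceeds {s = near} {far} order heavier))
                 (≤-reflexive (cong (λ z → suc (inner near + z)) (sym (+-identityʳ (inner near)))))
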